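{- Let $k$ be a positive integer, let $G$ be a graph, let $x,y$ be two distinct vertices of $G$, and let $z$ be a vertex (where possibly $z\in\{x,y\}$ or $z\notin V(G)$). Suppose that $(G,x,y)$ is a $2$-connected rooted graph and that $\delta(G,x,y;z)\ge k+1$. Then $G$ contains $k$ admissible paths from $x$ to $y$.
   Context: All graphs are finite, undirected, without loops or multiple edges. A cut-vertex of $G$ is a vertex whose removal increases the number of components; a block is a maximal connected subgraph with no cut-vertex; an end-block is a block containing at most one cut-vertex of $G$ (if $G$ is connected with no cut-vertex, $G$ itself is an end-block). For distinct vertices $x,y$ of $G$, the triple $(G,x,y)$ is called a $2$-connected rooted graph if (R1) $G$ is a connected graph of order at least three with at most two end-blocks, and (R2) every end-block of $G$ contains at least one of $x$ and $y$ as a vertex which is not a cut-vertex of $G$. (Equivalently, the graph obtained from $G$ by adding the edge $xy$ if it is absent is $2$-connected.) For a vertex $z$ (allowed to be $x$, $y$, or not a vertex of $G$), define $\delta(G,x,y;z)=\min\{\deg_G(v): v\in V(G)\setminus\{x,y,z\}\}$ if $V(G)\setminus\{x,y,z\}\neq\emptyset$, and $\delta(G,x,y;z)=-\infty$ otherwise. A sequence of $k$ paths $P_1,\dots,P_k$ is admissible if $|E(P_1)|\ge 2$ and either $|E(P_{i+1})|-|E(P_i)|=1$ for all $1\le i\le k-1$, or $|E(P_{i+1})|-|E(P_i)|=2$ for all $1\le i\le k-1$. "$G$ contains $k$ admissible paths from $x$ to $y$" means there exist $k$ paths in $G$ with end-vertices $x$ and $y$ forming an admissible sequence. -}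

module Defs where

open import Data.Nat using (ℕ; zero; suc; _+_; _*_; _≤_)
open import Data.Fin using (Fin; zero; suc; toℕ; inject₁; fromℕ)
open import Data.Bool using (Bool; true; false; if_then_else_)
open import Data.List using (List; map; allFin)
open import Data.Nat.ListAction using (sum)
open import Data.Unit using (⊤)
open import Data.Maybe using (Maybe; just; nothing)
open import Data.Product using (Σ; _×_; _,_; ∃; ∃-syntax)
open import Data.Sum using (_⊎_)
open import Relation.Nullary using (¬_)
open import Relation.Binary.PropositionalEquality using (_≡_; _≢_)
open import Function.Definitions using (Injective)

record Graph (n : ℕ) : Set where
  field
    adj     : Fin n → Fin n → Bool
    adj-sym : ∀ u v → adj u v ≡ adj v u
    adj-irr : ∀ v → adj v v ≡ false

open Graph public

module _ {n : ℕ} (G : Graph n) where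

  Adj : Fin n → Fin n → Set
  Adj u v = adj G u v ≡ true

  deg : Fin n → ℕ
  deg v = sum (map (λ u → if adj G v u then 1 else 0) (allFin n))

  VSet : Set₁
  VSet = Fin n → Set

  data Reach (S : VSet) : Fin n → Fin n → Set where
    here : ∀ {a} → S a → Reach S a a
    step : ∀ {a b c} → S a → Adj a b → Reach S b c → Reach S a c

  ConnectedOn : VSet → Set
  ConnectedOn S = (∃[ a ] S a) × (∀ a b → S a → S b → Reach S a b)

  -- For a connected induced subgraph G[S], v ∈ S is a cut-vertex of G[S]
  -- iff G[S] - v has at least two components (removing v increases the
  -- number of components).
  CutVertexOn : VSet → Fin n → Set
  CutVertexOn S v = S v × (∃[ a ] ∃[ b ] (S a × S b × a ≢ v × b ≢ v ×
                      ¬ Reach (λ w → S w × w ≢ v) a b))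

  All : VSet
  All _ = ⊤

  Connected : Set
  Connected = ConnectedOn All

  CutVertex : Fin n → Set
  CutVertex = CutVertexOn All

  _⊆_ : VSet → VSet → Set
  S ⊆ T = ∀ v → S v → T v

  -- A block: a maximal (w.r.t. vertex inclusion) vertex set whose induced
  -- subgraph is connected and has no cut-vertex.  (Maximal connected
  -- subgraphs without cut-vertex are induced, so this is the usual notion.)
  IsBlockish : VSet → Set
  IsBlockish S = ConnectedOn S × (∀ v → ¬ CutVertexOn S v)

  IsBlock : VSet → Set₁
  IsBlock S = IsBlockish S × (∀ T → S ⊆ T → IsBlockish T → T ⊆ S)

  IsEndBlock : VSet → Set₁
  IsEndBlock B = IsBlock B ×
    (∀ u v → B u → B v → CutVertex u → CutVertex v → u ≡ v)

  SameSet : VSet → VSet → Set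
  SameSet S T = S ⊆ T × T ⊆ S

  TwoConnectedRooted : Fin n → Fin n → Set₁
  TwoConnectedRooted x y =
    x ≢ y ×
    (Connected × 3 ≤ n ×
      (∀ B₁ B₂ B₃ → IsEndBlock B₁ → IsEndBlock B₂ → IsEndBlock B₃ →
         SameSet B₁ B₂ ⊎ SameSet B₁ B₃ ⊎ SameSet B₂ B₃)) ×
    (∀ B → IsEndBlock B →
       (B x × ¬ CutVertex x) ⊎ (B y × ¬ CutVertex y))

  -- v ∉ {x, y, z}, where z : Maybe (Fin n) (nothing = z is not a vertex of G)
  NotRoot : Fin n → Fin n → Maybe (Fin n) → Fin n → Set
  NotRoot x y (just z) v = v ≢ x × v ≢ y × v ≢ z
  NotRoot x y nothing  v = v ≢ x × v ≢ y

  -- δ(G,x,y;z) ≥ m.  Since δ = -∞ when V(G)∖{x,y,z} = ∅, the inequality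
  -- requires this set to be non-empty and all its vertices to have degree ≥ m.
  δ≥ : Fin n → Fin n → Maybe (Fin n) → ℕ → Set
  δ≥ x y z m = (∃[ v ] NotRoot x y z v) × (∀ v → NotRoot x y z v → m ≤ deg v)

  record PathLen (x y : Fin n) (ℓ : ℕ) : Set where
    field
      vs     : Fin (suc ℓ) → Fin n
      inj    : Injective _≡_ _≡_ vs
      edges  : ∀ (i : Fin ℓ) → Adj (vs (inject₁ i)) (vs (suc i))
      start  : vs zero ≡ x
      finish : vs (fromℕ ℓ) ≡ y

  AdmissiblePaths : ℕ → Fin n → Fin n → Set
  AdmissiblePaths k x y =
    ∃[ ℓ₁ ] ∃[ d ] (2 ≤ ℓ₁ × (d ≡ 1 ⊎ d ≡ 2) ×
      (∀ (i : Fin k) → PathLen x y (ℓ₁ + toℕ i * d)))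

-- Induction on the graph without its roots x and y, given by its vertex set F and the
-- neighbourhoods P of x and Q of y; the degree of one exceptional vertex z is not bounded.
-- Next to x a core H is chosen from which paths of many lengths with common difference 1 or 2
-- emerge: a maximal clique of neighbours of x or, if these are independent, a complete
-- bipartite graph between a set T of neighbours of x and a set R, which may contain a clique.
-- In a part K of G − H − y attached to both H and y, with the attaching vertices of H taken as
-- one root, the induction hypothesis yields paths whose lengths add up with those in the core
-- to sufficiently many.  So unless the theorem holds no such K exists apart from z, and the
-- neighbours of y lie in the core, up to one exception.  This holds with x and y exchanged
-- as well, and comparing sizes leaves the case that x and y have the same neighbours apart
-- from z.  There one of these neighbours, q, is kept for the last step before y, and the
-- argument is repeated with N(q) in place of Q.
module Submission where

-- The induction runs on one count: the sums of two progressions with `r` and `m` terms and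
-- differences 1 or 2 contain such a progression with `r + m - 1` terms. So a core with `r` lengths
-- may cost a vertex of `K` at most `r - 1` of its degree, if membership in the new root's
-- neighbourhood is credited. The cores are maximal in order to guarantee this. The exceptional
-- vertex keeps the hypothesis applicable. A part that is not rooted is cut at a vertex `w`, and the
-- far side is a smaller part of the same kind, left through `w`. If the far side contains `z`, it
-- is discarded instead: `w` has lost neighbours and takes the place of `z` as the one exception.
-- The obstacle is that this can end in a single vertex `e` at which both roots are attached. If `e`
-- is not `z`, the same is tried behind `e`, and a second failure means that almost the whole degree
-- of `e` comes from the core, which bounds `k`. Then `e` prolongs the paths of the core by one
-- vertex, and most of the case work counts the lengths so obtained.

open import Defs using (Graph; adj; adj-sym; adj-irr)
open import Data.Bool using (Bool; true; false; if_then_else_; _∧_; _∨_; not)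
open import Data.Empty using (⊥; ⊥-elim)
open import Data.Fin using (Fin; zero; suc)
open import Data.Nat
open import Data.Nat.Properties
open import Data.Product using (_×_; _,_; proj₁; proj₂; ∃; ∃-syntax)
open import Data.Sum using (_⊎_; inj₁; inj₂; [_,_]′; map₂)
open import Function using (_∘_; id; case_of_)
open import Relation.Nullary using (¬_; Dec; yes; no; does)
open import Relation.Nullary.Decidable using (dec-true)
open import Relation.Binary.PropositionalEquality hiding (J)
import Data.Fin.Properties as Fin
open import Algebra.Properties.CommutativeSemigroup +-commutativeSemigroup using (interchange)

-- A hypothesis list entails a goal as soon as the coefficients of
-- goal-left + Σ hyp-right are dominated by those of goal-right + Σ hyp-left.
module Linear where

  open import Data.Vec using (Vec; []; _∷_; lookup; zipWith; replicate)
  open import Data.Vec.N-ary using (N-ary; ∀ⁿ; curryⁿ; _$ⁿ_)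

  infixl 6 _⊕_
  infix 4 _≼_
  infixr 3 _⇛_
  infix 3 ⊢_

  data Ex (v : ℕ) : Set where
    κ   : ℕ → Ex v
    ν   : Fin v → Ex v
    _⊕_ : Ex v → Ex v → Ex v

  record Ineq (v : ℕ) : Set where
    constructor _≼_
    field lhs rhs : Ex v
  open Ineq

  data Stmt (v : ℕ) : Set where
    ⊢_  : Ineq v → Stmt v
    _⇛_ : Ineq v → Stmt v → Stmt v

  NF : ℕ → Set
  NF v = ℕ × Vec ℕ v

  unit : ∀ {v} → Fin v → Vec ℕ v
  unit zero    = 1 ∷ replicate _ 0
  unit (suc i) = 0 ∷ unit i

  norm : ∀ {v} → Ex v → NF v
  norm (κ c)   = c , replicate _ 0
  norm (ν i)   = 0 , unit i
  norm (a ⊕ b) = let (c , f) = norm a ; (d , g) = norm b in c + d , zipWith _+_ f g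

  dot : ∀ {v} → Vec ℕ v → Vec ℕ v → ℕ
  dot []      []      = 0
  dot (a ∷ f) (x ∷ ρ) = a * x + dot f ρ

  value : ∀ {v} → Vec ℕ v → NF v → ℕ
  value ρ (c , f) = c + dot f ρ

  ⟦_⟧ : ∀ {v} → Ex v → Vec ℕ v → ℕ
  ⟦ κ c ⟧   ρ = c
  ⟦ ν i ⟧   ρ = lookup ρ i
  ⟦ a ⊕ b ⟧ ρ = ⟦ a ⟧ ρ + ⟦ b ⟧ ρ

  Holds : ∀ {v} → Stmt v → Vec ℕ v → Set
  Holds (⊢ (a ≼ b)) ρ    = ⟦ a ⟧ ρ ≤ ⟦ b ⟧ ρ
  Holds ((a ≼ b) ⇛ s) ρ = ⟦ a ⟧ ρ ≤ ⟦ b ⟧ ρ → Holds s ρ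

  dot-zero : ∀ {v} (ρ : Vec ℕ v) → dot (replicate _ 0) ρ ≡ 0
  dot-zero []      = refl
  dot-zero (x ∷ ρ) = dot-zero ρ

  dot-unit : ∀ {v} (i : Fin v) (ρ : Vec ℕ v) → dot (unit i) ρ ≡ lookup ρ i
  dot-unit zero    (x ∷ ρ) rewrite dot-zero ρ | +-identityʳ x = +-identityʳ x
  dot-unit (suc i) (x ∷ ρ) = dot-unit i ρ

  dot-+ : ∀ {v} (f g ρ : Vec ℕ v) → dot (zipWith _+_ f g) ρ ≡ dot f ρ + dot g ρ
  dot-+ []      []      []      = refl
  dot-+ (a ∷ f) (b ∷ g) (x ∷ ρ)
    rewrite dot-+ f g ρ | *-distribʳ-+ x a b = interchange (a * x) (b * x) (dot f ρ) (dot g ρ)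

  norm-sound : ∀ {v} (e : Ex v) ρ → ⟦ e ⟧ ρ ≡ value ρ (norm e)
  norm-sound (κ c)   ρ rewrite dot-zero ρ = sym (+-identityʳ c)
  norm-sound (ν i)   ρ = sym (dot-unit i ρ)
  norm-sound (a ⊕ b) ρ rewrite norm-sound a ρ | norm-sound b ρ
    | dot-+ (proj₂ (norm a)) (proj₂ (norm b)) ρ =
    interchange (proj₁ (norm a)) (dot (proj₂ (norm a)) ρ) (proj₁ (norm b)) (dot (proj₂ (norm b)) ρ)

  dominated : ∀ {v} → Vec ℕ v → Vec ℕ v → Bool
  dominated []      []      = true
  dominated (a ∷ f) (b ∷ g) = (a ≤ᵇ b) ∧ dominated f g

  ∧-true : ∀ {a b} → a ∧ b ≡ true → a ≡ true × b ≡ true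
  ∧-true {true} {true} _ = refl , refl

  ≤ᵇ-true : ∀ {a b} → (a ≤ᵇ b) ≡ true → a ≤ b
  ≤ᵇ-true {a} {b} e = ≤ᵇ⇒≤ a b (subst Data.Bool.T (sym e) _)

  dominated-sound : ∀ {v} (f g ρ : Vec ℕ v) → dominated f g ≡ true → dot f ρ ≤ dot g ρ
  dominated-sound []      []      []      _ = z≤n
  dominated-sound (a ∷ f) (b ∷ g) (x ∷ ρ) e with ∧-true {a ≤ᵇ b} e
  ... | p , q = +-mono-≤ (*-monoˡ-≤ x (≤ᵇ-true {a} {b} p)) (dominated-sound f g ρ q)

  check : ∀ {v} → Ex v → Ex v → Stmt v → Bool
  check l r ((a ≼ b) ⇛ s) = check (l ⊕ a) (r ⊕ b) s
  check l r (⊢ (a ≼ b)) with norm (a ⊕ r) | norm (b ⊕ l)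
  ... | c , f | d , g = (c ≤ᵇ d) ∧ dominated f g

  sound : ∀ {v} (l r : Ex v) s ρ → check l r s ≡ true → ⟦ l ⟧ ρ ≤ ⟦ r ⟧ ρ → Holds s ρ
  sound l r ((a ≼ b) ⇛ s) ρ e h k = sound (l ⊕ a) (r ⊕ b) s ρ e (+-mono-≤ h k)
  sound l r (⊢ (a ≼ b)) ρ e h =
    +-cancelʳ-≤ (⟦ r ⟧ ρ) (⟦ a ⟧ ρ) (⟦ b ⟧ ρ) (≤-trans main (+-monoʳ-≤ (⟦ b ⟧ ρ) h))
    where
    split = ∧-true {proj₁ (norm (a ⊕ r)) ≤ᵇ proj₁ (norm (b ⊕ l))} e
    main : ⟦ a ⊕ r ⟧ ρ ≤ ⟦ b ⊕ l ⟧ ρ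
    main rewrite norm-sound (a ⊕ r) ρ | norm-sound (b ⊕ l) ρ =
      +-mono-≤ (≤ᵇ-true {proj₁ (norm (a ⊕ r))} (proj₁ split))
        (dominated-sound (proj₂ (norm (a ⊕ r))) (proj₂ (norm (b ⊕ l))) ρ (proj₂ split))

  -- `refl` runs the check, the coefficients being closed. Every hypothesis enters with coefficient
  -- 1, so one that is needed twice is listed twice.
  lin : ∀ v (f : N-ary v (Ex v) (Stmt v)) →
        let s = f $ⁿ Data.Vec.map ν (Data.Vec.allFin v) in
        check (κ 0) (κ 0) s ≡ true → ∀ⁿ v (curryⁿ (Holds s))
  lin v f e = curry∀ v λ ρ → sound (κ 0) (κ 0) (f $ⁿ Data.Vec.map ν (Data.Vec.allFin v)) ρ e z≤n
    where
    curry∀ : ∀ v {B : Vec ℕ v → Set} → (∀ ρ → B ρ) → ∀ⁿ v (curryⁿ B)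
    curry∀ zero    h = h []
    curry∀ (suc v) h = λ x → curry∀ v (λ ρ → h (x ∷ ρ))

open Linear using (lin; κ; _⊕_; _≼_; _⇛_; ⊢_)

-- Finite vertex sets and their sizes.

module Finite where

  infixl 7 _∖_ _─_
  infixl 6 _∪_
  infixl 8 _∩_
  infix 4 _∈_ _∉_ _⊑_

  Sub : ℕ → Set
  Sub n = Fin n → Bool

  -- A record instead of the bare equation, so that `u` and `S` are found by unification; the set
  -- operations below are opaque for the same reason.
  record _∈_ {n} (u : Fin n) (S : Sub n) : Set where
    constructor mem
    field holds : S u ≡ true
  open _∈_ public

  _∉_ : ∀ {n} → Fin n → Sub n → Set
  u ∉ S = ¬ (u ∈ S)

  _⊑_ : ∀ {n} → Sub n → Sub n → Set
  S ⊑ R = ∀ {u} → u ∈ S → u ∈ R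

  Disjoint : ∀ {n} → Sub n → Sub n → Set
  Disjoint S R = ∀ {u} → u ∈ S → u ∉ R

  opaque
    _∈?_ : ∀ {n} (u : Fin n) (S : Sub n) → Dec (u ∈ S)
    u ∈? S with S u in eq
    ... | true  = yes (mem eq)
    ... | false = no λ m → case trans (sym eq) (holds m) of λ ()

  opaque

    _∪_ _∩_ _─_ : ∀ {n} → Sub n → Sub n → Sub n
    (S ∪ R) u = S u ∨ R u
    (S ∩ R) u = S u ∧ R u
    (S ─ R) u = S u ∧ not (R u)

    ｛_｝ : ∀ {n} → Fin n → Sub n
    ｛ a ｝ u = does (u Fin.≟ a)

    _∖_ : ∀ {n} → Sub n → Fin n → Sub n
    S ∖ a = S ─ ｛ a ｝

    ∅ : ∀ {n} → Sub n
    ∅ _ = false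

    set : ∀ {n} {X : Fin n → Set} → (∀ u → Dec (X u)) → Sub n
    set X? u = does (X? u)

  module _ {n : ℕ} {u : Fin n} where

    opaque
      unfolding _∪_ _∩_ _─_ ｛_｝ _∖_ ∅ set

      ∈set : {X : Fin n → Set} (X? : ∀ u → Dec (X u)) → X u → u ∈ set X?
      ∈set X? x = mem (dec-true (X? u) x)

      set∈ : {X : Fin n → Set} (X? : ∀ u → Dec (X u)) → u ∈ set X? → X u
      set∈ X? (mem e) with X? u
      ... | yes x = x

      ∉∅ : u ∉ ∅
      ∉∅ (mem ())

      ∈｛｝ : u ∈ ｛ u ｝
      ∈｛｝ = mem (dec-true (u Fin.≟ u) refl)

      ｛｝∈ : ∀ {a} → u ∈ ｛ a ｝ → u ≡ a
      ｛｝∈ {a} = set∈ (Fin._≟ a)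

    module _ {S R : Sub n} where

      opaque
        unfolding _∪_ _∩_ _─_ ｛_｝ _∖_ ∅ set

        ∪ˡ : u ∈ S → u ∈ S ∪ R
        ∪ˡ (mem e) = mem (cong (_∨ R u) e)

        ∪ʳ : u ∈ R → u ∈ S ∪ R
        ∪ʳ (mem e) with S u in eq
        ... | true  = mem (cong (_∨ R u) eq)
        ... | false = mem (trans (cong (_∨ R u) eq) e)

        ∪⁻ : u ∈ S ∪ R → u ∈ S ⊎ u ∈ R
        ∪⁻ (mem e) with S u in eq
        ... | true  = inj₁ (mem eq)
        ... | false = inj₂ (mem e)

        ∩⁺ : u ∈ S → u ∈ R → u ∈ S ∩ R
        ∩⁺ (mem e) (mem f) = mem (cong₂ _∧_ e f)

        ∩ˡ : u ∈ S ∩ R → u ∈ S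
        ∩ˡ (mem e) with S u in eq
        ... | true = mem eq

        ∩ʳ : u ∈ S ∩ R → u ∈ R
        ∩ʳ (mem e) with S u
        ... | true = mem e

        ─⁺ : u ∈ S → u ∉ R → u ∈ S ─ R
        ─⁺ (mem e) h with R u in eq
        ... | true  = ⊥-elim (h (mem eq))
        ... | false = mem (cong₂ _∧_ e (cong not eq))

        ─ˡ : u ∈ S ─ R → u ∈ S
        ─ˡ (mem e) with S u in eq
        ... | true = mem eq

        ─ʳ : u ∈ S ─ R → u ∉ R
        ─ʳ (mem e) (mem f) with S u | R u
        ─ʳ (mem ()) (mem refl) | true  | true
        ─ʳ (mem ()) (mem refl) | false | true

    module _ {S : Sub n} where

      opaque
        unfolding _∪_ _∩_ _─_ ｛_｝ _∖_ ∅ set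

        ∖⁺ : ∀ {a} → u ∈ S → u ≢ a → u ∈ S ∖ a
        ∖⁺ s h = ─⁺ s (h ∘ ｛｝∈)

        ∖ˡ : ∀ {a} → u ∈ S ∖ a → u ∈ S
        ∖ˡ = ─ˡ {R = ｛ _ ｝}

        ∖ʳ : ∀ {a} → u ∈ S ∖ a → u ≢ a
        ∖ʳ m refl = ─ʳ {S = S} m ∈｛｝

  ∉∖ : ∀ {n} {a : Fin n} {S} → a ∉ S ∖ a
  ∉∖ m = ∖ʳ m refl

  opaque
    search : ∀ {n} {X Y : Fin n → Set} → (∀ u → X u ⊎ Y u) → (∀ u → X u) ⊎ ∃ Y
    search {zero}  f = inj₁ λ ()
    search {suc n} f with f zero | search (λ u → f (suc u))
    ... | inj₂ y | _            = inj₂ (zero , y)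
    ... | inj₁ _ | inj₂ (u , y) = inj₂ (suc u , y)
    ... | inj₁ x | inj₁ g       = inj₁ λ { zero → x ; (suc u) → g u }

  opaque
    find : ∀ {n} (S : Sub n) → (∀ u → u ∉ S) ⊎ (∃[ u ] u ∈ S)
    find S = search λ u → case u ∈? S of λ { (yes m) → inj₂ m ; (no h) → inj₁ h }

  bit : Bool → ℕ
  bit b = if b then 1 else 0

  total : ∀ {n} → (Fin n → ℕ) → ℕ
  total {zero}  f = 0
  total {suc n} f = f zero + total (f ∘ suc)

  # : ∀ {n} → Sub n → ℕ
  # S = total (bit ∘ S)

  total-mono : ∀ {n} {f g : Fin n → ℕ} → (∀ u → f u ≤ g u) → total f ≤ total g
  total-mono {zero}  h = z≤n
  total-mono {suc n} h = +-mono-≤ (h zero) (total-mono (h ∘ suc))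

  total-+ : ∀ {n} (f g : Fin n → ℕ) → total (λ u → f u + g u) ≡ total f + total g
  total-+ {zero}  f g = refl
  total-+ {suc n} f g rewrite total-+ (f ∘ suc) (g ∘ suc) =
    interchange (f zero) (g zero) (total (f ∘ suc)) (total (g ∘ suc))

  bit≤1 : ∀ b → bit b ≤ 1
  bit≤1 true  = s≤s z≤n
  bit≤1 false = z≤n

  bit-true : ∀ {n} {S : Sub n} {u} → u ∈ S → bit (S u) ≡ 1
  bit-true (mem e) rewrite e = refl

  bit-false : ∀ {n} {S : Sub n} {u} → u ∉ S → bit (S u) ≡ 0
  bit-false {S = S} {u} h with S u in eq
  ... | true  = ⊥-elim (h (mem eq))
  ... | false = refl

  bit-mono : ∀ {n} {S : Sub n} {m} {R : Sub m} {u v} → (u ∈ S → v ∈ R) → bit (S u) ≤ bit (R v)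
  bit-mono {S = S} {u = u} h with u ∈? S
  ... | yes m rewrite bit-true m | bit-true (h m) = ≤-refl
  ... | no k  rewrite bit-false k = z≤n

  module _ {n : ℕ} where

    #-mono : {S R : Sub n} → S ⊑ R → # S ≤ # R
    #-mono {S} {R} h = total-mono λ u → bit-mono {S = S} {R = R} {u} {u} h

    #-cover : {S R R′ : Sub n} → (∀ {u} → u ∈ S → u ∈ R ⊎ u ∈ R′) → # S ≤ # R + # R′
    #-cover {S} {R} {R′} h = subst (# S ≤_) (total-+ (bit ∘ R) (bit ∘ R′)) (total-mono pt)
      where
      pt : ∀ u → bit (S u) ≤ bit (R u) + bit (R′ u)
      pt u with u ∈? S
      ... | no k rewrite bit-false k = z≤n
      ... | yes m rewrite bit-true m with h m
      ... | inj₁ r rewrite bit-true r = s≤s z≤n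
      ... | inj₂ r rewrite bit-true r = m≤n+m 1 _

    #-disjoint : {S R R′ : Sub n} → R ⊑ S → R′ ⊑ S → Disjoint R R′ → # R + # R′ ≤ # S
    #-disjoint {S} {R} {R′} i j d = subst (_≤ # S) (total-+ (bit ∘ R) (bit ∘ R′)) (total-mono pt)
      where
      pt : ∀ u → bit (R u) + bit (R′ u) ≤ bit (S u)
      pt u with u ∈? R | u ∈? R′
      ... | yes m | yes m′ = ⊥-elim (d m m′)
      ... | yes m | no k rewrite bit-true m | bit-false k | bit-true (i m) = ≤-refl
      ... | no k | yes m rewrite bit-true m | bit-false k | bit-true (j m) = ≤-refl
      ... | no k | no k′ rewrite bit-false k | bit-false k′ = z≤n

  opaque
    unfolding ∅ ｛_｝ set

    #∅ : ∀ {n} → # {n} ∅ ≡ 0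
    #∅ {zero}  = refl
    #∅ {suc n} = #∅ {n}

    #｛｝ : ∀ {n} (a : Fin n) → # ｛ a ｝ ≡ 1
    #｛｝ {suc n} zero    = cong suc (#∅ {n})
    #｛｝ {suc n} (suc a) = #｛｝ a

  #-empty : ∀ {n} {S : Sub n} → (∀ u → u ∉ S) → # S ≤ 0
  #-empty {n} {S} h = subst (# S ≤_) (#∅ {n}) (#-mono {S = S} {∅} λ {u} m → ⊥-elim (h u m))

  module _ {n : ℕ} where

    #-member : {S : Sub n} {a : Fin n} → a ∈ S → 1 ≤ # S
    #-member {S} {a} m = subst (_≤ # S) (#｛｝ a) (#-mono λ { {u} k → subst (_∈ S) (sym (｛｝∈ k)) m })

    #-single : {S : Sub n} (a : Fin n) → (∀ {u} → u ∈ S → u ≡ a) → # S ≤ 1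
    #-single {S} a h = subst (# S ≤_) (#｛｝ a) (#-mono λ m → subst (_∈ ｛ a ｝) (sym (h m)) ∈｛｝)

    #-pick : {S : Sub n} → 1 ≤ # S → ∃[ u ] u ∈ S
    #-pick {S} h with find S
    ... | inj₂ w = w
    ... | inj₁ k = ⊥-elim (1+n≰n (≤-trans h (#-empty k)))

    #-∖ : (S : Sub n) (a : Fin n) → # S ≤ # (S ∖ a) + 1
    #-∖ S a = subst (λ t → # S ≤ # (S ∖ a) + t) (#｛｝ a) (#-cover {R′ = ｛ a ｝} go)
      where
      go : ∀ {u} → u ∈ S → u ∈ S ∖ a ⊎ u ∈ ｛ a ｝
      go {u} m with u Fin.≟ a
      ... | yes refl = inj₂ ∈｛｝
      ... | no h     = inj₁ (∖⁺ m h)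

    #-∖< : {S : Sub n} {a : Fin n} → a ∈ S → # (S ∖ a) + 1 ≤ # S
    #-∖< {S} {a} m = subst (λ t → # (S ∖ a) + t ≤ # S) (#｛｝ a)
      (#-disjoint {R′ = ｛ a ｝} ∖ˡ (λ k → subst (_∈ S) (sym (｛｝∈ k)) m) (λ s k → ∖ʳ s (｛｝∈ k)))

    #-strict : {S R : Sub n} {a : Fin n} → S ⊑ R → a ∈ R → a ∉ S → # S < # R
    #-strict {S} {R} {a} i m h = subst (_≤ # R) (+-comm (# S) 1)
      (≤-trans (+-monoˡ-≤ 1 (#-mono {R = R ∖ a} λ s → ∖⁺ (i s) λ { refl → h s })) (#-∖< m))

    #-pick≢ : {S : Sub n} (a : Fin n) → 2 ≤ # S → ∃[ u ] u ∈ S × u ≢ a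
    #-pick≢ {S} a h with #-pick (+-cancelʳ-≤ 1 1 (# (S ∖ a)) (≤-trans h (#-∖ S a)))
    ... | u , m = u , ∖ˡ m , ∖ʳ m

open Finite

-- Paths, components and the arithmetic of path sizes.

module Walks {n : ℕ} (G : Graph n) where

  infix 4 _~_

  V : Set
  V = Fin n

  N : V → Sub n
  N u w = adj G u w

  _~_ : V → V → Set
  u ~ w = w ∈ N u

  ~-sym : ∀ {u w} → u ~ w → w ~ u
  ~-sym {u} {w} (mem e) = mem (trans (adj-sym G w u) e)

  ~-irr : ∀ {u} → ¬ (u ~ u)
  ~-irr {u} (mem e) with trans (sym e) (adj-irr G u)
  ... | ()

  ~⇒≢ : ∀ {u w} → u ~ w → u ≢ w
  ~⇒≢ e refl = ~-irr e

  dg : Sub n → V → ℕ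
  dg S u = # (N u ∩ S)

  dg-cover : ∀ {S R R′ u} → (∀ {w} → u ~ w → w ∈ S → w ∈ R ⊎ w ∈ R′) → dg S u ≤ dg R u + dg R′ u
  dg-cover {S} {R} {R′} {u} h = #-cover {R = N u ∩ R} {N u ∩ R′} λ m → go (h (∩ˡ m) (∩ʳ {S = N u} m)) (∩ˡ m)
    where
    go : ∀ {w} → w ∈ R ⊎ w ∈ R′ → u ~ w → w ∈ N u ∩ R ⊎ w ∈ N u ∩ R′
    go (inj₁ r) a = inj₁ (∩⁺ a r)
    go (inj₂ r) a = inj₂ (∩⁺ a r)

  dg-mono : ∀ {S R u} → (∀ {w} → u ~ w → w ∈ S → w ∈ R) → dg S u ≤ dg R u
  dg-mono {S} {R} {u} h = #-mono {R = N u ∩ R} λ m → ∩⁺ (∩ˡ m) (h (∩ˡ m) (∩ʳ {S = N u} m))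

  dg≤# : ∀ S u → dg S u ≤ # S
  dg≤# S u = #-mono {R = S} (∩ʳ {S = N u})

  dg-zero : ∀ {S u} → (∀ {w} → u ~ w → w ∉ S) → dg S u ≤ 0
  dg-zero {S} {u} h = #-empty {S = N u ∩ S} λ w m → h (∩ˡ m) (∩ʳ {S = N u} m)

  dg-pos : ∀ {S u w} → u ~ w → w ∈ S → 1 ≤ dg S u
  dg-pos {S} {u} a s = #-member {S = N u ∩ S} (∩⁺ a s)

  dg-one : ∀ {S u} a → (∀ {w} → u ~ w → w ∈ S → w ≡ a) → dg S u ≤ bit (N a u)
  dg-one {S} {u} a h with u ∈? N a
  ... | yes m rewrite bit-true m = #-single {S = N u ∩ S} a λ k → h (∩ˡ k) (∩ʳ {S = N u} k)
  ... | no k rewrite bit-false k = dg-zero {S} λ e s → k (subst (_~ u) (h e s) (~-sym e))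

  -- A walk removes each vertex it leaves from the set still available,
  -- so it is a path; the last index counts its vertices.
  data Walk : Sub n → V → V → ℕ → Set where
    one  : ∀ {S u} → u ∈ S → Walk S u u 1
    cons : ∀ {S u v w c} → u ∈ S → u ~ v → Walk (S ∖ u) v w c → Walk S u w (suc c)

  walk-mono : ∀ {S R u v c} → S ⊑ R → Walk S u v c → Walk R u v c
  walk-mono i (one s)      = one (i s)
  walk-mono i (cons s e p) = cons (i s) e (walk-mono (λ m → ∖⁺ (i (∖ˡ m)) (∖ʳ m)) p)

  walk-start : ∀ {S u v c} → Walk S u v c → u ∈ S
  walk-start (one s)      = s
  walk-start (cons s _ _) = s

  walk-end : ∀ {S u v c} → Walk S u v c → v ∈ S
  walk-end (one s)      = s
  walk-end (cons _ _ p) = ∖ˡ (walk-end p)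

  walk-++ : ∀ {S R u v w x c d} → Walk S u v c → v ~ w → Walk R w x d → Disjoint S R → Walk (S ∪ R) u x (c + d)
  walk-++ {S} {R} (one s) e q dj = cons (∪ˡ s) e (walk-mono (λ r → ∖⁺ (∪ʳ {S = S} r) λ { refl → dj s r }) q)
  walk-++ {S} {R} (cons {u = u} s f p) e q dj =
    cons (∪ˡ s) f (walk-mono incl (walk-++ p e q (dj ∘ ∖ˡ)))
    where
    incl : (S ∖ u) ∪ R ⊑ (S ∪ R) ∖ u
    incl m with ∪⁻ {S = S ∖ u} m
    ... | inj₁ a = ∖⁺ (∪ˡ (∖ˡ a)) (∖ʳ a)
    ... | inj₂ r = ∖⁺ (∪ʳ {S = S} r) λ { refl → dj s r }

  walk-rev : ∀ {S u v c} → Walk S u v c → Walk S v u c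
  walk-rev (one s) = one s
  walk-rev {S} {u} {v} (cons {c = c} s e p) =
    subst (Walk S v u) (+-comm c 1)
      (walk-mono incl (walk-++ (walk-rev p) (~-sym e) (one (∈｛｝ {u = u})) (λ m k → ∖ʳ m (｛｝∈ k))))
    where
    incl : (S ∖ u) ∪ ｛ u ｝ ⊑ S
    incl m with ∪⁻ {S = S ∖ u} m
    ... | inj₁ a = ∖ˡ a
    ... | inj₂ a = subst (_∈ S) (sym (｛｝∈ a)) s

  record Closed (S C : Sub n) : Set where
    field
      sub : C ⊑ S
      cl  : ∀ {u w} → u ∈ C → w ∈ S → u ~ w → w ∈ C
  open Closed public

  walk-closed : ∀ {S C u v c} → Closed S C → Walk S u v c → u ∈ C → v ∈ C
  walk-closed k p = go id p
    where
    go : ∀ {R u v c} → R ⊑ _ → Walk R u v c → u ∈ _ → v ∈ _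
    go i (one _)      m = m
    go i (cons s e p) m = go (i ∘ ∖ˡ) p (cl k m (i (∖ˡ (walk-start p))) e)

  record Comp (S : Sub n) (a : V) : Set where
    field
      D      : Sub n
      closed : Closed S D
      base   : a ∈ D
      reach  : ∀ {u} → u ∈ D → ∃[ c ] Walk D a u c

  module _ (S : Sub n) (a : V) where

    private
      grow : ∀ m D → D ⊑ S → a ∈ D → (∀ {u} → u ∈ D → ∃[ c ] Walk D a u c) → # S ≤ # D + m → Comp S a
      grow m D i b r h with search exits
        where
        exits : ∀ w → (∀ u → u ∈ D → w ∈ S → u ~ w → w ∈ D) ⊎ (∃[ u ] u ∈ D × w ∈ S × w ∉ D × u ~ w)
        exits w = search λ u → case u ∈? D of λ
          { (no k) → inj₁ (⊥-elim ∘ k)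
          ; (yes d) → case w ∈? S of λ
            { (no k) → inj₁ λ _ s → ⊥-elim (k s)
            ; (yes s) → case w ∈? D of λ
              { (yes e) → inj₁ λ _ _ _ → e
              ; (no k) → case w ∈? N u of λ
                { (yes e) → inj₂ (d , s , k , e)
                ; (no l) → inj₁ λ _ _ e → ⊥-elim (l e) } } } }
      ... | inj₁ k = record { D = D ; closed = record { sub = i ; cl = λ {u} {w} d s e → k w u d s e } ; base = b ; reach = r }
      grow zero D i b r h | inj₂ (w , u , d , s , k , e) =
        ⊥-elim (<⇒≱ (#-strict i s k) (subst (# S ≤_) (+-identityʳ (# D)) h))
      grow (suc m) D i b r h | inj₂ (w , u , d , s , k , e) =
        grow m (D ∪ ｛ w ｝) incl (∪ˡ b) reach′
          (≤-trans h (subst (_≤ # (D ∪ ｛ w ｝) + m) (sym (+-suc (# D) m))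
            (+-monoˡ-≤ m (#-strict ∪ˡ (∪ʳ {S = D} ∈｛｝) k))))
        where
        incl : D ∪ ｛ w ｝ ⊑ S
        incl m with ∪⁻ {S = D} m
        ... | inj₁ x = i x
        ... | inj₂ x = subst (_∈ S) (sym (｛｝∈ x)) s
        reach′ : ∀ {v} → v ∈ D ∪ ｛ w ｝ → ∃[ c ] Walk (D ∪ ｛ w ｝) a v c
        reach′ m with ∪⁻ {S = D} m
        ... | inj₁ x = _ , walk-mono ∪ˡ (proj₂ (r x))
        ... | inj₂ x with ｛｝∈ x
        ... | refl = _ , walk-++ (proj₂ (r d)) e (one ∈｛｝) (λ y z → k (subst (_∈ D) (｛｝∈ z) y))

    opaque
      comp : a ∈ S → Comp S a
      comp s = grow (# S) ｛ a ｝ (λ m → subst (_∈ S) (sym (｛｝∈ m)) s) ∈｛｝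
        (λ m → 1 , subst (λ t → Walk ｛ a ｝ a t 1) (sym (｛｝∈ m)) (one ∈｛｝)) (m≤n+m (# S) _)

  opaque
    comp-minimal : ∀ {S a} (K : Comp S a) {C u} → Closed (Comp.D K) C → u ∈ C → a ∈ C
    comp-minimal K c m = walk-closed c (walk-rev (proj₂ (Comp.reach K (sub c m)))) m

  -- The size `c` counts vertices other than `x` and `y`: with `P` and `Q` as their neighbourhoods
  -- it stands for an `x`-`y` path with `c + 1` edges.
  AB : Sub n → Sub n → Sub n → ℕ → Set
  AB F P Q c = ∃[ s ] ∃[ t ] (s ∈ P × t ∈ Q × Walk F s t c)

  Adm : ℕ → Sub n → Sub n → Sub n → Set
  Adm k F P Q = ∃[ a ] ∃[ d ] ((d ≡ 1 ⊎ d ≡ 2) × (∀ i → i < k → AB F P Q (a + i * d)))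

  AB-rev : ∀ {F P Q c} → AB F P Q c → AB F Q P c
  AB-rev (s , t , p , q , w) = t , s , q , p , walk-rev w

  Adm-rev : ∀ {k F P Q} → Adm k F P Q → Adm k F Q P
  Adm-rev (a , d , e , f) = a , d , e , λ i l → AB-rev (f i l)

  -- How `u` is reached from `x`: directly, or after `c` vertices of `X`. Read backwards with `Q`
  -- for `P`, it describes the way from `u` to `y`.
  Pre : Sub n → Sub n → ℕ → V → Set
  Pre P X c u = (c ≡ 0 × u ∈ P) ⊎ (∃[ s ] ∃[ t ] (s ∈ P × Walk X s t c × t ~ u))

  glue : ∀ {F P Q X K L c d e u w} → X ⊑ F → K ⊑ F → L ⊑ F → Disjoint X K → Disjoint X L → Disjoint K L →
         Pre P X c u → Walk K u w d → Pre Q L e w → AB F P Q (c + d + e)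
  glue {F} {P} {Q} {X} {K} {L} {c} {d} {e} {u} {w} xf kf lf xk xl kl pre p suf = ends suf (begins pre)
    where
    begins : Pre P X c u → ∃[ s ] (s ∈ P × Walk (X ∪ K) s w (c + d))
    begins (inj₁ (refl , m)) = u , m , walk-mono (∪ʳ {S = X}) p
    begins (inj₂ (s , t , m , q , a)) = s , m , walk-++ q a p xk
    sub₂ : X ∪ K ⊑ F
    sub₂ m with ∪⁻ {S = X} m
    ... | inj₁ x = xf x
    ... | inj₂ x = kf x
    sub₃ : (X ∪ K) ∪ L ⊑ F
    sub₃ m with ∪⁻ {S = X ∪ K} m
    ... | inj₁ x = sub₂ x
    ... | inj₂ x = lf x
    dis : Disjoint (X ∪ K) L
    dis m l with ∪⁻ {S = X} m
    ... | inj₁ x = xl x l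
    ... | inj₂ x = kl x l
    ends : Pre Q L e w → ∃[ s ] (s ∈ P × Walk (X ∪ K) s w (c + d)) → AB F P Q (c + d + e)
    ends (inj₁ (refl , m)) (s , a , q) =
      s , w , a , m , subst (Walk F s w) (sym (+-identityʳ (c + d))) (walk-mono sub₂ q)
    ends (inj₂ (s′ , t′ , m , q′ , b)) (s , a , q) =
      s , s′ , a , m , walk-mono sub₃ (walk-++ q (~-sym b) (walk-rev q′) dis)

  opaque
    -- With equal differences the sums `i + j` run from 0 to `r + m - 2`. With differences 1 and 2,
    -- single steps fill the gaps between double ones as soon as the progression of difference 1 has
    -- two terms; if it has one, it only shifts the other.
    sumset : ∀ {d d′} r m k → (d ≡ 1 ⊎ d ≡ 2) → (d′ ≡ 1 ⊎ d′ ≡ 2) → 1 ≤ r → 1 ≤ m → k < r + m →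
      ∃[ D ] ((D ≡ 1 ⊎ D ≡ 2) × (∀ t → t < k → ∃[ i ] ∃[ j ] (i < r × j < m × i * d + j * d′ ≡ t * D)))
    sumset (suc r₀) (suc m₀) k ed₀ ed₀′ _ _ h₀ = go r₀ m₀ h₀ ed₀ ed₀′
      where
      open ≡-Reasoning
      same : ∀ {d} r m t → t < r + suc m → ∃[ i ] ∃[ j ] (i < suc r × j < suc m × i * d + j * d ≡ t * d)
      same zero    m t       l = 0 , t , s≤s z≤n , l , refl
      same (suc r) m zero    l = 0 , 0 , s≤s z≤n , s≤s z≤n , refl
      same {d} (suc r) m (suc t) (s≤s l) with same {d} r m t l
      ... | i , j , a , b , e = suc i , j , s≤s a , b , trans (+-assoc d (i * d) (j * d)) (cong (d +_) e)
      -- With unit steps on one side, once those are used up the other side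
      -- advances by two while the unit side alternates between its last two values.
      climb : ∀ r t → ∃[ i ] ∃[ j ] (i ≤ suc r × j ≤ t × i * 1 + j * 2 ≡ suc r + t)
      climb r zero = suc r , 0 , ≤-refl , z≤n , cong (_+ 0) (*-identityʳ (suc r))
      climb r (suc zero) = r , 1 , n≤1+n r , ≤-refl , trans (cong (_+ 2) (*-identityʳ r)) (+-suc r 1)
      climb r (suc (suc t)) with climb r t
      ... | i , j , a , b , e = i , suc j , a , s≤s (m≤n⇒m≤1+n b) , (begin
        i * 1 + (2 + j * 2)   ≡⟨ sym (+-assoc (i * 1) 2 (j * 2)) ⟩
        i * 1 + 2 + j * 2     ≡⟨ cong (_+ j * 2) (+-comm (i * 1) 2) ⟩
        2 + (i * 1 + j * 2)   ≡⟨ cong (2 +_) e ⟩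
        2 + (suc r + t)       ≡⟨ sym (trans (+-suc (suc r) (suc t)) (cong suc (+-suc (suc r) t))) ⟩
        suc r + suc (suc t)   ∎)
      mixed : ∀ r m t → t < suc r + suc m → ∃[ i ] ∃[ j ] (i < suc (suc r) × j < suc m × i * 1 + j * 2 ≡ t * 1)
      mixed r m t l with t ≤? suc r
      ... | yes a = t , 0 , s≤s a , s≤s z≤n , +-identityʳ (t * 1)
      ... | no a with climb r (t ∸ suc r)
      ... | i , j , x , y , e = i , j , s≤s x , s≤s (≤-trans y b) , trans e (trans (m+[n∸m]≡n (<⇒≤ (≰⇒> a))) (sym (*-identityʳ t)))
        where
        b : t ∸ suc r ≤ m
        b = m≤n+o⇒m∸n≤o t (suc r) (≤-pred (≤-trans l (≤-reflexive (+-suc (suc r) m))))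
      go : ∀ {d d′} r m → k < suc r + suc m → (d ≡ 1 ⊎ d ≡ 2) → (d′ ≡ 1 ⊎ d′ ≡ 2) →
           ∃[ D ] ((D ≡ 1 ⊎ D ≡ 2) × (∀ t → t < k → ∃[ i ] ∃[ j ] (i < suc r × j < suc m × i * d + j * d′ ≡ t * D)))
      go r m h (inj₁ refl) (inj₁ refl) = 1 , inj₁ refl , λ t l → same r m t (≤-trans l (≤-pred h))
      go r m h (inj₂ refl) (inj₂ refl) = 2 , inj₂ refl , λ t l → same r m t (≤-trans l (≤-pred h))
      go zero m h (inj₁ refl) (inj₂ refl) = 2 , inj₂ refl , λ t l → 0 , t , s≤s z≤n , ≤-trans l (≤-pred h) , refl
      go (suc r) m h (inj₁ refl) (inj₂ refl) = 1 , inj₁ refl , λ t l → mixed r m t (≤-trans l (≤-pred h))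
      go r zero h (inj₂ refl) (inj₁ refl) = 2 , inj₂ refl ,
        λ t l → t , 0 , ≤-trans l (≤-trans (≤-pred h) (≤-reflexive (+-comm r 1))) , s≤s z≤n , +-identityʳ _
      go r (suc m) h (inj₂ refl) (inj₁ refl) = 1 , inj₁ refl , λ t l →
        let (i , j , a , b , e) = mixed m r t (≤-trans l (≤-trans (≤-pred h)
                                    (≤-reflexive (trans (+-comm r (suc (suc m))) (cong suc (sym (+-suc m r)))))))
        in j , i , b , a , trans (+-comm (j * 2) (i * 1)) e

  opaque
    -- Since `X`, `K` and `L` are disjoint, every entering path can be joined with every path
    -- through `K`; so the sizes form a sumset, shifted by the fixed exit.
    combine : ∀ {F P Q A B X K L a d e} r m k → (d ≡ 1 ⊎ d ≡ 2) → 1 ≤ r → 1 ≤ m → k < r + m →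
      X ⊑ F → K ⊑ F → L ⊑ F → Disjoint X K → Disjoint X L → Disjoint K L →
      (∀ {u} → u ∈ K → u ∈ A → ∀ i → i < r → Pre P X (a + i * d) u) →
      (∀ {u} → u ∈ K → u ∈ B → Pre Q L e u) →
      Adm m K A B → Adm k F P Q
    combine {F} {P} {Q} {a = a} {d} {e} r m k ed r1 m1 h xf kf lf xk xl kl pre suf (b , d′ , ed′ , f)
      with sumset r m k ed ed′ r1 m1 h
    ... | D , eD , g = a + b + e , D , eD , λ t l →
      let (i , j , x , y , eq) = g t l ; (s , s′ , sa , sb , w) = f j y in
      subst (AB F P Q) (shuffle {i} {j} {t} eq) (glue xf kf lf xk xl kl (pre (walk-start w) sa i x) w (suf (walk-end w) sb))
      where
      shuffle : ∀ {i j t} → i * d + j * d′ ≡ t * D → (a + i * d) + (b + j * d′) + e ≡ a + b + e + t * D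
      shuffle {i} {j} {t} eq = begin
        (a + i * d) + (b + j * d′) + e   ≡⟨ cong (_+ e) (interchange a (i * d) b (j * d′)) ⟩
        (a + b) + (i * d + j * d′) + e   ≡⟨ cong (λ x → a + b + x + e) eq ⟩
        (a + b) + t * D + e              ≡⟨ +-assoc (a + b) (t * D) e ⟩
        (a + b) + (t * D + e)            ≡⟨ cong (a + b +_) (+-comm (t * D) e) ⟩
        (a + b) + (e + t * D)            ≡⟨ sym (+-assoc (a + b) e (t * D)) ⟩
        a + b + e + t * D                ∎
        where open ≡-Reasoning

  opaque
    adm-run : ∀ {F P Q} k lo hi → k + lo ≤ suc hi → (∀ c → lo ≤ c → c ≤ hi → AB F P Q c) → Adm k F P Q
    adm-run k lo hi h f = lo , 1 , inj₁ refl , λ i l → subst (AB _ _ _) (cong (lo +_) (sym (*-identityʳ i)))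
      (f (lo + i) (m≤m+n lo i) (lin 4 (λ i k lo hi → κ 1 ⊕ i ≼ k ⇛ k ⊕ lo ≼ κ 1 ⊕ hi ⇛ ⊢ lo ⊕ i ≼ hi) refl i k lo hi l h))

-- Rooted graphs, and the pieces to which the induction is applied.

module Rooted {n : ℕ} (G : Graph n) where

  open Walks G

  Meets : Sub n → Sub n → Set
  Meets C A = ∃[ v ] v ∈ C × v ∈ A

  Misses : Sub n → Sub n → Set
  Misses C A = ∀ {v} → v ∈ C → v ∉ A

  opaque
    meets? : ∀ C A → Meets C A ⊎ Misses C A
    meets? C A with find (C ∩ A)
    ... | inj₂ (v , m) = inj₁ (v , ∩ˡ m , ∩ʳ {S = C} m)
    ... | inj₁ h       = inj₂ λ c a → h _ (∩⁺ c a)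

  -- F is the graph without its roots x and y; P and Q are the neighbourhoods
  -- of x and y.  A union of components of F, or of F minus a vertex, is a
  -- closed set, so the fields say that adding the edge xy gives a 2-connected graph.
  record RG (F P Q : Sub n) : Set where
    field
      rgP : ∀ {C u} → Closed F C → u ∈ C → Meets C P
      rgQ : ∀ {C u} → Closed F C → u ∈ C → Meets C Q
      rgX : ∀ w {C u} → Closed (F ∖ w) C → u ∈ C → Meets C (P ∪ Q)
  open RG public

  RG-rev : ∀ {F P Q} → RG F P Q → RG F Q P
  RG-rev {P = P} {Q} r = record
    { rgP = rgQ r ; rgQ = rgP r
    ; rgX = λ w c m → let (v , a , b) = rgX r w c m in v , a , swap (∪⁻ {S = P} b) }
    where
    swap : ∀ {v} → v ∈ P ⊎ v ∈ Q → v ∈ Q ∪ P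
    swap (inj₁ x) = ∪ʳ {S = Q} x
    swap (inj₂ x) = ∪ˡ x

  -- The failure of `RG` with its witness. Only `w` in `K` matters in `badX`: otherwise `K ∖ w` is
  -- `K`, and a closed set missing `A` falls under `badA`.
  data Bad (K A B : Sub n) : Set where
    badA : ∀ {C u} → Closed K C → u ∈ C → Misses C A → Bad K A B
    badB : ∀ {C u} → Closed K C → u ∈ C → Misses C B → Bad K A B
    badX : ∀ w {C u} → w ∈ K → Closed (K ∖ w) C → u ∈ C → Misses C A → Misses C B → Bad K A B

  ∖-skip : ∀ {K w C} → w ∉ K → Closed (K ∖ w) C → Closed K C
  ∖-skip h c = record { sub = ∖ˡ ∘ sub c ; cl = λ m s e → cl c m (∖⁺ s λ { refl → h s }) e }

  private
    -- A closed set contains the component of each of its vertices, so testing components suffices.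
    probe : ∀ S A → (∀ {C u} → Closed S C → u ∈ C → Meets C A) ⊎ (∃[ u ] ∃[ C ] Closed S C × u ∈ C × Misses C A)
    probe S A with search test
      where
      test : ∀ a → (∀ {C} → Closed S C → a ∈ C → Meets C A) ⊎ (∃[ C ] Closed S C × a ∈ C × Misses C A)
      test a with a ∈? S
      ... | no h = inj₁ λ c m → ⊥-elim (h (sub c m))
      ... | yes s with comp S a s
      ... | K with meets? (Comp.D K) A
      ... | inj₂ h = inj₂ (Comp.D K , Comp.closed K , Comp.base K , h)
      ... | inj₁ (v , d , m) = inj₁ λ c b →
        v , walk-closed c (walk-mono (sub (Comp.closed K)) (proj₂ (Comp.reach K d))) b , m
    ... | inj₁ f = inj₁ λ c m → f _ c m
    ... | inj₂ w = inj₂ w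

  opaque
    rooted? : ∀ K A B → RG K A B ⊎ Bad K A B
    rooted? K A B with probe K A | probe K B | search cuts
      where
      cuts : ∀ w → (∀ {C u} → Closed (K ∖ w) C → u ∈ C → Meets C (A ∪ B)) ⊎
                   (∃[ u ] ∃[ C ] Closed (K ∖ w) C × u ∈ C × Misses C (A ∪ B))
      cuts w = probe (K ∖ w) (A ∪ B)
    ... | inj₂ (u , C , c , m , h) | _ | _ = inj₂ (badA c m h)
    ... | inj₁ _ | inj₂ (u , C , c , m , h) | _ = inj₂ (badB c m h)
    ... | inj₁ f | inj₁ g | inj₁ h = inj₁ record { rgP = f ; rgQ = g ; rgX = λ w → h w }
    ... | inj₁ f | inj₁ g | inj₂ (w , u , C , c , m , h) with w ∈? K
    ... | yes k = inj₂ (badX w k c m (λ v a → h v (∪ˡ a)) (λ v b → h v (∪ʳ {S = A} b)))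
    ... | no k = let (v , v∈ , a) = f (∖-skip k c) m in ⊥-elim (h v∈ (∪ˡ a))

  closed-trans : ∀ {K C D} → Closed K C → Closed C D → Closed K D
  closed-trans c d = record { sub = sub c ∘ sub d ; cl = λ m k e → cl d m (cl c (sub d m) k e) e }

  closed-∖ : ∀ {K C D w} → Closed K C → Closed (C ∖ w) D → Closed (K ∖ w) D
  closed-∖ c d = record
    { sub = λ m → ∖⁺ (sub c (∖ˡ (sub d m))) (∖ʳ (sub d m))
    ; cl  = λ m k e → cl d m (∖⁺ (cl c (∖ˡ (sub d m)) (∖ˡ k) e) (∖ʳ k)) e }

  closed-add : ∀ {K C w} → Closed (K ∖ w) C → Misses C (N w) → Closed K C
  closed-add {w = w} c h = record { sub = ∖ˡ ∘ sub c ; cl = go }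
    where
    go : ∀ {u v} → u ∈ _ → v ∈ _ → u ~ v → v ∈ _
    go {v = v} m k e with v Fin.≟ w
    ... | yes refl = ⊥-elim (h m (~-sym e))
    ... | no d     = cl c m (∖⁺ k d) e

  -- The two bits complete the degree in `F` by the edges to `x` and `y`. If `z` is not in `F`, no
  -- vertex is excepted.
  Claim : Sub n → Sub n → Sub n → V → ℕ → Set
  Claim F P Q z k = RG F P Q → (∃[ u ] u ∈ F × u ≢ z) →
    (∀ {u} → u ∈ F → u ≢ z → k + 1 ≤ dg F u + bit (P u) + bit (Q u)) → Adm k F P Q

  -- Nothing but the size is tied to `F`: the induction is applied with other roots, another
  -- exception and another `k`.
  Below : Sub n → Set
  Below F = ∀ F′ P′ Q′ z′ k′ → # F′ < # F → 1 ≤ k′ → Claim F′ P′ Q′ z′ k′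

  opaque
    one-path : ∀ {K A B u} → RG K A B → u ∈ K → Adm 1 K A B
    one-path {K} {A} {B} r m with rgP r (record { sub = id ; cl = λ _ s _ → s }) m
    ... | v , v∈ , a with comp K v v∈
    ... | D with rgQ r (Comp.closed D) (Comp.base D)
    ... | w , w∈ , b = proj₁ (Comp.reach D w∈) , 1 , inj₁ refl , path
      where
      path : ∀ i → i < 1 → AB K A B (proj₁ (Comp.reach D w∈) + i * 1)
      path zero _ = v , w , a , b , subst (Walk K v w) (sym (+-identityʳ _))
        (walk-mono (sub (Comp.closed D)) (proj₂ (Comp.reach D w∈)))
      path (suc i) (s≤s ())

  record Problem : Set where
    field
      F P Q : Sub n
      z     : V
      k     : ℕ
      k≥2   : 2 ≤ k
      below : Below F
      rg    : RG F P Q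
      degF  : ∀ {u} → u ∈ F → u ≢ z → k + 1 ≤ dg F u + bit (P u) + bit (Q u)

  -- H is a set in which many path lengths from x are available, and a piece
  -- is a part K of S \ H to be entered from H or x and left from B, whence a fixed
  -- path in L leads to y.  O marks the vertices of F with neighbours in H or at a root.
  module Pieces (I : Problem) (H O S : Sub n) (S⊑F : S ⊑ Problem.F I) where

    open Problem I

    record Piece (K B : Sub n) : Set where
      field
        inS    : K ⊑ S
        offH   : Disjoint K H
        proper : ∃[ h ] h ∈ F × h ∉ K
        L      : Sub n
        L-inF  : L ⊑ F
        L-offK : Disjoint K L
        L-offH : Disjoint H L
        len    : ℕ
        exit   : ∀ {u} → u ∈ K → u ∈ B → Pre Q L len u
        toB    : ∀ {C u} → Closed K C → u ∈ C → Meets C B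
        toO    : ∀ {C u} → Closed K C → u ∈ C → Meets C O
        toBO   : ∀ w {C u} → Closed (K ∖ w) C → u ∈ C → Meets C (B ∪ O)
        deg    : ∀ {u} → u ∈ K → u ≢ z → k + 1 ≤ dg K u + dg H u + bit (P u) + bit (B u)
    open Piece public

    inF : ∀ {K B} → Piece K B → K ⊑ F
    inF p m = S⊑F (inS p m)

    -- `bound` is the exchange rate: edges to `H` and `x` are lost, membership in `A` is gained, and
    -- the balance costs a vertex at most `r - 1` for the `r` lengths it buys.
    record Source (K L : Sub n) : Set where
      field
        A      : Sub n
        meetsA : Meets K A
        X      : Sub n
        X-inF  : X ⊑ F
        X-offK : Disjoint X K
        X-offL : Disjoint X L
        a d r  : ℕ
        d≡     : d ≡ 1 ⊎ d ≡ 2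
        r≥1    : 1 ≤ r
        enter  : ∀ {u} → u ∈ K → u ∈ A → ∀ i → i < r → Pre P X (a + i * d) u
        bound  : ∀ {u} → u ∈ K → u ≢ z → dg H u + bit (P u) + 1 ≤ r + bit (A u)
    open Source public

    private
      self : ∀ {K} → Closed K K
      self = record { sub = id ; cl = λ _ s _ → s }

    opaque
      -- `r` lengths from the source and `m = k + 1 - r` from the induction make `k`; if `r` is at
      -- least `k`, any one path through the part will do. The form with `K₁` and `e` is for `peel`,
      -- where vertices of `K` have been cut off that only `e` may have as neighbours.
      cross : ∀ {K B} (p : Piece K B) (s : Source K (L p)) {K₁} e → K₁ ⊑ K → RG K₁ (A s) B →
        (∃[ u ] u ∈ K₁ × u ≢ e) → (∀ {u} → u ∈ K₁ → u ≢ e → u ≢ z × dg K u ≤ dg K₁ u) → Adm k F P Q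
      cross {K} {B} p s {K₁} e i g (u₀ , m₀ , h₀) dgs with k ≤? r s
      ... | yes k≤r = combine (r s) 1 k (d≡ s) (r≥1 s) ≤-refl
        (≤-trans (s≤s k≤r) (≤-reflexive (+-comm 1 (r s)))) (X-inF s) (inF p ∘ i) (L-inF p)
        (λ x y → X-offK s x (i y)) (X-offL s) (L-offK p ∘ i)
        (enter s ∘ i) (exit p ∘ i) (one-path g m₀)
      ... | no k≰r = combine (r s) m k (d≡ s) (r≥1 s) m≥1 (≤-reflexive (sym r+m))
        (X-inF s) (inF p ∘ i) (L-inF p)
        (λ x y → X-offK s x (i y)) (X-offL s) (L-offK p ∘ i) (enter s ∘ i) (exit p ∘ i)
        (below K₁ (A s) B e m smaller m≥1 g (u₀ , m₀ , h₀) enough)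
        where
        m : ℕ
        m = suc k ∸ r s
        r+m : r s + m ≡ suc k
        r+m = m+[n∸m]≡n (≤-trans (<⇒≤ (≰⇒> k≰r)) (n≤1+n k))
        m≥1 : 1 ≤ m
        m≥1 = m<n⇒0<n∸m (≤-trans (≰⇒> k≰r) (n≤1+n k))
        smaller : # K₁ < # F
        smaller = let (h , a , b) = proper p in #-strict (inF p ∘ i) a (b ∘ i)
        enough : ∀ {u} → u ∈ K₁ → u ≢ e → m + 1 ≤ dg K₁ u + bit (A s u) + bit (B u)
        enough {u} x y = let (u≢z , le) = dgs x y in
          lin 9 (λ m k r g₁ g h p a b → r ⊕ m ≼ κ 1 ⊕ k ⇛ g ≼ g₁ ⇛ k ⊕ κ 1 ≼ g ⊕ h ⊕ p ⊕ b ⇛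
                h ⊕ p ⊕ κ 1 ≼ r ⊕ a ⇛ ⊢ m ⊕ κ 1 ≼ g₁ ⊕ a ⊕ b) refl
              m k (r s) (dg K₁ u) (dg K u) (dg H u) (bit (P u)) (bit (A s u)) (bit (B u))
              (≤-reflexive r+m) le (deg p (i x) u≢z) (bound s (i x) u≢z)

    sub-closed : ∀ {K B C u} → Piece K B → Closed K C → u ∈ C → Piece C B
    sub-closed {K} {B} {C} p c m = record
      { inS = inS p ∘ sub c ; offH = offH p ∘ sub c
      ; proper = let (h , a , b) = proper p in h , a , b ∘ sub c
      ; L = L p ; L-inF = L-inF p ; L-offK = L-offK p ∘ sub c ; L-offH = L-offH p
      ; len = len p ; exit = exit p ∘ sub c
      ; toB = λ d → toB p (closed-trans c d) ; toO = λ d → toO p (closed-trans c d)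
      ; toBO = λ w d → toBO p w (closed-∖ c d)
      ; deg = λ {u} x y → ≤-trans (deg p (sub c x) y)
          (+-monoˡ-≤ (bit (B u)) (+-monoˡ-≤ (bit (P u)) (+-monoˡ-≤ (dg H u) (dg-mono {K} λ e s → cl c x s e)))) }

    -- `C` can be left only through `w`. The exit is prolonged by a path from `w` to `B` in the
    -- component `D` of `w` in `K ─ C`; it exists because `D ∪ C` is closed in `K` and so meets `B`,
    -- which `C` misses. A vertex of `C` loses no neighbour in `K` but `w`, and `N w` now counts
    -- that one.
    sub-cut : ∀ {K B C w u} → Piece K B → w ∈ K → Closed (K ∖ w) C → u ∈ C → Misses C B → Piece C (N w)
    sub-cut {K} {B} {C} {w} {u₀} p w∈ c m₀ h = record
      { inS = inS p ∘ incl ; offH = offH p ∘ incl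
      ; proper = let (h , a , b) = proper p in h , a , b ∘ incl
      ; L = L p ∪ D
      ; L-inF = λ x → [ L-inF p , inF p ∘ ─ˡ ∘ sub (Comp.closed W) ]′ (∪⁻ {S = L p} x)
      ; L-offK = λ x y → [ L-offK p (incl x) , (λ d → ─ʳ {S = K} (sub (Comp.closed W) d) x) ]′ (∪⁻ {S = L p} y)
      ; L-offH = λ x y → [ L-offH p x , (λ d → offH p (─ˡ (sub (Comp.closed W) d)) x) ]′ (∪⁻ {S = L p} y)
      ; len = len p + len′ ; exit = λ _ a → leave (exit p (─ˡ (sub (Comp.closed W) b∈D)) b∈B) a
      ; toB = toB′ ; toO = toO′ ; toBO = toBO′
      ; deg = deg′ }
      where
      incl : C ⊑ K
      incl = ∖ˡ ∘ sub c
      W = comp (K ─ C) w (─⁺ w∈ (∉∖ ∘ sub c))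
      D = Comp.D W
      D∪C-closed : Closed K (D ∪ C)
      D∪C-closed = record { sub = λ x → [ ─ˡ ∘ sub (Comp.closed W) , incl ]′ (∪⁻ {S = D} x) ; cl = go }
        where
        go : ∀ {u v} → u ∈ D ∪ C → v ∈ K → u ~ v → v ∈ D ∪ C
        go {u} {v} x k e with v ∈? C
        ... | yes v∈C = ∪ʳ {S = D} v∈C
        ... | no v∉C with ∪⁻ {S = D} x
        ... | inj₁ d = ∪ˡ (cl (Comp.closed W) d (─⁺ k v∉C) e)
        ... | inj₂ d with v Fin.≟ w
        ... | yes refl = ∪ˡ (Comp.base W)
        ... | no v≢w   = ⊥-elim (v∉C (cl c d (∖⁺ k v≢w) e))
      found : ∃[ b ] b ∈ D × b ∈ B
      found with toB p D∪C-closed (∪ʳ {S = D} m₀)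
      ... | b , x , y with ∪⁻ {S = D} x
      ... | inj₁ d = b , d , y
      ... | inj₂ d = ⊥-elim (h d y)
      b = proj₁ found
      b∈D = proj₁ (proj₂ found)
      b∈B = proj₂ (proj₂ found)
      len′ = proj₁ (Comp.reach W b∈D)
      back : Walk D b w len′
      back = walk-rev (proj₂ (Comp.reach W b∈D))
      leave : ∀ {u} → Pre Q (L p) (len p) b → u ∈ N w → Pre Q (L p ∪ D) (len p + len′) u
      leave (inj₁ (eq , q)) a = inj₂ (b , w , q , subst (Walk _ b w) (cong (_+ len′) (sym eq)) (walk-mono (∪ʳ {S = L p}) back) , a)
      leave (inj₂ (s , t , q , wk , e)) a = inj₂ (s , w , q ,
        walk-++ wk e back (λ x y → L-offK p (─ˡ (sub (Comp.closed W) y)) x) , a)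
      lift : ∀ {C′} → Closed C C′ → Misses C′ (N w) → Closed K C′
      lift d g = closed-add (closed-trans c d) g
      toB′ : ∀ {C′ u} → Closed C C′ → u ∈ C′ → Meets C′ (N w)
      toB′ {C′} d x with meets? C′ (N w)
      ... | inj₁ y = y
      ... | inj₂ g = let (v , a , b) = toB p (lift d g) x in ⊥-elim (h (sub d a) b)
      notB : ∀ {C′} → C′ ⊑ C → Meets C′ (B ∪ O) → Meets C′ O
      notB i (v , a , y) = v , a , [ ⊥-elim ∘ h (i a) , id ]′ (∪⁻ {S = B} y)
      toO′ : ∀ {C′ u} → Closed C C′ → u ∈ C′ → Meets C′ O
      toO′ d x = notB (sub d) (toBO p w (closed-trans c d) x)
      toBO′ : ∀ w′ {C′ u} → Closed (C ∖ w′) C′ → u ∈ C′ → Meets C′ (N w ∪ O)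
      toBO′ w′ {C′} d x with meets? C′ (N w)
      ... | inj₁ (v , a , y) = v , a , ∪ˡ y
      ... | inj₂ g with notB (∖ˡ ∘ sub d) (toBO p w′ cl′ x)
        where
        cl′ : Closed (K ∖ w′) C′
        cl′ = record { sub = λ y → ∖⁺ (incl (∖ˡ (sub d y))) (∖ʳ (sub d y)) ; cl = go }
          where
          go : ∀ {u v} → u ∈ C′ → v ∈ K ∖ w′ → u ~ v → v ∈ C′
          go {v = v} y k e with v Fin.≟ w
          ... | yes refl = ⊥-elim (g y (~-sym e))
          ... | no v≢w   = cl d y (∖⁺ (cl c (∖ˡ (sub d y)) (∖⁺ (∖ˡ k) v≢w) e) (∖ʳ k)) e
      ... | v , a , y = v , a , ∪ʳ {S = N w} y
      deg′ : ∀ {u} → u ∈ C → u ≢ z → k + 1 ≤ dg C u + dg H u + bit (P u) + bit (N w u)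
      deg′ {u} x y = lin 8 (λ k g g₁ h p b i j → k ⊕ κ 1 ≼ g ⊕ h ⊕ p ⊕ b ⇛ g ≼ g₁ ⊕ i ⇛ i ≼ j ⇛ b ≼ κ 0 ⇛
                               ⊢ k ⊕ κ 1 ≼ g₁ ⊕ h ⊕ p ⊕ j) refl
        k (dg K u) (dg C u) (dg H u) (bit (P u)) (bit (B u)) (dg ｛ w ｝ u) (bit (N w u))
        (deg p (incl x) y) (dg-cover {K} {C} {｛ w ｝} split) (dg-one {｛ w ｝} w (λ _ → ｛｝∈)) (≤-reflexive (bit-false (h x)))
        where
        split : ∀ {v} → u ~ v → v ∈ K → v ∈ C ⊎ v ∈ ｛ w ｝
        split {v} e s with v Fin.≟ w
        ... | yes refl = inj₂ ∈｛｝
        ... | no v≢w   = inj₁ (cl c x (∖⁺ s v≢w) e)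

    Smaller : Sub n → Set
    Smaller K = ∀ {C B u} → Piece C B → z ∉ C → u ∈ C → # C < # K → Adm k F P Q

    Provider : Set
    Provider = ∀ {K B} (p : Piece K B) → z ∉ K → (∃[ v ] v ∈ K) → Smaller K → Source K (L p) ⊎ Adm k F P Q

    Solved : Set
    Solved = ∀ {K B u} → Piece K B → z ∉ K → u ∈ K → Adm k F P Q

    opaque
      shrink : ∀ {K B u} → Piece K B → u ∈ K → (s : Sub n) → Meets K s → z ∉ K → Smaller K → Bad K s B → Adm k F P Q
      shrink {K} p m s (v , v∈ , a) h rec (badA c x g) =
        rec (sub-closed p c x) (h ∘ sub c) x (#-strict (sub c) v∈ λ y → g y a)
      shrink p m s _ h rec (badB c x g) = let (v , a , b) = toB p c x in ⊥-elim (g a b)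
      shrink p m s _ h rec (badX w w∈ c x f g) =
        rec (sub-cut p w∈ c x g) (h ∘ ∖ˡ ∘ sub c) x (#-strict (∖ˡ ∘ sub c) w∈ (∉∖ ∘ sub c))

    opaque
      -- Induction on the size of `K`, since a failure of 2-connectedness contains a smaller piece.
      -- As `z` is not in `K`, all degrees there are bounded.
      zfree : Provider → Solved
      zfree src {K} p h m = go (suc (# K)) p h m ≤-refl
        where
        go : ∀ m {K B u} → Piece K B → z ∉ K → u ∈ K → # K < m → Adm k F P Q
        go (suc m) {K} {B} {u} p h x (s≤s l) = [ run , id ]′ (src p h (u , x) rec)
          where
          rec : Smaller K
          rec q g y le = go m q g y (≤-trans le l)
          run : Source K (L p) → Adm k F P Q
          run s with rooted? K (A s) B
          ... | inj₁ g = cross p s z id g (u , x , λ { refl → h x }) (λ { y _ → (λ { refl → h y }) , ≤-refl })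
          ... | inj₂ b = shrink p x (A s) (meetsA s) h rec b

    -- What is left when the pieces containing z that obstruct the induction have been
    -- removed one after the other, the vertex e where they hang becoming the new exception.
    record Stuck (K A B : Sub n) : Set where
      field
        e      : V
        e∈K    : e ∈ K
        e∈A    : e ∈ A
        e∈B    : e ∈ B
        only-A : ∀ {u} → u ∈ K → u ∈ A → u ≡ e
        only-B : ∀ {u} → u ∈ K → u ∈ B → u ≡ e
        alone  : e ≡ z → ∀ {u} → u ∈ K → u ≡ z
    open Stuck public

    opaque
      -- An obstruction avoiding the current exception `e` yields a piece without `z`, which is
      -- solved. One beyond a cut-vertex `w` that contains `e` is discarded, and `w` becomes the
      -- exception. What remains in the end is rooted, so that `cross` applies, or a single vertex.
      peel : Solved → ∀ {K B} (p : Piece K B) (s : Source K (L p)) → z ∈ K → Adm k F P Q ⊎ Stuck K (A s) B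
      peel solved {K} {B} p s z∈K = go (suc (# K)) K z ≤-refl id z∈K (λ _ h → h) (λ u∈ u∉ → ⊥-elim (u∉ u∈))
        where
        -- All that was discarded hangs on `e` alone, so the other remaining vertices keep their
        -- degrees; and it contains `z`, so all these degrees are bounded.
        Outside : Sub n → V → Set
        Outside K₁ e = ∀ {u} → u ∈ K → u ∉ K₁ → u ∉ A s × u ∉ B × z ∉ K₁ × (∀ {w} → w ∈ K₁ → u ~ w → w ≡ e)
        go : ∀ m K₁ e → # K₁ < m → K₁ ⊑ K → e ∈ K₁ → (∀ {u} → u ∈ K₁ → u ≢ e → u ≢ z) → Outside K₁ e →
             Adm k F P Q ⊎ Stuck K (A s) B
        go (suc m) K₁ e (s≤s l) i e∈ av out = decide (rooted? K₁ (A s) B)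
          where
          z⇒e : ∀ {u} → u ∈ K₁ → u ≡ z → u ≡ e
          z⇒e {u} x eq with u Fin.≟ e
          ... | yes y = y
          ... | no y  = ⊥-elim (av x y eq)
          lift : ∀ {C} → Closed K₁ C → e ∉ C → Closed K C
          lift {C} c h = record { sub = i ∘ sub c ; cl = step }
            where
            step : ∀ {u v} → u ∈ C → v ∈ K → u ~ v → v ∈ C
            step {u} {v} x y a with v ∈? K₁
            ... | yes v∈ = cl c x v∈ a
            ... | no v∉  = ⊥-elim (h (subst (_∈ C) (proj₂ (proj₂ (proj₂ (out y v∉))) (sub c x) (~-sym a)) x))
          avoid-z : ∀ {C : Sub n} → C ⊑ K₁ → e ∉ C → z ∉ C
          avoid-z {C} j h x = h (subst (_∈ C) (z⇒e (j x) refl) x)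
          whole : ∀ {C u} → Closed K₁ C → u ∈ C → Adm k F P Q ⊎ (K₁ ⊑ C)
          whole {C} c x with e ∈? C
          ... | no h = inj₁ (solved (sub-closed p (lift c h) x) (avoid-z (sub c) h) x)
          ... | yes e∈C with find (K₁ ─ C)
          ... | inj₁ h = inj₂ sub-all
            where
            sub-all : K₁ ⊑ C
            sub-all {u} y with u ∈? C
            ... | yes y′ = y′
            ... | no g   = ⊥-elim (h u (─⁺ y g))
          ... | inj₂ (v , y) = inj₁ (solved (sub-closed p (lift rest e∉) y) (avoid-z ─ˡ e∉) y)
            where
            e∉ : e ∉ K₁ ─ C
            e∉ g = ─ʳ {S = K₁} g e∈C
            rest : Closed K₁ (K₁ ─ C)
            rest = record { sub = ─ˡ ; cl = λ g t a → ─⁺ t λ t∈ → ─ʳ {S = K₁} g (cl c t∈ (─ˡ g) (~-sym a)) }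
          lone : (∀ u → u ∈ K₁ → u ≡ e) → Stuck K (A s) B
          lone h = record
            { e = e ; e∈K = i e∈
            ; e∈A = let (v , a , b) = meetsA s in subst (_∈ A s) (atA a b) b
            ; e∈B = let (v , a , b) = toB p self (i e∈) in subst (_∈ B) (atB a b) b
            ; only-A = atA ; only-B = atB ; alone = al }
            where
            atA : ∀ {u} → u ∈ K → u ∈ A s → u ≡ e
            atA {u} a b with u ∈? K₁
            ... | yes y = h u y
            ... | no g  = ⊥-elim (proj₁ (out a g) b)
            atB : ∀ {u} → u ∈ K → u ∈ B → u ≡ e
            atB {u} a b with u ∈? K₁
            ... | yes y = h u y
            ... | no g  = ⊥-elim (proj₁ (proj₂ (out a g)) b)
            al : e ≡ z → ∀ {u} → u ∈ K → u ≡ z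
            al eq {u} a with u ∈? K₁
            ... | yes y = trans (h u y) eq
            ... | no g  = ⊥-elim (proj₁ (proj₂ (proj₂ (out a g))) (subst (_∈ K₁) eq e∈))
          decide : RG K₁ (A s) B ⊎ Bad K₁ (A s) B → Adm k F P Q ⊎ Stuck K (A s) B
          decide (inj₁ g) with find (K₁ ∖ e)
          ... | inj₁ h = inj₂ (lone same)
            where
            same : ∀ u → u ∈ K₁ → u ≡ e
            same u y with u Fin.≟ e
            ... | yes eq = eq
            ... | no ne  = ⊥-elim (h u (∖⁺ y ne))
          ... | inj₂ (u , y) = inj₁ (cross p s e i g (u , ∖ˡ y , ∖ʳ y) λ a b → av a b , dg-mono {K} (stay a b))
            where
            stay : ∀ {u} → u ∈ K₁ → u ≢ e → ∀ {w} → u ~ w → w ∈ K → w ∈ K₁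
            stay a b {w} c d with w ∈? K₁
            ... | yes x = x
            ... | no g  = ⊥-elim (b (proj₂ (proj₂ (proj₂ (out d g))) a (~-sym c)))
          decide (inj₂ (badA {C} c x h)) with whole c x
          ... | inj₁ r = inj₁ r
          ... | inj₂ j = let (v , a , b) = meetsA s in ⊥-elim (missing a b)
            where
            missing : ∀ {v} → v ∈ K → v ∉ A s
            missing {v} a b with v ∈? K₁
            ... | yes y = h (j y) b
            ... | no g  = proj₁ (out a g) b
          decide (inj₂ (badB {C} c x h)) with whole c x
          ... | inj₁ r = inj₁ r
          ... | inj₂ j = let (v , a , b) = toB p self (i e∈) in ⊥-elim (missing a b)
            where
            missing : ∀ {v} → v ∈ K → v ∉ B
            missing {v} a b with v ∈? K₁
            ... | yes y = h (j y) b
            ... | no g  = proj₁ (proj₂ (out a g)) b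
          decide (inj₂ (badX w {C} w∈ c x hA hB)) with e ∈? C
          ... | no h = inj₁ (solved (sub-cut p (i w∈) cut x hB) (avoid-z (∖ˡ ∘ sub c) h) x)
            where
            cut : Closed (K ∖ w) C
            cut = record { sub = λ y → ∖⁺ (i (∖ˡ (sub c y))) (∖ʳ (sub c y)) ; cl = step }
              where
              step : ∀ {u v} → u ∈ C → v ∈ K ∖ w → u ~ v → v ∈ C
              step {u} {v} y y′ a with v ∈? K₁
              ... | yes v∈ = cl c y (∖⁺ v∈ (∖ʳ y′)) a
              ... | no v∉  = ⊥-elim (h (subst (_∈ C) (proj₂ (proj₂ (proj₂ (out (∖ˡ y′) v∉))) (∖ˡ (sub c y)) (~-sym a)) y))
          ... | yes e∈C = go m (K₁ ─ C) w (≤-trans (#-strict ─ˡ e∈ (λ g → ─ʳ {S = K₁} g e∈C)) l) (i ∘ ─ˡ)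
                             (─⁺ w∈ (∉∖ ∘ sub c)) av′ out′
            where
            z∉ : z ∉ K₁ ─ C
            z∉ g = ─ʳ {S = K₁} g (subst (_∈ C) (sym (z⇒e (─ˡ g) refl)) e∈C)
            av′ : ∀ {u} → u ∈ K₁ ─ C → u ≢ w → u ≢ z
            av′ g _ refl = z∉ g
            out′ : Outside (K₁ ─ C) w
            out′ {u} a g with u ∈? K₁
            ... | no u∉ = let (p₁ , p₂ , p₃ , p₄) = out a u∉ in
              p₁ , p₂ , z∉ , λ y b → ⊥-elim (─ʳ {S = K₁} y (subst (_∈ C) (sym (p₄ (─ˡ y) b)) e∈C))
            ... | yes u∈ with u ∈? C
            ... | no u∉C = ⊥-elim (g (─⁺ u∈ u∉C))
            ... | yes u∈C = hA u∈C , hB u∈C , z∉ , near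
              where
              near : ∀ {v} → v ∈ K₁ ─ C → u ~ v → v ≡ w
              near {v} y b with v Fin.≟ w
              ... | yes eq = eq
              ... | no ne  = ⊥-elim (─ʳ {S = K₁} y (cl c u∈C (∖⁺ (─ˡ y) ne) b))

    -- If a stuck piece K does not consist of z alone, the rest of K is a piece left through e.
    module _ {K B} (p : Piece K B) {A : Sub n} (t : Stuck K A B) (z∈K : z ∈ K) (e≢z : e t ≢ z) where

      tail : Piece (K ∖ e t) (N (e t))
      tail = sub-cut p (e∈K t) self (∖⁺ z∈K (e≢z ∘ sym)) λ m b → ∖ʳ m (only-B t (∖ˡ m) b)

      tail-L : L tail ⊑ L p ∪ K
      tail-L m = [ ∪ˡ , (λ d → ∪ʳ {S = L p} (─ˡ (sub (Comp.closed (comp _ _ _)) d))) ]′ (∪⁻ {S = L p} m)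

      opaque
        -- Of the degree `k + 1` of `e`, at most one neighbour lies in `K` and one is credited by
        -- `B`; the rest must come from `H` and `x`.
        stuck-deg : ∀ {w} → (∀ {u} → u ∈ K ∖ e t → u ∈ N (e t) → u ≡ w) → k ≤ dg H (e t) + bit (P (e t)) + 1
        stuck-deg {w} h = lin 5 (λ k g h p b → k ⊕ κ 1 ≼ g ⊕ h ⊕ p ⊕ b ⇛ g ≼ κ 1 ⇛ b ≼ κ 1 ⇛ ⊢ k ≼ h ⊕ p ⊕ κ 1) refl
          k (dg K (e t)) (dg H (e t)) (bit (P (e t))) (bit (B (e t))) (deg p (e∈K t) e≢z)
          (#-single {S = N (e t) ∩ K} w λ y → h (away y) (∩ˡ y)) (bit≤1 (B (e t)))
          where
          away : ∀ {u} → u ∈ N (e t) ∩ K → u ∈ K ∖ e t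
          away y = ∖⁺ (∩ʳ {S = N (e t)} y) (λ eq → ~⇒≢ (∩ˡ y) (sym eq))

-- First pieces, and the case that `y` has few neighbours.

module Start {n : ℕ} (G : Graph n) where

  open Walks G
  open Rooted G

  near : ∀ S u → Dec (∃[ w ] w ∈ N u ∩ S)
  near S u with find (N u ∩ S)
  ... | inj₁ h = no λ (w , m) → h w m
  ... | inj₂ w = yes w

  nb : Sub n → Sub n
  nb S = set (near S)

  ∈nb : ∀ {S u w} → u ~ w → w ∈ S → u ∈ nb S
  ∈nb {S} e s = ∈set (near S) (_ , ∩⁺ e s)

  nb∈ : ∀ {S u} → u ∈ nb S → ∃[ w ] u ~ w × w ∈ S
  nb∈ {S} {u} m = let (w , k) = set∈ (near S) m in w , ∩ˡ k , ∩ʳ {S = N u} k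

  dg-nb : ∀ {S u} → u ∉ nb S → dg S u ≤ 0
  dg-nb h = dg-zero λ e s → h (∈nb e s)

  split-at : ∀ {F : Sub n} a {u} → u ∈ F → u ∈ ｛ a ｝ ⊎ u ∈ F ∖ a
  split-at a {u} m with u Fin.≟ a
  ... | yes refl = inj₁ ∈｛｝
  ... | no h     = inj₂ (∖⁺ m h)

  Pre-single : ∀ {Q q u} → q ∈ Q → q ~ u → Pre Q ｛ q ｝ 1 u
  Pre-single {q = q} h e = inj₂ (q , q , h , one ∈｛｝ , e)

  whole-set : ∀ {K} → Closed K K
  whole-set = record { sub = id ; cl = λ _ s _ → s }

  module Launch (I : Problem) (H O S : Sub n) (S⊑F : S ⊑ Problem.F I) where

    open Problem I

    open Pieces I H O S S⊑F public

    x-source : ∀ {K} L → Meets K P → (∀ {u} → u ∈ K → u ∉ nb H) → Source K L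
    x-source L m h = record
      { A = P ; meetsA = m ; X = ∅ ; X-inF = ⊥-elim ∘ ∉∅ ; X-offK = ⊥-elim ∘ ∉∅ ; X-offL = ⊥-elim ∘ ∉∅
      ; a = 0 ; d = 1 ; r = 1 ; d≡ = inj₁ refl ; r≥1 = ≤-refl
      ; enter = λ { _ a zero _ → inj₁ (refl , a) ; _ _ (suc _) (s≤s ()) }
      ; bound = λ {u} m _ → lin 2 (λ h p → h ≼ κ 0 ⇛ ⊢ h ⊕ p ⊕ κ 1 ≼ κ 1 ⊕ p) refl (dg H u) (bit (P u)) (dg-nb (h m)) }

    layer : ∀ {K B} (p : Piece K B) {A} → H ⊑ F → Meets K A → ∀ {a d r} → d ≡ 1 ⊎ d ≡ 2 → 1 ≤ r →
            (∀ {u} → u ∈ A → ∀ i → i < r → Pre P H (a + i * d) u) →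
            (∀ {u} → u ∈ K → u ≢ z → dg H u + bit (P u) + 1 ≤ r + bit (A u)) → Source K (L p)
    layer p {A} H⊑F m d≡ r≥1 f b = record
      { A = A ; meetsA = m ; X = H ; X-inF = H⊑F ; X-offK = λ h x → offH p x h ; X-offL = L-offH p
      ; a = _ ; d = _ ; r = _ ; d≡ = d≡ ; r≥1 = r≥1 ; enter = λ _ → f ; bound = b }

    record Region (E B L : Sub n) : Set where
      field
        K     : Sub n
        base  : V
        base∈ : base ∈ K
        piece : Piece K B
        on-L  : Piece.L piece ⊑ L
        z∈K   : z ∈ K
        all   : ∀ {u} → u ∈ E → u ∈ B → u ∈ K
        shut  : Closed E K
        conn  : ∀ {C u} → Closed K C → u ∈ C → base ∈ C

    module Depart (B L : Sub n) (ℓ : ℕ) (L-F : L ⊑ F) (H-L : Disjoint H L)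
                  (out : ∀ {u} → u ∈ B → Pre Q L ℓ u) (h₀ : ∃[ h ] h ∈ F × h ∉ S ─ H ─ L)
                  (meetsO : ∀ {C u} → Closed (S ─ H ─ L) C → u ∈ C → Meets C O)
                  (meetsBO : ∀ w {C u} → Closed ((S ─ H ─ L) ∖ w) C → u ∈ C → Meets C (B ∪ O))
                  (degs : ∀ {u} → u ∈ S ─ H ─ L → u ≢ z → k + 1 ≤ dg (S ─ H ─ L) u + dg H u + bit (P u) + bit (B u)) where

      rest : Sub n
      rest = S ─ H ─ L

      launch : ∀ {a} (s : a ∈ rest) → a ∈ B → Piece (Comp.D (comp rest a s)) B
      launch {a} s b = record
        { inS = ─ˡ ∘ ─ˡ ∘ inc ; offH = λ m → ─ʳ {S = S} (─ˡ (inc m))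
        ; proper = let (h , x , y) = h₀ in h , x , y ∘ inc
        ; L = L ; L-inF = L-F ; L-offK = λ m → ─ʳ {S = S ─ H} (inc m) ; L-offH = H-L
        ; len = ℓ ; exit = λ _ → out
        ; toB = λ c m → a , comp-minimal C c m , b
        ; toO = λ c → meetsO (closed-trans (Comp.closed C) c)
        ; toBO = λ w c → meetsBO w (closed-∖ (Comp.closed C) c)
        ; deg = λ {u} m h → ≤-trans (degs (inc m) h)
            (+-monoˡ-≤ (bit (B u)) (+-monoˡ-≤ (bit (P u)) (+-monoˡ-≤ (dg H u) (dg-mono {rest} λ e s → cl (Comp.closed C) m s e)))) }
        where
        C = comp rest a s
        inc : Comp.D C ⊑ rest
        inc = sub (Comp.closed C)

      opaque
        -- A component of `S ─ H ─ L` that meets `B` is a piece, hence solved unless it contains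
        -- `z`. So at most one is left, and it contains all of `B` there.
        region : Solved → Adm k F P Q ⊎ Misses rest B ⊎ Region rest B L
        region solved with search each
          where
          each : ∀ a → ((s : a ∈ rest) → a ∈ B → z ∈ Comp.D (comp rest a s)) ⊎ Adm k F P Q
          each a with a ∈? rest | a ∈? B
          ... | no h  | _     = inj₁ λ s → ⊥-elim (h s)
          ... | yes _ | no h  = inj₁ λ _ b → ⊥-elim (h b)
          ... | yes s | yes b with z ∈? Comp.D (comp rest a s)
          ... | no h  = inj₂ (solved (launch s b) h (Comp.base (comp rest a s)))
          ... | yes y = inj₁ λ s′ _ → move s′
            where
            -- `comp` depends on the membership proof, so the result is carried over to any other
            -- one.
            move : (s′ : a ∈ rest) → z ∈ Comp.D (comp rest a s′)
            move s′ = walk-closed (Comp.closed (comp rest a s′))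
              (walk-mono (sub (Comp.closed (comp rest a s))) (proj₂ (Comp.reach (comp rest a s) y))) (Comp.base (comp rest a s′))
        ... | inj₂ (_ , r) = inj₁ r
        ... | inj₁ hz with meets? rest B
        ... | inj₂ h = inj₂ (inj₁ h)
        ... | inj₁ (a , s , b) = inj₂ (inj₂ record
          { K = Comp.D C ; base = a ; base∈ = Comp.base C ; piece = launch s b ; on-L = id ; z∈K = hz a s b
          ; all = λ {u} m m′ → walk-closed (Comp.closed C)
              (walk-rev (walk-mono (sub (Comp.closed (comp rest u m))) (proj₂ (Comp.reach (comp rest u m) (hz u m m′))))) (hz a s b)
          ; shut = Comp.closed C ; conn = comp-minimal C })
          where
          C : Comp rest a
          C = comp rest a s

  module Whole (I : Problem) where

    open Problem I

    k≥1 : 1 ≤ k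
    k≥1 = ≤-trans (s≤s z≤n) k≥2

    opaque
      -- With `a` and `b` as new roots no degree in `C` is lost. A closed part of `C` not attached
      -- to `a` would be closed in `F` without `b` and miss both old roots, against `rgX`.
      two-hubs : ∀ {a b C u} → a ∈ F → a ∉ C → b ∉ C → C ⊑ F → (∀ {u w} → u ∈ C → w ∈ F → u ~ w → w ∈ C ⊎ w ≡ a ⊎ w ≡ b) →
                 Misses C (P ∪ Q) → u ∈ C → z ∉ C → Adm k C (N a) (N b)
      two-hubs {a} {b} {C} {u₀} a∈ a∉ b∉ i c h m z∉ =
        below C (N a) (N b) z k (#-strict i a∈ a∉) k≥1
          record { rgP = λ d x → one-hub a b b∉ exits d x
                 ; rgQ = λ d x → one-hub b a a∉ (λ e s f → flip (exits e s f)) d x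
                 ; rgX = both }
          (u₀ , m , λ { refl → z∉ m })
          λ {u} x _ → lin 10 (λ k g p q g₁ ga gb ia ib g₂ → k ⊕ κ 1 ≼ g ⊕ p ⊕ q ⇛ p ≼ κ 0 ⇛ q ≼ κ 0 ⇛ g ≼ g₁ ⊕ g₂ ⇛ g₂ ≼ ga ⊕ gb ⇛
                              ga ≼ ia ⇛ gb ≼ ib ⇛ ⊢ k ⊕ κ 1 ≼ g₁ ⊕ ia ⊕ ib) refl
            k (dg F u) (bit (P u)) (bit (Q u)) (dg C u) (dg ｛ a ｝ u) (dg ｛ b ｝ u) (bit (N a u)) (bit (N b u)) (dg (｛ a ｝ ∪ ｛ b ｝) u)
            (degF (i x) λ { refl → z∉ x })
            (≤-reflexive (bit-false λ p → h x (∪ˡ p))) (≤-reflexive (bit-false λ q → h x (∪ʳ {S = P} q)))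
            (dg-cover {F} {C} {｛ a ｝ ∪ ｛ b ｝} λ e s → out₂ (exits x s e))
            (dg-cover {｛ a ｝ ∪ ｛ b ｝} {｛ a ｝} {｛ b ｝} λ _ → ∪⁻ {S = ｛ a ｝})
            (dg-one {｛ a ｝} a λ _ → ｛｝∈) (dg-one {｛ b ｝} b λ _ → ｛｝∈)
        where
        exits : ∀ {u w} → u ∈ C → w ∈ F → u ~ w → w ∈ C ⊎ w ≡ a ⊎ w ≡ b
        exits = c
        flip : ∀ {w x y} → w ∈ C ⊎ w ≡ x ⊎ w ≡ y → w ∈ C ⊎ w ≡ y ⊎ w ≡ x
        flip (inj₁ x) = inj₁ x
        flip (inj₂ (inj₁ x)) = inj₂ (inj₂ x)
        flip (inj₂ (inj₂ x)) = inj₂ (inj₁ x)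
        out₂ : ∀ {w} → w ∈ C ⊎ w ≡ a ⊎ w ≡ b → w ∈ C ⊎ w ∈ ｛ a ｝ ∪ ｛ b ｝
        out₂ (inj₁ x) = inj₁ x
        out₂ (inj₂ (inj₁ refl)) = inj₂ (∪ˡ ∈｛｝)
        out₂ (inj₂ (inj₂ refl)) = inj₂ (∪ʳ {S = ｛ a ｝} ∈｛｝)
        one-hub : ∀ x y → y ∉ C → (∀ {u w} → u ∈ C → w ∈ F → u ~ w → w ∈ C ⊎ w ≡ x ⊎ w ≡ y) →
                  ∀ {D u} → Closed C D → u ∈ D → Meets D (N x)
        one-hub x y y∉ out {D} d m with meets? D (N x)
        ... | inj₁ r = r
        ... | inj₂ g = let (v , v∈ , t) = rgX rg y cl′ m in ⊥-elim (h (sub d v∈) t)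
          where
          cl′ : Closed (F ∖ y) D
          cl′ = record { sub = λ s → ∖⁺ (i (sub d s)) (λ { refl → y∉ (sub d s) }) ; cl = go }
            where
            go : ∀ {u v} → u ∈ D → v ∈ F ∖ y → u ~ v → v ∈ D
            go s t e with out (sub d s) (∖ˡ t) e
            ... | inj₁ v∈ = cl d s v∈ e
            ... | inj₂ (inj₁ refl) = ⊥-elim (g s (~-sym e))
            ... | inj₂ (inj₂ refl) = ⊥-elim (∉∖ t)
        both : ∀ w {D u} → Closed (C ∖ w) D → u ∈ D → Meets D (N a ∪ N b)
        both w {D} d m with meets? D (N a ∪ N b)
        ... | inj₁ r = r
        ... | inj₂ g = let (v , v∈ , t) = rgX rg w cl′ m in ⊥-elim (h (∖ˡ (sub d v∈)) t)
          where
          cl′ : Closed (F ∖ w) D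
          cl′ = record { sub = λ s → ∖⁺ (i (∖ˡ (sub d s))) (∖ʳ (sub d s)) ; cl = go }
            where
            go : ∀ {u v} → u ∈ D → v ∈ F ∖ w → u ~ v → v ∈ D
            go s t e with exits (∖ˡ (sub d s)) (∖ˡ t) e
            ... | inj₁ v∈ = cl d s (∖⁺ v∈ (∖ʳ t)) e
            ... | inj₂ (inj₁ refl) = ⊥-elim (g s (∪ˡ (~-sym e)))
            ... | inj₂ (inj₂ refl) = ⊥-elim (g s (∪ʳ {S = N a} (~-sym e)))

    opaque
      extend : ∀ {a b C} → a ∈ P → b ∈ Q → a ∈ F → b ∈ F → a ≢ b → a ∉ C → b ∉ C → C ⊑ F → Adm k C (N a) (N b) → Adm k F P Q
      extend {a} {b} {C} p q a∈ b∈ ne a∉ b∉ i adm =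
        combine {X = ｛ a ｝} {C} {｛ b ｝} {a = 1} {1} {1} 1 k k (inj₁ refl) ≤-refl k≥1 ≤-refl
          (λ m → subst (_∈ F) (sym (｛｝∈ m)) a∈) i (λ m → subst (_∈ F) (sym (｛｝∈ m)) b∈)
          (λ m c → a∉ (subst (_∈ C) (｛｝∈ m) c)) (λ m m′ → ne (trans (sym (｛｝∈ m)) (｛｝∈ m′)))
          (λ c m → b∉ (subst (_∈ C) (｛｝∈ m) c))
          (λ { _ e zero _ → Pre-single p e ; _ _ (suc _) (s≤s ()) }) (λ _ e → Pre-single q e) adm

    AB₁ : ∀ {u} → u ∈ F → u ∈ P → u ∈ Q → AB F P Q 1
    AB₁ f p q = _ , _ , p , q , one f

    AB₂ : ∀ {u v} → u ∈ F → v ∈ F → u ~ v → u ∈ P → v ∈ Q → AB F P Q 2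
    AB₂ f g e p q = _ , _ , p , q , cons f e (one (∖⁺ g λ { refl → ~-irr e }))

    two-short : k ≤ 2 → AB F P Q 1 → AB F P Q 2 → Adm k F P Q
    two-short h a b = adm-run k 1 2 (+-monoˡ-≤ 1 h) λ
      { (suc zero) _ _ → a ; (suc (suc zero)) _ _ → b ; (suc (suc (suc c))) _ (s≤s (s≤s ())) }

    -- The core is empty and the last step is from `q` to `y`, so pieces are entered directly from
    -- `x`. After this case `y` can be assumed to have two neighbours other than `z`.
    module OneExit {q : V} (q∈ : q ∈ F) (qQ : q ∈ Q) (only : ∀ {u} → u ∈ F → u ∈ Q → u ≡ q ⊎ u ≡ z)
                   (v₀ : ∃[ v ] v ∈ F × v ≢ z) where

      S : Sub n
      S = F ─ ∅ ─ ｛ q ｝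

      S⊑ : S ⊑ F ∖ q
      S⊑ m = ∖⁺ (─ˡ (─ˡ m)) (λ { refl → ─ʳ {S = F ─ ∅} m ∈｛｝ })

      ⊑S : F ∖ q ⊑ S
      ⊑S m = ─⁺ (─⁺ (∖ˡ m) ∉∅) (λ s → ∖ʳ m (｛｝∈ s))

      O : Sub n
      O = P ∪ Q ∖ q

      open Launch I ∅ O F id

      PQ⇒O : ∀ {C} → C ⊑ F ∖ q → Meets C (P ∪ Q) → Meets C O
      PQ⇒O i (v , a , b) = v , a , [ ∪ˡ , (λ x → ∪ʳ {S = P} (∖⁺ x (∖ʳ (i a)))) ]′ (∪⁻ {S = P} b)

      provider : Provider
      provider {K} p h (v , m) _ = inj₁ (x-source (L p) attached λ _ b → ∉∅ (proj₂ (proj₂ (nb∈ b))))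
        where
        attached : Meets K P
        attached with toO p whole-set m
        ... | w , w∈ , t with ∪⁻ {S = P} t
        ... | inj₁ x = w , w∈ , x
        ... | inj₂ x with only (inF p w∈) (∖ˡ x)
        ... | inj₂ refl = ⊥-elim (h w∈)
        ... | inj₁ refl = ⊥-elim (∉∖ x)

      meetsO : ∀ {C u} → Closed S C → u ∈ C → Meets C O
      meetsO c m = PQ⇒O (S⊑ ∘ sub c) (rgX rg q (record { sub = S⊑ ∘ sub c ; cl = λ x y → cl c x (⊑S y) }) m)

      -- Missing the neighbours of q, a set closed without q is closed with it.
      meetsBO : ∀ w {C u} → Closed (S ∖ w) C → u ∈ C → Meets C (N q ∪ O)
      meetsBO w {C} c m with meets? C (N q)
      ... | inj₁ (v , a , b) = v , a , ∪ˡ b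
      ... | inj₂ g with PQ⇒O (S⊑ ∘ ∖ˡ ∘ sub c) (rgX rg w (record { sub = λ x → ∖⁺ (∖ˡ (S⊑ (∖ˡ (sub c x)))) (∖ʳ (sub c x)) ; cl = go }) m)
        where
        go : ∀ {u v} → u ∈ C → v ∈ F ∖ w → u ~ v → v ∈ C
        go {v = v} x y e with v Fin.≟ q
        ... | yes refl = ⊥-elim (g x (~-sym e))
        ... | no ne    = cl c x (∖⁺ (⊑S (∖⁺ (∖ˡ y) ne)) (∖ʳ y)) e
      ... | v , a , b = v , a , ∪ʳ {S = N q} b

      degs : ∀ {u} → u ∈ S → u ≢ z → k + 1 ≤ dg S u + dg ∅ u + bit (P u) + bit (N q u)
      degs {u} m h = lin 8 (λ k g p b s o i t → k ⊕ κ 1 ≼ g ⊕ p ⊕ b ⇛ b ≼ κ 0 ⇛ g ≼ s ⊕ t ⇛ t ≼ i ⇛ ⊢ k ⊕ κ 1 ≼ s ⊕ o ⊕ p ⊕ i) refl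
        k (dg F u) (bit (P u)) (bit (Q u)) (dg S u) (dg ∅ u) (bit (N q u)) (dg ｛ q ｝ u)
        (degF (∖ˡ (S⊑ m)) h) (≤-reflexive (bit-false notQ))
        (dg-cover {F} {S} {｛ q ｝} λ _ f → [ inj₂ , inj₁ ∘ ⊑S ]′ (split-at q f)) (dg-one {｛ q ｝} q λ _ → ｛｝∈)
        where
        notQ : u ∉ Q
        notQ b with only (∖ˡ (S⊑ m)) b
        ... | inj₁ refl = ∖ʳ (S⊑ m) refl
        ... | inj₂ refl = h refl

      open Depart (N q) ｛ q ｝ 1 (λ m → subst (_∈ F) (sym (｛｝∈ m)) q∈) (⊥-elim ∘ ∉∅) (λ e → Pre-single qQ e)
                  (q , q∈ , λ m → ∖ʳ (S⊑ m) refl) meetsO meetsBO degs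

      -- With a single neighbour in `F`, the degree `k + 1` of `q` is at most 3, and for `k` at
      -- least 2 it needs the edge to `x`.
      dgq≤ : q ≢ z → ∀ {w} → (∀ {u} → u ∈ F → q ~ u → u ≡ w) → k ≤ 2 × q ∈ P
      dgq≤ q≢z {w} h = ≤-trans (lin 5 (λ k g p b t → k ⊕ κ 1 ≼ g ⊕ p ⊕ b ⇛ g ≼ κ 1 ⇛ b ≼ κ 1 ⇛ ⊢ k ≼ p ⊕ κ 1) refl
                               k (dg F q) (bit (P q)) (bit (Q q)) 0 (degF q∈ q≢z) one-nbr (bit≤1 (Q q))) (+-monoˡ-≤ 1 (bit≤1 (P q)))
                         , isP
        where
        one-nbr : dg F q ≤ 1
        one-nbr = #-single {S = N q ∩ F} w λ m → h (∩ʳ {S = N q} m) (∩ˡ m)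
        isP : q ∈ P
        isP with q ∈? P
        ... | yes p = p
        ... | no p  = ⊥-elim (1+n≰n (≤-trans k≥2 (lin 4 (λ k g p b → k ⊕ κ 1 ≼ g ⊕ p ⊕ b ⇛ g ≼ κ 1 ⇛ b ≼ κ 1 ⇛ p ≼ κ 0 ⇛ ⊢ k ≼ κ 1) refl
                               k (dg F q) (bit (P q)) (bit (Q q)) (degF q∈ q≢z) one-nbr (bit≤1 (Q q)) (≤-reflexive (bit-false p)))))

      opaque
        result : Adm k F P Q
        result with region (zfree provider)
        ... | inj₁ r = r
        ... | inj₂ (inj₁ h) = ⊥-elim isolated
          where
          noN : ∀ {u} → u ∈ F → q ~ u → ⊥
          noN f e = h (⊑S (∖⁺ f (λ { refl → ~-irr e }))) e
          isolated : ⊥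
          isolated with q Fin.≟ z
          ... | no q≢z = 1+n≰n (≤-trans k≥2 (≤-trans
                  (lin 4 (λ k g p b → k ⊕ κ 1 ≼ g ⊕ p ⊕ b ⇛ g ≼ κ 0 ⇛ b ≼ κ 1 ⇛ p ≼ κ 1 ⇛ ⊢ k ≼ κ 1) refl
                     k (dg F q) (bit (P q)) (bit (Q q)) (degF q∈ q≢z) (dg-zero λ e f → noN f e) (bit≤1 (Q q)) (bit≤1 (P q))) ≤-refl))
          ... | yes refl with rgQ rg {F ∖ q} (record { sub = ∖ˡ ; cl = λ {u} m f e → ∖⁺ f λ { refl → noN (∖ˡ m) (~-sym e) } })
                                (∖⁺ (proj₁ (proj₂ v₀)) (proj₂ (proj₂ v₀)))
          ... | w , m , b with only (∖ˡ m) b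
          ... | inj₁ eq = ∖ʳ m eq
          ... | inj₂ eq = ∖ʳ m eq
        ... | inj₂ (inj₂ R) = conclude (meets? K P)
          where
          open Region R
          z∈F : z ∈ F ∖ q
          z∈F = S⊑ (sub shut z∈K)
          q≢z : q ≢ z
          q≢z eq = ∖ʳ z∈F (sym eq)
          nbr∈K : ∀ {u} → u ∈ F → q ~ u → u ∈ K
          nbr∈K f e = all (⊑S (∖⁺ f λ { refl → ~-irr e })) e
          K⊑ : K ⊑ F ∖ q
          K⊑ = S⊑ ∘ sub shut
          conclude : Meets K P ⊎ Misses K P → Adm k F P Q
          conclude (inj₁ m) with peel (zfree provider) piece (x-source (L piece) m λ _ b → ∉∅ (proj₂ (proj₂ (nb∈ b)))) z∈K
          ... | inj₁ r = r
          -- The paths `x q y` and `x e q y`, where `e` is the one neighbour of `q` in `F`.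
          ... | inj₂ t = two-short (proj₁ small) (AB₁ q∈ (proj₂ small) qQ)
                          (AB₂ (∖ˡ (K⊑ (e∈K t))) q∈ (~-sym (e∈B t)) (e∈A t) qQ)
            where
              small : k ≤ 2 × q ∈ P
              small = dgq≤ q≢z {e t} λ f a → only-B t (nbr∈K f a) a
          conclude (inj₂ h) with find (K ∖ z)
          ... | inj₁ g = two-short (proj₁ small) (AB₁ q∈ (proj₂ small) qQ) (AB₂ q∈ (∖ˡ z∈F) q~z (proj₂ small) z∈Q)
            where
            isz : ∀ {u} → u ∈ K → u ≡ z
            isz {u} m with u Fin.≟ z
            ... | yes eq = eq
            ... | no ne  = ⊥-elim (g u (∖⁺ m ne))
            small : k ≤ 2 × q ∈ P
            small = dgq≤ q≢z {z} λ f a → isz (nbr∈K f a)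
            q~z : q ~ z
            q~z = let (w , m , e) = toB piece whole-set z∈K in subst (q ~_) (isz m) e
            z∈Q : z ∈ Q
            z∈Q with PQ⇒O K⊑ (rgX rg q (record { sub = K⊑ ; cl = λ x y → cl shut x (⊑S y) }) z∈K)
            ... | w , m , o with ∪⁻ {S = P} o
            ... | inj₁ p = ⊥-elim (h m p)
            ... | inj₂ b = subst (_∈ Q) (isz m) (∖ˡ b)
          -- In `K` there is no neighbour of `x`, and none of `y` but `z`. So `K ∖ z` hangs on `q`
          -- and `z`, and the paths begin with `x q` and end with `z y`.
          ... | inj₂ (v , v∈) = extend q∈P z∈Q q∈ (∖ˡ z∈F) q≢z (λ m → ∖ʳ (K⊑ (∖ˡ m)) refl) ∉∖ (∖ˡ ∘ K⊑ ∘ ∖ˡ)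
                  (two-hubs q∈ (λ m → ∖ʳ (K⊑ (∖ˡ m)) refl) ∉∖ (∖ˡ ∘ K⊑ ∘ ∖ˡ) exits noPQ v∈ ∉∖)
            where
            Qz : ∀ {u} → u ∈ K → u ∈ Q → u ≡ z
            Qz m b with only (∖ˡ (K⊑ m)) b
            ... | inj₁ refl = ⊥-elim (∖ʳ (K⊑ m) refl)
            ... | inj₂ eq = eq
            z∈Q : z ∈ Q
            z∈Q with PQ⇒O K⊑ (rgX rg q (record { sub = K⊑ ; cl = λ x y → cl shut x (⊑S y) }) z∈K)
            ... | w , m , o with ∪⁻ {S = P} o
            ... | inj₁ p = ⊥-elim (h m p)
            ... | inj₂ b = subst (_∈ Q) (Qz m (∖ˡ b)) (∖ˡ b)
            noPQ : Misses (K ∖ z) (P ∪ Q)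
            noPQ m o = [ h (∖ˡ m) , (λ b → ∖ʳ m (Qz (∖ˡ m) b)) ]′ (∪⁻ {S = P} o)
            exits : ∀ {u w} → u ∈ K ∖ z → w ∈ F → u ~ w → w ∈ K ∖ z ⊎ w ≡ q ⊎ w ≡ z
            exits {w = w} m f e with w Fin.≟ q | w Fin.≟ z
            ... | yes a | _     = inj₂ (inj₁ a)
            ... | no _  | yes a = inj₂ (inj₂ a)
            ... | no a  | no b  = inj₁ (∖⁺ (cl shut (∖ˡ m) (⊑S (∖⁺ f a)) e) b)
            -- Everything outside K ∪ {q} would be closed in F without meeting Q.
            q∈P : q ∈ P
            q∈P with q ∈? P
            ... | yes p = p
            ... | no np = ⊥-elim (other (rgQ rg rest-closed (proj₂ rest-member)))
              where
              rest-member : ∃[ w ] w ∈ F ∖ q ─ K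
              rest-member with rgP rg whole-set q∈
              ... | w , f , p = w , ─⁺ (∖⁺ f λ { refl → np p }) (λ m → h m p)
              rest-closed : Closed F (F ∖ q ─ K)
              rest-closed = record { sub = ∖ˡ ∘ ─ˡ ; cl = go }
                where
                go : ∀ {u v} → u ∈ F ∖ q ─ K → v ∈ F → u ~ v → v ∈ F ∖ q ─ K
                go {u} {v} m f e = ─⁺ (∖⁺ f λ { refl → ─ʳ {S = F ∖ q} m (nbr∈K (∖ˡ (─ˡ m)) (~-sym e)) })
                  (λ v∈K → ─ʳ {S = F ∖ q} m (cl shut v∈K (⊑S (─ˡ m)) (~-sym e)))
              other : Meets (F ∖ q ─ K) Q → ⊥
              other (w , m , b) with only (∖ˡ (─ˡ m)) b
              ... | inj₁ eq = ∖ʳ (─ˡ m) eq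
              ... | inj₂ refl = ─ʳ {S = F ∖ q} m z∈K

-- Paths in cliques and complete bipartite graphs.

module Families {n : ℕ} (G : Graph n) where

  open Walks G
  open Rooted G

  Complete : Sub n → Sub n → Set
  Complete T R = ∀ {t r} → t ∈ T → r ∈ R → t ~ r

  Clique : Sub n → Set
  Clique S = ∀ {u v} → u ∈ S → v ∈ S → u ≢ v → u ~ v

  complete-∖ : ∀ {T R s r} → Complete T R → Complete (T ∖ s) (R ∖ r)
  complete-∖ c t r = c (∖ˡ t) (∖ˡ r)

  clique-∖ : ∀ {S s} → Clique S → Clique (S ∖ s)
  clique-∖ c u v = c (∖ˡ u) (∖ˡ v)

  complete-disjoint : ∀ {T R} → Complete T R → Disjoint T R
  complete-disjoint c t r = ~-irr (c t r)

  remove : ∀ {S : Sub n} {a m} → suc m ≤ # S → m ≤ # (S ∖ a)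
  remove {S} {a} {m} h = +-cancelʳ-≤ 1 m (# (S ∖ a)) (≤-trans (≤-reflexive (+-comm m 1)) (≤-trans h (#-∖ S a)))

  two-steps : ∀ {T R s r v w c} → Disjoint T R → s ∈ T → r ∈ R → s ~ r → r ~ v →
              Walk ((T ∖ s) ∪ (R ∖ r)) v w c → Walk (T ∪ R) s w (2 + c)
  two-steps {T} {R} {s} {r} d s∈ r∈ e f p =
    cons (∪ˡ s∈) e (cons (∖⁺ (∪ʳ {S = T} r∈) λ { refl → d s∈ r∈ }) f (walk-mono incl p))
    where
    incl : (T ∖ s) ∪ (R ∖ r) ⊑ (T ∪ R) ∖ s ∖ r
    incl m with ∪⁻ {S = T ∖ s} m
    ... | inj₁ x = ∖⁺ (∖⁺ (∪ˡ (∖ˡ x)) (∖ʳ x)) (λ { refl → d (∖ˡ x) r∈ })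
    ... | inj₂ x = ∖⁺ (∖⁺ (∪ʳ {S = T} (∖ˡ x)) (λ { refl → d s∈ (∖ˡ x) })) (∖ʳ x)

  opaque
    zigzag-T : ∀ j {T R t} → Complete T R → t ∈ T → suc j ≤ # T → j ≤ # R →
               ∃[ s ] s ∈ T × Walk (T ∪ R) s t (1 + j * 2)
    zigzag-T zero c t∈ _ _ = _ , t∈ , one (∪ˡ t∈)
    zigzag-T (suc j) {T} {R} {t} c t∈ hT hR with #-pick≢ t (≤-trans (s≤s (s≤s z≤n)) hT) | #-pick (≤-trans (s≤s z≤n) hR)
    ... | s , s∈ , s≢t | r , r∈ with zigzag-T j (complete-∖ c) (∖⁺ t∈ (s≢t ∘ sym)) (remove hT) (remove hR)
    ... | v , v∈ , p = s , s∈ , two-steps (complete-disjoint c) s∈ r∈ (c s∈ r∈) (~-sym (c (∖ˡ v∈) r∈)) p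

  opaque
    zigzag-R : ∀ j {T R r} → Complete T R → r ∈ R → suc j ≤ # T → suc j ≤ # R →
               ∃[ s ] s ∈ T × Walk (T ∪ R) s r (2 + j * 2)
    zigzag-R zero {T} c r∈ hT _ with #-pick hT
    ... | s , s∈ = s , s∈ , cons (∪ˡ s∈) (c s∈ r∈) (one (∖⁺ (∪ʳ {S = T} r∈) λ { refl → ~-irr (c s∈ r∈) }))
    zigzag-R (suc j) {T} {R} {r} c r∈ hT hR with #-pick (≤-trans (s≤s z≤n) hT) | #-pick≢ r (≤-trans (s≤s (s≤s z≤n)) hR)
    ... | s , s∈ | r′ , r′∈ , ne with zigzag-R j (complete-∖ c) (∖⁺ r∈ (ne ∘ sym)) (remove hT) (remove hR)
    ... | v , v∈ , p = s , s∈ , two-steps (complete-disjoint c) s∈ r′∈ (c s∈ r′∈) (~-sym (c (∖ˡ v∈) r′∈)) p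

  opaque
    clique-walk : ∀ m {S s} → Clique S → s ∈ S → suc m ≤ # S → ∃[ v ] v ∈ S × Walk S v s (suc m)
    clique-walk zero c s∈ _ = _ , s∈ , one s∈
    clique-walk (suc m) {S} {s} c s∈ h with #-pick≢ s (≤-trans (s≤s (s≤s z≤n)) h)
    ... | u , u∈ , ne with clique-walk m (clique-∖ c) (∖⁺ s∈ (ne ∘ sym)) (remove h)
    ... | v , v∈ , p = u , u∈ , cons u∈ (c u∈ (∖ˡ v∈) (λ eq → ∖ʳ v∈ (sym eq))) p

  opaque
    -- `j` vertices of `R` are visited between vertices of `T`, and `m + 1` are kept for the last
    -- stretch inside the clique.
    zigzag-clique : ∀ j m {T R s} → Complete T R → Clique R → s ∈ R → suc j ≤ # T → suc (j + m) ≤ # R →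
                    ∃[ t ] t ∈ T × Walk (T ∪ R) t s (j * 2 + (2 + m))
    zigzag-clique zero m {T} c q s∈ hT hR with #-pick hT | clique-walk m q s∈ hR
    ... | t , t∈ | v , v∈ , p = t , t∈ , cons (∪ˡ t∈) (c t∈ v∈)
      (walk-mono (λ x → ∖⁺ (∪ʳ {S = T} x) λ { refl → ~-irr (c t∈ x) }) p)
    zigzag-clique (suc j) m {T} {R} {s} c q s∈ hT hR with #-pick (≤-trans (s≤s z≤n) hT) | #-pick≢ s (≤-trans (s≤s (s≤s z≤n)) hR)
    ... | t , t∈ | r , r∈ , ne with zigzag-clique j m (complete-∖ c) (clique-∖ q) (∖⁺ s∈ (ne ∘ sym)) (remove hT) (remove hR)
    ... | v , v∈ , p = t , t∈ , two-steps (complete-disjoint c) t∈ r∈ (c t∈ r∈) (~-sym (c (∖ˡ v∈) r∈)) p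

  half : ∀ i → ∃[ j ] (i ≡ j * 2 ⊎ i ≡ suc (j * 2))
  half zero = 0 , inj₁ refl
  half (suc i) with half i
  ... | j , inj₁ e = j , inj₂ (cong suc e)
  ... | j , inj₂ e = suc j , inj₁ (cong suc e)

  halve : ∀ {a b} → a + a ≤ b + b + 1 → a ≤ b
  halve {a} {b} h with a ≤? b
  ... | yes l = l
  ... | no g  = ⊥-elim (1+n≰n {b + b + 1}
    (lin 3 (λ a b z → κ 1 ⊕ b ≼ a ⇛ κ 1 ⊕ b ≼ a ⇛ a ⊕ a ≼ b ⊕ b ⊕ κ 1 ⇛ ⊢ κ 1 ⊕ (b ⊕ b ⊕ κ 1) ≼ b ⊕ b ⊕ κ 1) refl
       a b 0 (≰⇒> g) (≰⇒> g) h))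

  double : ∀ j → j * 2 ≡ j + j
  double zero    = refl
  double (suc j) = cong suc (trans (cong suc (double j)) (sym (+-suc j j)))

  opaque
    append : ∀ {S T u v w c} → Walk S u v c → S ⊑ T → w ∈ T → w ∉ S → v ~ w → Walk T u w (suc c)
    append {T = T} {u} {v} {w} {c} p i w∈ w∉ e = subst (Walk T u w) (+-comm c 1)
      (walk-mono (λ m → [ i , (λ x → subst (_∈ T) (sym (｛｝∈ x)) w∈) ]′ (∪⁻ m))
        (walk-++ p e (one (∈｛｝ {u = w})) λ m k → w∉ (subst (_∈ _) (｛｝∈ k) m)))

  -- Either the clique S is all of R, or R is small and a single edge of S changes the parity.
  opaque
    reach-clique : ∀ {T R S s} c → Complete T R → S ⊑ R → Clique S → 2 ≤ # S → R ⊑ S ⊎ c ≤ # T + # T + 1 → s ∈ S → 1 ≤ # T →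
                   2 ≤ c → c ≤ # R + # T → c ≤ # R + # R → ∃[ t ] t ∈ T × Walk (T ∪ R) t s c
    reach-clique {T} {R} (suc (suc i)) cp S⊑R cq _ (inj₁ R⊑S) s∈ T≥1 _ h₁ h₂ with suc i ≤? # R
    ... | yes a = zigzag-clique 0 i cp (λ u v → cq (R⊑S u) (R⊑S v)) (S⊑R s∈) T≥1 a
    ... | no a = let (t , t∈ , p) = zigzag-clique j m cp (λ u v → cq (R⊑S u) (R⊑S v)) (S⊑R s∈)
                       (lin 4 (λ r t i j → κ 2 ⊕ i ≼ r ⊕ t ⇛ j ⊕ r ≼ κ 1 ⊕ i ⇛ ⊢ κ 1 ⊕ j ≼ t) refl (# R) (# T) i j h₁ (≤-reflexive jR))
                       (lin 4 (λ r i j m → m ⊕ (j ⊕ j) ≼ i ⇛ κ 1 ⊕ i ≼ j ⊕ r ⇛ ⊢ κ 1 ⊕ (j ⊕ m) ≼ r) refl (# R) i j m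
                          (≤-reflexive mj) (≤-reflexive (sym jR)))
                 in t , t∈ , subst (Walk _ t _) count p
      where
      -- The path uses all of `R` and `j + 1` vertices of `T`, together `c`; alternation takes `j`
      -- vertices of `R` and leaves `m + 1` for the clique.
      j : ℕ
      j = suc i ∸ # R
      jR : j + # R ≡ suc i
      jR = m∸n+n≡m (<⇒≤ (≰⇒> a))
      m : ℕ
      m = i ∸ (j + j)
      mj : m + (j + j) ≡ i
      mj = m∸n+n≡m (lin 3 (λ r i j → j ⊕ r ≼ κ 1 ⊕ i ⇛ j ⊕ r ≼ κ 1 ⊕ i ⇛ κ 2 ⊕ i ≼ r ⊕ r ⇛ ⊢ j ⊕ j ≼ i) refl
                      (# R) i j (≤-reflexive jR) (≤-reflexive jR) h₂)
      count : j * 2 + (2 + m) ≡ 2 + i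
      count = begin
        j * 2 + (2 + m)      ≡⟨ cong (_+ (2 + m)) (double j) ⟩
        j + j + (2 + m)      ≡⟨ +-comm (j + j) (2 + m) ⟩
        2 + (m + (j + j))    ≡⟨ cong (2 +_) mj ⟩
        2 + i                ∎
        where open ≡-Reasoning
    reach-clique {T} {R} {S} {s} (suc (suc i)) cp S⊑R cq S≥2 (inj₂ c≤) s∈ T≥1 _ h₁ h₂ with half i
    ... | j , inj₁ refl = zigzag-R j cp (S⊑R s∈) (halve (≤-trans (≤-reflexive two) c≤)) (halve (≤-trans (≤-reflexive two) (≤-trans h₂ (m≤m+n _ 1))))
      where
      two : suc j + suc j ≡ 2 + j * 2
      two = trans (cong suc (+-suc j j)) (cong (2 +_) (sym (double j)))
    ... | j , inj₂ refl with #-pick≢ s S≥2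
    ... | s′ , s′∈ , ne with zigzag-R j {T} {R ∖ s} (λ t r → cp t (∖ˡ r)) (∖⁺ (S⊑R s′∈) ne) jT (remove jR)
      where
      jR : suc (suc j) ≤ # R
      jR = halve (lin 3 (λ j r d → κ 3 ⊕ d ≼ r ⊕ r ⇛ j ⊕ j ≼ d ⇛ ⊢ κ 2 ⊕ j ⊕ (κ 2 ⊕ j) ≼ r ⊕ r ⊕ κ 1) refl j (# R) (j * 2) h₂ (≤-reflexive (sym (double j))))
      jT : suc j ≤ # T
      jT = halve (lin 3 (λ j r d → κ 3 ⊕ d ≼ r ⊕ r ⊕ κ 1 ⇛ j ⊕ j ≼ d ⇛ ⊢ κ 1 ⊕ j ⊕ (κ 1 ⊕ j) ≼ r ⊕ r ⊕ κ 1) refl j (# T) (j * 2) c≤ (≤-reflexive (sym (double j))))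
    ... | t , t∈ , p = t , t∈ , append p (λ m → [ ∪ˡ , ∪ʳ {S = T} ∘ ∖ˡ ]′ (∪⁻ m)) (∪ʳ {S = T} (S⊑R s∈))
                         (λ m → [ (λ x → ~-irr (cp x (S⊑R s∈))) , ∉∖ ]′ (∪⁻ m)) (cq s′∈ s∈ ne)
    reach-clique (suc zero) _ _ _ _ _ _ _ (s≤s ()) _ _

-- What a core at `x` says about the neighbours of `y`; hubs.

module Analysis {n : ℕ} (G : Graph n) where

  open Walks G
  open Rooted G
  open Start G
  open Families G

  module Side (I : Problem) where

    open Problem I

    open Whole I public

    -- The vertices of Q \ {e} lie in R and are fewer than those of T; either e is
    -- the exception z, or it is a vertex outside the core adjacent to z.
    record RKind (H T R : Sub n) : Set where
      field
        e     : V
        toR   : ∀ {q} → q ∈ F → q ∈ Q → q ≢ e → q ∈ R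
        small : # ((F ∩ Q) ∖ e) < # T
        tiny  : e ≢ z → e ~ z × z ∉ H × z ∉ nb T

    TKind : Sub n → Set
    TKind T = ∀ {q} → q ∈ F → q ∈ Q → q ≢ z → q ∈ T

    -- A core (T, R) is complete bipartite and Q independent, so the members of Q
    -- in the core lie on one side.
    one-side : ∀ {T R} → T ⊑ F → R ⊑ F → Complete T R → (∀ {u v} → u ∈ F → v ∈ F → u ∈ Q → v ∈ Q → u ∉ N v) →
           (∀ {q} → q ∈ F → q ∈ Q → q ≢ z → q ∈ T ∪ R) → TKind T ⊎ (∀ {q} → q ∈ F → q ∈ Q → q ≢ z → q ∈ R)
    one-side {T} {R} T⊑ R⊑ c ind h with find (((F ∩ Q) ∖ z) ∩ T)
    ... | inj₁ none = inj₂ λ {q} f b ne → [ (λ t → ⊥-elim (none q (∩⁺ (∖⁺ (∩⁺ f b) ne) t))) , id ]′ (∪⁻ (h f b ne))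
    ... | inj₂ (t , m) = inj₁ λ {q} f b ne → [ id , (λ r → ⊥-elim (ind (R⊑ r) (T⊑ t∈) b (∩ʳ {S = F} (∖ˡ (∩ˡ m))) (c t∈ r))) ]′ (∪⁻ (h f b ne))
      where
      t∈ : t ∈ T
      t∈ = ∩ʳ {S = (F ∩ Q) ∖ z} m

    module With (H : Sub n) (H⊑F : H ⊑ F) (h₀ : ∃[ h ] h ∈ H) where

      O : Sub n
      O = P ∪ nb H

      open Launch I H O F id public

      S : Sub n
      S = F ─ H ─ ∅

      ∈S : ∀ {u} → u ∈ F → u ∉ H → u ∈ S
      ∈S f h = ─⁺ (─⁺ f h) ∉∅

      S⊑F : S ⊑ F
      S⊑F = ─ˡ ∘ ─ˡ

      S-off : ∀ {u} → u ∈ S → u ∉ H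
      S-off m = ─ʳ {S = F} (─ˡ m)

      put-back : ∀ {C} → Closed S C → Misses C (nb H) → Closed F C
      put-back {C} c g = record { sub = S⊑F ∘ sub c ; cl = go }
        where
        go : ∀ {u v} → u ∈ C → v ∈ F → u ~ v → v ∈ C
        go {v = v} m f e with v ∈? H
        ... | yes h = ⊥-elim (g m (∈nb e h))
        ... | no h  = cl c m (∈S f h) e

      put-back-∖ : ∀ {w C} → Closed (S ∖ w) C → Misses C (nb H) → Closed (F ∖ w) C
      put-back-∖ {w} {C} c g = record { sub = λ m → ∖⁺ (S⊑F (∖ˡ (sub c m))) (∖ʳ (sub c m)) ; cl = go }
        where
        go : ∀ {u v} → u ∈ C → v ∈ F ∖ w → u ~ v → v ∈ C
        go {v = v} m f e with v ∈? H
        ... | yes h = ⊥-elim (g m (∈nb e h))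
        ... | no h  = cl c m (∖⁺ (∈S (∖ˡ f) h) (∖ʳ f)) e

      meetsO : ∀ {C u} → Closed S C → u ∈ C → Meets C O
      meetsO {C} c m with meets? C (nb H)
      ... | inj₁ (v , a , b) = v , a , ∪ʳ {S = P} b
      ... | inj₂ g = let (v , a , b) = rgP rg (put-back c g) m in v , a , ∪ˡ b

      meetsQO : ∀ w {C u} → Closed (S ∖ w) C → u ∈ C → Meets C (Q ∪ O)
      meetsQO w {C} c m with meets? C (nb H)
      ... | inj₁ (v , a , b) = v , a , ∪ʳ {S = Q} (∪ʳ {S = P} b)
      ... | inj₂ g with rgX rg w (put-back-∖ c g) m
      ... | v , a , b = v , a , [ (λ p → ∪ʳ {S = Q} (∪ˡ p)) , ∪ˡ ]′ (∪⁻ {S = P} b)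

      degs : ∀ {u} → u ∈ S → u ≢ z → k + 1 ≤ dg S u + dg H u + bit (P u) + bit (Q u)
      degs {u} m h = ≤-trans (degF (S⊑F m) h)
        (+-monoˡ-≤ (bit (Q u)) (+-monoˡ-≤ (bit (P u)) (dg-cover {F} {S} {H} λ {w} _ f → side w f)))
        where
        side : ∀ w → w ∈ F → w ∈ S ⊎ w ∈ H
        side w f with w ∈? H
        ... | yes h = inj₂ h
        ... | no h  = inj₁ (∈S f h)

      open Depart Q ∅ 0 (⊥-elim ∘ ∉∅) (λ _ → ∉∅) (λ q → inj₁ (refl , q))
                  (proj₁ h₀ , H⊑F (proj₂ h₀) , λ m → S-off m (proj₂ h₀)) meetsO meetsQO degs public using (region)

      attached : ∀ {K B u} (p : Piece K B) → u ∈ K → Misses K (nb H) → Meets K P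
      attached p m g with toO p whole-set m
      ... | v , a , b = v , a , [ id , (λ y → ⊥-elim (g a y)) ]′ (∪⁻ {S = P} b)

      AB-via : ∀ {c e} → Pre P H c e → e ∈ F → e ∉ H → e ∈ Q → AB F P Q (suc c)
      AB-via {c} {e} pre f h q = subst (AB F P Q) (trans (+-identityʳ (c + 1)) (+-comm c 1))
        (glue {X = H} {｛ e ｝} {∅} {e = 0} H⊑F (λ m → subst (_∈ F) (sym (｛｝∈ m)) f) (⊥-elim ∘ ∉∅) (λ x y → h (subst (_∈ H) (｛｝∈ y) x))
          (λ _ → ∉∅) (λ _ → ∉∅) pre (one ∈｛｝) (inj₁ (refl , q)))

      opaque
        -- If `K` is stuck at `e ≠ z`, the piece behind `e` is tried. If that is stuck as well, its
        -- vertex is the only neighbour of `e` inside `K`, and the degree of `e` in `H` and at `x`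
        -- bounds `k`.
        follow : Solved → ∀ {K A B} (p : Piece K B) (t : Stuck K A B) (z∈K : z ∈ K) (ne : e t ≢ z) →
                 (s : Source (K ∖ e t) (L (tail p t z∈K ne))) →
                 Adm k F P Q ⊎ (Stuck (K ∖ e t) (Source.A s) (N (e t)) × k ≤ dg H (e t) + bit (P (e t)) + 1)
        follow solved p t z∈K ne s with peel solved (tail p t z∈K ne) s (∖⁺ z∈K (ne ∘ sym))
        ... | inj₁ r = inj₁ r
        ... | inj₂ t′ = inj₂ (t′ , stuck-deg p t z∈K ne (only-B t′))

      -- Pieces whose only neighbour in H is one vertex h.
      module Hub {h : V} (h∈H : h ∈ H) where

        Only : Sub n → Set
        Only K = ∀ {u w} → u ∈ K → w ∈ H → u ~ w → w ≡ h

        dg-hub : ∀ {K u} → Only K → u ∈ K → dg H u ≤ bit (N h u)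
        dg-hub o m = dg-one {H} h λ e w → o m w e

        -- A second length from x to h, found outside K, makes h a good source.
        hub-source : ∀ {K B} (p : Piece K B) D → Only K → Meets K (N h) → D ⊑ F → Disjoint D K → Disjoint D (L p) → h ∉ D →
                     Adm 2 D P (N h) → Source K (L p)
        hub-source {K} p D o m D⊑F dk dl h∉D (a , d , d≡ , f) = record
          { A = N h ; meetsA = m ; X = D ∪ ｛ h ｝
          ; X-inF = λ x → [ D⊑F , (λ y → subst (_∈ F) (sym (｛｝∈ y)) (H⊑F h∈H)) ]′ (∪⁻ {S = D} x)
          ; X-offK = λ x y → [ (λ d → dk d y) , (λ s → offH p (subst (_∈ K) (｛｝∈ s) y) h∈H) ]′ (∪⁻ {S = D} x)
          ; X-offL = λ x y → [ (λ d → dl d y) , (λ s → L-offH p h∈H (subst (_∈ L p) (｛｝∈ s) y)) ]′ (∪⁻ {S = D} x)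
          ; a = suc a ; d = d ; r = 2 ; d≡ = d≡ ; r≥1 = s≤s z≤n
          ; enter = λ _ e i l → let (s , t , s∈ , t∈ , w) = f i l in
              inj₂ (s , h , s∈ , append w ∪ˡ (∪ʳ {S = D} ∈｛｝) h∉D (~-sym t∈) , e)
          ; bound = λ {u} x _ → lin 3 (λ g p b → g ≼ b ⇛ p ≼ κ 1 ⇛ ⊢ g ⊕ p ⊕ κ 1 ≼ κ 2 ⊕ b) refl
              (dg H u) (bit (P u)) (bit (N h u)) (dg-hub o x) (bit≤1 (P u)) }

        from-P : ∀ {K B B′ K′} (p : Piece K B) → K′ ⊑ F → Disjoint K′ (L p) → (∀ {u} → u ∈ K′ → u ∈ B′ → u ∈ K × u ∈ B) →
                 Adm k K′ P B′ → Adm k F P Q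
        from-P p i dl b = combine {X = ∅} {a = 0} {1} {len p} 1 k k (inj₁ refl) ≤-refl k≥1 ≤-refl (⊥-elim ∘ ∉∅) i (L-inF p)
          (⊥-elim ∘ ∉∅) (⊥-elim ∘ ∉∅) dl (λ { _ a zero _ → inj₁ (refl , a) ; _ _ (suc _) (s≤s ()) })
          (λ x y → let (x′ , y′) = b x y in exit p x′ y′)

        -- For a piece without z the hub h itself can serve as the exceptional vertex;
        -- if it has one neighbour w in the piece, then w does.
        opaque
          hub-free : ∀ {K B} (p : Piece K B) → z ∉ K → (∃[ v ] v ∈ K) → Only K → (∀ {u} → u ∈ K → u ∈ P → u ∉ N h) →
                     (∃[ g ] g ∈ F × g ∉ K × g ≢ h) → (∃[ c ] ∀ {u} → u ∈ N h → Pre P H c u) →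
                     Smaller K → Source K (L p) ⊎ Adm k F P Q
          hub-free {K} {B} p z∉ (v₀ , v₀∈) o apart (g , g∈ , g∉ , g≢h) (c , at-h) rec with meets? K P | meets? K (N h)
          ... | inj₂ noP | inj₁ m = inj₁ (layer p H⊑F m {c} {1} {1} (inj₁ refl) ≤-refl
                (λ { e zero _ → subst (λ t → Pre P H t _) (sym (+-identityʳ c)) (at-h e) ; _ (suc _) (s≤s ()) })
                (λ {u} x _ → lin 3 (λ g p b → g ≼ b ⇛ p ≼ κ 0 ⇛ ⊢ g ⊕ p ⊕ κ 1 ≼ κ 1 ⊕ b) refl
                  (dg H u) (bit (P u)) (bit (N h u)) (dg-hub o x) (≤-reflexive (bit-false (noP x)))))
          ... | _ | inj₂ noH = inj₁ (x-source (L p) (attached p v₀∈ off) off)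
            where
            off : ∀ {u} → u ∈ K → u ∉ nb H
            off x b = let (w , e , w∈) = nb∈ b in noH x (~-sym (subst (_ ~_) (o x w∈ e) e))
          ... | inj₁ mP | inj₁ (w₀ , w₀∈ , w₀~h) = inj₂ (first (rooted? K′ P B′))
            where
            h∉K : h ∉ K
            h∉K x = offH p x h∈H
            K′ : Sub n
            K′ = K ∪ ｛ h ｝
            B′ : Sub n
            B′ = B ∖ h
            K⇒≢h : ∀ {u} → u ∈ K → u ≢ h
            K⇒≢h x refl = h∉K x
            K′⇒K : ∀ {u} → u ∈ K′ → u ≢ h → u ∈ K
            K′⇒K x ne = [ id , (λ y → ⊥-elim (ne (｛｝∈ y))) ]′ (∪⁻ {S = K} x)
            K′⊑F : K′ ⊑ F
            K′⊑F x = [ inF p , (λ y → subst (_∈ F) (sym (｛｝∈ y)) (H⊑F h∈H)) ]′ (∪⁻ {S = K} x)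
            K′-L : Disjoint K′ (L p)
            K′-L x y = [ (λ x′ → L-offK p x′ y) , (λ s → L-offH p h∈H (subst (_∈ L p) (｛｝∈ s) y)) ]′ (∪⁻ {S = K} x)
            smaller : # K′ < # F
            smaller = #-strict K′⊑F g∈ λ x → g∉ (K′⇒K x g≢h)
            dg-h : ∀ {u} → u ∈ K → bit (N h u) ≤ dg ｛ h ｝ u
            dg-h {u} x with u ∈? N h
            ... | yes y rewrite bit-true y = dg-pos (~-sym y) ∈｛｝
            ... | no y  rewrite bit-false y = z≤n
            degs′ : ∀ {u} → u ∈ K′ → u ≢ h → k + 1 ≤ dg K′ u + bit (P u) + bit (B′ u)
            degs′ {u} x ne = lin 9 (λ k g g₁ h p b b₁ i j → k ⊕ κ 1 ≼ g ⊕ h ⊕ p ⊕ b ⇛ h ≼ i ⇛ i ≼ j ⇛ g ⊕ j ≼ g₁ ⇛ b ≼ b₁ ⇛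
                                       ⊢ k ⊕ κ 1 ≼ g₁ ⊕ p ⊕ b₁) refl
              k (dg K u) (dg K′ u) (dg H u) (bit (P u)) (bit (B u)) (bit (B′ u)) (bit (N h u)) (dg ｛ h ｝ u)
              (deg p x′ (λ { refl → z∉ x′ })) (dg-hub o x′) (dg-h x′)
              (#-disjoint {S = N u ∩ K′} {N u ∩ K} {N u ∩ ｛ h ｝} (λ m → ∩⁺ (∩ˡ m) (∪ˡ (∩ʳ {S = N u} m)))
                 (λ m → ∩⁺ (∩ˡ m) (∪ʳ {S = K} (∩ʳ {S = N u} m))) (λ m m′ → K⇒≢h (∩ʳ {S = N u} m) (｛｝∈ (∩ʳ {S = N u} m′))))
              (bit-mono {S = B} {R = B′} λ b → ∖⁺ b ne)
              where
              x′ : u ∈ K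
              x′ = K′⇒K x ne
            strip : ∀ {C} → Closed K′ C → Closed K (C ∖ h)
            strip c = record { sub = λ x → K′⇒K (sub c (∖ˡ x)) (∖ʳ x) ; cl = λ x y e → ∖⁺ (cl c (∖ˡ x) (∪ˡ y) e) (K⇒≢h y) }
            strip-pick : ∀ {C u} → Closed K′ C → u ∈ C → ∃[ v ] v ∈ C ∖ h
            strip-pick {u = u} c x with u Fin.≟ h
            ... | no ne    = u , ∖⁺ x ne
            ... | yes refl = w₀ , ∖⁺ (cl c x (∪ˡ w₀∈) w₀~h) (K⇒≢h w₀∈)
            noB′ : ∀ {C} → (∀ {v} → v ∈ C → v ∈ K′) → Misses C B′ → Misses (C ∖ h) B
            noB′ _ f x b = f (∖ˡ x) (∖⁺ b (∖ʳ x))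
            second : ∀ {w} → (∀ {u} → u ∈ K → u ∈ N h → u ≡ w) → RG K P B ⊎ Bad K P B → Adm k F P Q
            second lone (inj₂ bad) = shrink p v₀∈ P mP z∉ rec bad
            second {w} lone (inj₁ r) = from-P p (inF p) (L-offK p) (λ x y → x , y)
              (below K P B w k (≤-trans (#-strict ∪ˡ (∪ʳ {S = K} ∈｛｝) h∉K) (<⇒≤ smaller)) k≥1 r
                (let (v , a , b) = mP in v , a , λ { refl → apart a b (subst (_∈ N h) (lone w₀∈ w₀~h) w₀~h) })
                λ {u} x ne → lin 5 (λ k g h p b → k ⊕ κ 1 ≼ g ⊕ h ⊕ p ⊕ b ⇛ h ≼ κ 0 ⇛ ⊢ k ⊕ κ 1 ≼ g ⊕ p ⊕ b) refl
                  k (dg K u) (dg H u) (bit (P u)) (bit (B u)) (deg p x λ { refl → z∉ x })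
                  (≤-trans (dg-hub o x) (≤-reflexive (bit-false λ y → ne (lone x y)))))
            first : RG K′ P B′ ⊎ Bad K′ P B′ → Adm k F P Q
            first (inj₁ r) = from-P p K′⊑F K′-L (λ x y → K′⇒K x (∖ʳ y) , ∖ˡ y)
              (below K′ P B′ h k smaller k≥1 r (v₀ , ∪ˡ v₀∈ , K⇒≢h v₀∈) degs′)
            first (inj₂ (badA c x f)) = let (v , y) = strip-pick c x ; (u , a , b) = mP in
              rec (sub-closed p (strip c) y) (z∉ ∘ sub (strip c)) y (#-strict (sub (strip c)) a λ m → f (∖ˡ m) b)
            first (inj₂ (badB c x f)) = let (v , y) = strip-pick c x ; (u , a , b) = toB p (strip c) y in
              ⊥-elim (f (∖ˡ a) (∖⁺ b (∖ʳ a)))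
            first (inj₂ (badX w {C} w∈ c x fA fB)) with w Fin.≟ h
            ... | yes refl = let (u , a , b) = toB p cK x in ⊥-elim (fB a (∖⁺ b (∖ʳ (sub c a))))
              where
              cK : Closed K C
              cK = record { sub = λ m → K′⇒K (∖ˡ (sub c m)) (∖ʳ (sub c m)) ; cl = λ m y e → cl c m (∖⁺ (∪ˡ y) (K⇒≢h y)) e }
            ... | no w≢h with find (C ∖ h)
            ... | inj₂ (v , y) = rec (sub-cut p (K′⇒K w∈ w≢h) cK y (noB′ (∖ˡ ∘ sub c) fB)) (z∉ ∘ ∖ˡ ∘ sub cK) y
                                     (#-strict (∖ˡ ∘ sub cK) (K′⇒K w∈ w≢h) (∉∖ ∘ sub cK))
              where
              cK : Closed (K ∖ w) (C ∖ h)
              cK = record { sub = λ m → ∖⁺ (K′⇒K (∖ˡ (sub c (∖ˡ m))) (∖ʳ m)) (∖ʳ (sub c (∖ˡ m)))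
                          ; cl = λ m y e → ∖⁺ (cl c (∖ˡ m) (∖⁺ (∪ˡ (∖ˡ y)) (∖ʳ y)) e) (K⇒≢h (∖ˡ y)) }
            ... | inj₁ none = second lone (rooted? K P B)
              where
              h∈C : h ∈ C
              h∈C = subst (_∈ C) (is-h x) x
                where
                is-h : ∀ {u} → u ∈ C → u ≡ h
                is-h {u} m with u Fin.≟ h
                ... | yes eq = eq
                ... | no ne  = ⊥-elim (none u (∖⁺ m ne))
              lone : ∀ {u} → u ∈ K → u ∈ N h → u ≡ w
              lone {u} m e with u Fin.≟ w
              ... | yes eq = eq
              ... | no ne  = ⊥-elim (none u (∖⁺ (cl c h∈C (∖⁺ (∪ˡ m) ne) e) (K⇒≢h m)))

      AB-via2 : ∀ {c v e} → Pre P H c v → v ∈ F → v ∉ H → e ∈ F → e ∉ H → v ~ e → e ∈ Q → AB F P Q (2 + c)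
      AB-via2 {c} {v} {e} pre fv hv fe he a q = subst (AB F P Q) (trans (+-identityʳ (c + 2)) (+-comm c 2))
        (glue {X = H} {｛ v ｝ ∪ ｛ e ｝} {∅} {e = 0} H⊑F (λ m → [ at fv , at fe ]′ (∪⁻ {S = ｛ v ｝} m)) (⊥-elim ∘ ∉∅)
          (λ x m → [ (λ s → hv (subst (_∈ H) (｛｝∈ s) x)) , (λ s → he (subst (_∈ H) (｛｝∈ s) x)) ]′ (∪⁻ {S = ｛ v ｝} m))
          (λ _ → ∉∅) (λ _ → ∉∅) pre
          (cons (∪ˡ ∈｛｝) a (one (∖⁺ (∪ʳ {S = ｛ v ｝} ∈｛｝) λ eq → ~⇒≢ a (sym eq)))) (inj₁ (refl , q)))
        where
        at : ∀ {a u} → a ∈ F → u ∈ ｛ a ｝ → u ∈ F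
        at f s = subst (_∈ F) (sym (｛｝∈ s)) f

      plain : ∀ {q} → (∀ {u} → u ∈ S → u ∉ Q) → q ∈ F → q ∈ Q → q ∈ H
      plain {q} h f b with q ∈? H
      ... | yes m = m
      ... | no g  = ⊥-elim (h (∈S f g) b)

      module AtRegion (R : Region S Q ∅) where
        open Region R public

        K⊑F : K ⊑ F
        K⊑F = S⊑F ∘ sub shut

        K-off : ∀ {u} → u ∈ K → u ∉ H
        K-off = S-off ∘ sub shut

        exits : ∀ {q} → q ∈ F → q ∈ Q → q ∉ K → q ∈ H
        exits {q} f b g with q ∈? H
        ... | yes y = y
        ... | no y  = ⊥-elim (g (all (∈S f y) b))

        in-core : ∀ {A} (t : Stuck K A Q) {q} → q ∈ F → q ∈ Q → q ≢ e t → q ∈ H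
        in-core t f b ne = exits f b λ m → ne (only-B t m b)

        L-∅ : ∀ {u} → u ∉ L piece
        L-∅ m = ∉∅ (on-L m)

        stuck-plain : ∀ {A} (t : Stuck K A Q) → e t ≡ z → ∀ {q} → q ∈ F → q ∈ Q → q ≢ z → q ∈ H
        stuck-plain t eq f b ne = in-core t f b λ eq′ → ne (trans eq′ eq)

        tail-off : ∀ {A} (t : Stuck K A Q) (ne : e t ≢ z) → L (tail piece t z∈K ne) ⊑ K
        tail-off t ne m = [ ⊥-elim ∘ L-∅ , id ]′ (∪⁻ {S = L piece} (tail-L piece t z∈K ne m))

        opaque
          -- By `touch`, a vertex of `D` adjacent to `K` or `y` is adjacent to `h` too, so `h` can
          -- play the part of `y`: a closed part of `D` missing `N h` would be closed in `F` and
          -- miss `Q`. Degree 3 then gives two lengths.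
          hub-adm : ∀ {h D} → h ∈ H → Closed (F ─ K ─ ｛ h ｝) D → (∀ {u} → u ∈ D → u ∈ Q ⊎ (∃[ w ] w ∈ K × u ~ w) → u ∈ N h) →
                    (∀ {C u} → Closed D C → u ∈ C → Meets C P) → (∀ {u} → u ∈ D → 3 ≤ dg D u + bit (P u) + bit (N h u)) →
                    (∃[ d ] d ∈ D) → Adm 2 D P (N h)
          hub-adm {h} {D} h∈ cD touch onP deg3 (d₀ , d₀∈) =
            below D P (N h) z 2 (#-strict D⊑F (H⊑F h∈) h∉D) (s≤s z≤n)
              record { rgP = onP ; rgQ = onN ; rgX = onX }
              (d₀ , d₀∈ , λ { refl → D-off d₀∈ z∈K }) (λ m _ → deg3 m)
            where
            D⊑F : D ⊑ F
            D⊑F = ─ˡ ∘ ─ˡ ∘ sub cD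
            D-off : ∀ {u} → u ∈ D → u ∉ K
            D-off m = ─ʳ {S = F} (─ˡ (sub cD m))
            h∉D : h ∉ D
            h∉D m = ─ʳ {S = F ─ K} (sub cD m) ∈｛｝
            reopen : ∀ {C u v} → C ⊑ D → Misses C (N h) → u ∈ C → v ∈ F → u ~ v → v ∈ D
            reopen {v = v} i g m f e with v ∈? K | v Fin.≟ h
            ... | yes v∈ | _        = ⊥-elim (g m (touch (i m) (inj₂ (v , v∈ , e))))
            ... | no _   | yes refl = ⊥-elim (g m (~-sym e))
            ... | no v∉  | no ne    = cl cD (i m) (─⁺ (─⁺ f v∉) (λ s → ne (｛｝∈ s))) e
            onN : ∀ {C u} → Closed D C → u ∈ C → Meets C (N h)
            onN {C} c m with meets? C (N h)
            ... | inj₁ r = r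
            ... | inj₂ g with rgQ rg (record { sub = D⊑F ∘ sub c ; cl = λ x f e → cl c x (reopen (sub c) g x f e) e }) m
            ... | v , a , b = ⊥-elim (g a (touch (sub c a) (inj₁ b)))
            onX : ∀ w {C u} → Closed (D ∖ w) C → u ∈ C → Meets C (P ∪ N h)
            onX w {C} c m with meets? C (P ∪ N h)
            ... | inj₁ r = r
            ... | inj₂ g with rgX rg w (record { sub = λ x → ∖⁺ (D⊑F (∖ˡ (sub c x))) (∖ʳ (sub c x))
                                                ; cl = λ x f e → cl c x (∖⁺ (reopen (∖ˡ ∘ sub c) (λ y s → g y (∪ʳ {S = P} s)) x (∖ˡ f) e) (∖ʳ f)) e }) m
            ... | v , a , b = ⊥-elim ([ (λ p → g a (∪ˡ p)) , (λ q → g a (∪ʳ {S = P} (touch (∖ˡ (sub c a)) (inj₁ q)))) ]′ (∪⁻ {S = P} b))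

-- Adjacent neighbours of `x`: a clique as core.

module CliqueCase {n : ℕ} (G : Graph n) where

  open Walks G
  open Rooted G
  open Start G
  open Families G
  open Analysis G

  record MaximalClique (F P : Sub n) : Set where
    field
      T       : Sub n
      T⊑F     : T ⊑ F
      T⊑P     : T ⊑ P
      clique  : Clique T
      T≥2     : 2 ≤ # T
      maximal : ∀ {u} → u ∈ F → u ∈ P → u ∉ T → ∃[ t ] t ∈ T × t ∉ N u

  module Around (I : Problem) (D : MaximalClique (Problem.F I) (Problem.P I)) where

    open Problem I
    open MaximalClique D
    open Side I
    open With T T⊑F (#-pick (≤-trans (s≤s z≤n) T≥2))

    reach : ∀ {u} → u ∈ nb T → ∀ c → 1 ≤ c → c ≤ # T → Pre P T c u
    reach m (suc c) _ h = let (t , e , t∈) = nb∈ m ; (s , s∈ , p) = clique-walk c clique t∈ h in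
      inj₂ (s , t , T⊑P s∈ , p , ~-sym e)

    -- By maximality a neighbour of `x` outside `T` misses a vertex of `T`, which makes up for its
    -- edge to `x`. Without neighbours in `T` only that edge counts, and |T| ≥ 2 pays for it.
    limit : ∀ {u} → u ∈ F → u ∉ T → dg T u + bit (P u) + 1 ≤ # T + bit (nb T u)
    limit {u} f h with u ∈? nb T | u ∈? P
    ... | no g | _ = lin 4 (λ d p t b → d ≼ κ 0 ⇛ p ≼ κ 1 ⇛ κ 2 ≼ t ⇛ ⊢ d ⊕ p ⊕ κ 1 ≼ t ⊕ b) refl
          (dg T u) (bit (P u)) (# T) (bit (nb T u)) (dg-nb g) (bit≤1 (P u)) T≥2
    ... | yes g | no np = lin 4 (λ d p t b → d ≼ t ⇛ p ≼ κ 0 ⇛ κ 1 ≼ b ⇛ ⊢ d ⊕ p ⊕ κ 1 ≼ t ⊕ b) refl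
          (dg T u) (bit (P u)) (# T) (bit (nb T u)) (dg≤# T u) (≤-reflexive (bit-false np)) (≤-reflexive (sym (bit-true g)))
    ... | yes g | yes p = lin 4 (λ d p t b → κ 1 ⊕ d ≼ t ⇛ p ≼ κ 1 ⇛ κ 1 ≼ b ⇛ ⊢ d ⊕ p ⊕ κ 1 ≼ t ⊕ b) refl
          (dg T u) (bit (P u)) (# T) (bit (nb T u))
          (let (t , t∈ , ne) = maximal f p h in #-strict {S = N u ∩ T} (∩ʳ {S = N u}) t∈ (λ m → ne (∩ˡ m)))
          (bit≤1 (P u)) (≤-reflexive (sym (bit-true g)))

    source : ∀ {K B u} (p : Piece K B) → u ∈ K → Source K (L p)
    source {K} p m with meets? K (nb T)
    ... | inj₂ g = x-source (L p) (attached p m g) g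
    ... | inj₁ g = layer p T⊑F g {1} {1} {# T} (inj₁ refl) (≤-trans (s≤s z≤n) T≥2)
      (λ a i l → reach a (1 + i * 1) (s≤s z≤n) (subst (λ t → suc t ≤ # T) (sym (*-identityʳ i)) l))
      (λ x _ → limit (inF p x) (offH p x))

    solved : Solved
    solved = zfree λ { p _ (_ , m) _ → inj₁ (source p m) }

    opaque
      conclude : (∀ e → ∃[ q ] q ∈ F × q ∈ Q × q ≢ z × q ≢ e) → Adm k F P Q ⊎ TKind T
      conclude twoQ with region solved
      ... | inj₁ r = inj₁ r
      ... | inj₂ (inj₁ h) = inj₂ λ f b _ → plain (λ m → h m) f b
      ... | inj₂ (inj₂ R) = go (peel solved piece (source piece base∈) z∈K)
        where
        open AtRegion R
        go : Adm k F P Q ⊎ Stuck K (Source.A (source piece base∈)) Q → Adm k F P Q ⊎ TKind T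
        go (inj₁ r) = inj₁ r
        go (inj₂ t) with e t Fin.≟ z
        ... | yes eq = inj₂ (stuck-plain t eq)
        ... | no ne with follow solved piece t z∈K ne (source (tail piece t z∈K ne) (∖⁺ z∈K (ne ∘ sym)))
        ... | inj₁ r = inj₁ r
        ... | inj₂ (_ , kb) = inj₁ (finish (ε ∈? nb T))
          where
          ε : V
          ε = e t
          q : V
          q = proj₁ (twoQ ε)
          q∈Q : q ∈ Q
          q∈Q = proj₁ (proj₂ (proj₂ (twoQ ε)))
          q∈T : q ∈ T
          q∈T = in-core t (proj₁ (proj₂ (twoQ ε))) q∈Q (proj₂ (proj₂ (proj₂ (proj₂ (twoQ ε)))))
          direct : ∀ c → 1 ≤ c → c ≤ # T → AB F P Q c
          direct (suc c) _ h = let (s , s∈ , p) = clique-walk c clique q∈T h in s , q , T⊑P s∈ , q∈Q , walk-mono T⊑F p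
          finish : Dec (ε ∈ nb T) → Adm k F P Q
          finish (no g) = adm-run k 1 (# T) (lin 4 (λ k d p t → k ≼ d ⊕ p ⊕ κ 1 ⇛ d ≼ κ 0 ⇛ p ≼ κ 1 ⇛ κ 2 ≼ t ⇛ ⊢ k ⊕ κ 1 ≼ κ 1 ⊕ t) refl
            k (dg T ε) (bit (P ε)) (# T) kb (dg-nb g) (bit≤1 (P ε)) T≥2) direct
          -- The stuck vertex adds one size to the paths ending in `q`: all of `T`, then `ε`, which
          -- is adjacent to `y`.
          finish (yes g) = adm-run k 1 (suc (# T)) (lin 5 (λ k d p t b → k ≼ d ⊕ p ⊕ κ 1 ⇛ d ⊕ p ⊕ κ 1 ≼ t ⊕ b ⇛ b ≼ κ 1 ⇛ ⊢ k ⊕ κ 1 ≼ κ 2 ⊕ t) refl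
            k (dg T ε) (bit (P ε)) (# T) (bit (nb T ε)) kb (limit (K⊑F (e∈K t)) (K-off (e∈K t))) (bit≤1 (nb T ε))) λ c l h → run c l h
            where
            run : ∀ c → 1 ≤ c → c ≤ suc (# T) → AB F P Q c
            run c l h with c ≤? # T
            ... | yes a = direct c l a
            run (suc c) l (s≤s h) | no a = AB-via (reach g c (≤-trans (≤-trans (s≤s z≤n) T≥2) (≤-pred (≰⇒> a))) h)
                                            (K⊑F (e∈K t)) (K-off (e∈K t)) (e∈B t)

-- Bipartite cores, without and with a clique.

module Cores {n : ℕ} (G : Graph n) where

  open Walks G
  open Rooted G
  open Start G
  open Families G

  -- Paths from x into this core alternate between T and R, so those ending in T have an
  -- odd and those ending in R an even number of vertices.
  record Core₂ (E P : Sub n) (z : V) : Set where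
    field
      T R : Sub n
      T⊑E : T ⊑ E
      R⊑E : R ⊑ E
      T⊑P : T ⊑ P
      complete : Complete T R
      common : ∀ {u} → u ∈ E → u ≢ z → u ∈ P → (∀ {r} → r ∈ R → u ~ r) → u ∈ T
      P-ind : ∀ {u v} → u ∈ E → v ∈ E → u ∈ P → v ∈ P → u ∉ N v
      nbT-R : ∀ {u r} → u ∈ E → u ∈ nb T → r ∈ R → u ∉ N r
      R<T : suc (# R) ≤ # T
      maximal : ∀ {u} → u ∈ E → u ∉ R → dg T u ≤ # R + 1

    H : Sub n
    H = T ∪ R

    H⊑E : H ⊑ E
    H⊑E m = [ T⊑E , R⊑E ]′ (∪⁻ m)

    t₀ : ∃[ t ] t ∈ T
    t₀ = #-pick (≤-trans (s≤s z≤n) R<T)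

    nbT-P : ∀ {u} → u ∈ E → u ∈ nb T → u ∉ P
    nbT-P f m p = let (t , e , t∈) = nb∈ m in P-ind (T⊑E t∈) f (T⊑P t∈) p e

    dg-H : ∀ u → dg H u ≤ dg T u + dg R u
    dg-H u = dg-cover {H} {T} {R} λ _ → ∪⁻

    dg-P : ∀ {u} → u ∈ E → u ≢ z → u ∉ T → u ∈ P → dg R u + 1 ≤ # R
    dg-P {u} f uz t∉ p with find (R ─ N u)
    ... | inj₂ (r , m) = ≤-trans (≤-reflexive (+-comm (dg R u) 1))
          (#-strict {S = N u ∩ R} (∩ʳ {S = N u}) (─ˡ m) (λ y → ─ʳ {S = R} m (∩ˡ y)))
    ... | inj₁ g = ⊥-elim (t∉ (common f uz p λ {r} r∈ → near-r r∈ (r ∈? N u)))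
      where
      near-r : ∀ {r} → r ∈ R → Dec (r ∈ N u) → u ~ r
      near-r _ (yes y) = y
      near-r r∈ (no y) = ⊥-elim (g _ (─⁺ r∈ y))

    -- Only edges to `R` and `x` count, and a neighbour of `x` outside `T` misses a vertex of `R`,
    -- by `common`.
    limit-R : ∀ {u} → u ∈ E → u ≢ z → u ∉ H → u ∉ nb T → dg H u + bit (P u) ≤ # R
    limit-R {u} f uz h g with u ∈? P
    ... | yes p = lin 5 (λ d t r p s → d ≼ t ⊕ r ⇛ t ≼ κ 0 ⇛ r ⊕ κ 1 ≼ s ⇛ p ≼ κ 1 ⇛ ⊢ d ⊕ p ≼ s) refl
          (dg H u) (dg T u) (dg R u) (bit (P u)) (# R) (dg-H u) (dg-nb g) (dg-P f uz (h ∘ ∪ˡ) p) (bit≤1 (P u))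
    ... | no p = lin 5 (λ d t r p s → d ≼ t ⊕ r ⇛ t ≼ κ 0 ⇛ r ≼ s ⇛ p ≼ κ 0 ⇛ ⊢ d ⊕ p ≼ s) refl
          (dg H u) (dg T u) (dg R u) (bit (P u)) (# R) (dg-H u) (dg-nb g) (dg≤# R u) (≤-reflexive (bit-false p))

    -- A neighbour of `T` is adjacent neither to `R` nor to `x`, and the maximality of `R` allows it
    -- |R| + 1 neighbours in `T`. This is also the number of sizes of alternating paths ending in
    -- `T`.
    limit-T : ∀ {u} → u ∈ E → u ≢ z → u ∉ H → dg H u + bit (P u) + 1 ≤ suc (# R) + bit (nb T u)
    limit-T {u} f uz h with u ∈? nb T
    ... | no g = lin 4 (λ d p s b → d ⊕ p ≼ s ⇛ ⊢ d ⊕ p ⊕ κ 1 ≼ κ 1 ⊕ s ⊕ b) refl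
          (dg H u) (bit (P u)) (# R) (bit (nb T u)) (limit-R f uz h g)
    ... | yes g = lin 6 (λ d t r p s b → d ≼ t ⊕ r ⇛ t ≼ s ⊕ κ 1 ⇛ r ≼ κ 0 ⇛ p ≼ κ 0 ⇛ κ 1 ≼ b ⇛ ⊢ d ⊕ p ⊕ κ 1 ≼ κ 1 ⊕ s ⊕ b) refl
          (dg H u) (dg T u) (dg R u) (bit (P u)) (# R) (bit (nb T u)) (dg-H u) (maximal f (h ∘ ∪ʳ {S = T}))
          (dg-zero λ e r∈ → nbT-R f g r∈ (~-sym e)) (≤-reflexive (bit-false (nbT-P f g))) (≤-reflexive (sym (bit-true g)))

    reach-T : ∀ {u} → u ∈ nb T → ∀ j → j ≤ # R → Pre P H (1 + j * 2) u
    reach-T m j h = let (t , e , t∈) = nb∈ m ; (s , s∈ , p) = zigzag-T j complete t∈ (≤-trans (s≤s h) R<T) h in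
      inj₂ (s , t , T⊑P s∈ , p , ~-sym e)

    reach-R : ∀ {u} → u ∈ nb R → ∀ j → j < # R → Pre P H (2 + j * 2) u
    reach-R m j h = let (r , e , r∈) = nb∈ m ; (s , s∈ , p) = zigzag-R j complete r∈ (≤-trans h (≤-trans (n≤1+n _) R<T)) h in
      inj₂ (s , r , T⊑P s∈ , p , ~-sym e)

    off-H : ∀ {K} → Misses K (nb T) → Misses K (nb R) → Misses K (nb H)
    off-H g g′ x m with nb∈ m
    ... | w , e , w∈ with ∪⁻ {S = T} w∈
    ... | inj₁ t = g x (∈nb e t)
    ... | inj₂ r = g′ x (∈nb e r)

  module Sources₂ (I : Problem) {E : Sub n} (D : Core₂ E (Problem.P I) (Problem.z I)) (O : Sub n) (E⊑F : E ⊑ Problem.F I) where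

    open Problem I
    open Core₂ D

    open Launch I H O E E⊑F

    H⊑F : H ⊑ F
    H⊑F m = E⊑F (H⊑E m)

    source-T : ∀ {K B} (p : Piece K B) → Meets K (nb T) → Source K (L p)
    source-T p m = layer p H⊑F m {1} {2} (inj₂ refl) (s≤s z≤n) (λ a i l → reach-T a i (≤-pred l))
      (λ x uz → limit-T (inS p x) uz (offH p x))

    -- The paths ending in `R` have |R| sizes. A vertex next to neither `T` nor `R` may still be
    -- adjacent to `x`, which is affordable for |R| ≥ 2; otherwise the one vertex of `R` is treated
    -- as a hub.
    source-R : ∀ {K B} (p : Piece K B) → Misses K (nb T) → Meets K (nb R) → 2 ≤ # R → Source K (L p)
    source-R p g m R≥2 = layer p H⊑F m {2} {2} (inj₂ refl) (≤-trans (s≤s z≤n) R≥2) reach-R bd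
      where
      bd : ∀ {u} → u ∈ _ → u ≢ z → dg H u + bit (P u) + 1 ≤ # R + bit (nb R u)
      bd {u} x uz with u ∈? nb R
      ... | yes y = lin 4 (λ d p s b → d ⊕ p ≼ s ⇛ κ 1 ≼ b ⇛ ⊢ d ⊕ p ⊕ κ 1 ≼ s ⊕ b) refl
            (dg H u) (bit (P u)) (# R) (bit (nb R u)) (limit-R (inS p x) uz (offH p x) (g x)) (≤-reflexive (sym (bit-true y)))
      ... | no y = lin 6 (λ d t r p s b → d ≼ t ⊕ r ⇛ t ≼ κ 0 ⇛ r ≼ κ 0 ⇛ p ≼ κ 1 ⇛ κ 2 ≼ s ⇛ ⊢ d ⊕ p ⊕ κ 1 ≼ s ⊕ b) refl
            (dg H u) (dg T u) (dg R u) (bit (P u)) (# R) (bit (nb R u)) (dg-H u) (dg-nb (g x)) (dg-nb y) (bit≤1 (P u)) R≥2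

  -- An edge of the clique C can be inserted in the alternating paths, so that both parities occur.
  record Core₃ (E P : Sub n) (z : V) : Set where
    field
      T R C : Sub n
      T⊑E : T ⊑ E
      R⊑E : R ⊑ E
      T⊑P : T ⊑ P
      complete : Complete T R
      C⊑R : C ⊑ R
      clique : Clique C
      C≥2 : 2 ≤ # C
      T≥1 : 1 ≤ # T
      common : ∀ {u} → u ∈ E → u ≢ z → u ∈ P → (∀ {r} → r ∈ R → u ~ r) → u ∈ T
      P-ind : ∀ {u v} → u ∈ E → v ∈ E → u ∈ P → v ∈ P → u ∉ N v
      shape : R ⊑ C ⊎ # R ≤ # T
      maximal : ∀ {u} → u ∈ E → u ∉ R → dg T u ≤ # R
      C-max : ∀ {u} → u ∈ E → u ∉ C → u ∈ nb T → ∃[ c ] c ∈ C × c ∉ N u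

    H : Sub n
    H = T ∪ R

    H⊑E : H ⊑ E
    H⊑E m = [ T⊑E , R⊑E ]′ (∪⁻ m)

    t₀ : ∃[ t ] t ∈ T
    t₀ = #-pick T≥1

    c₀ : ∃[ c ] c ∈ C
    c₀ = #-pick (≤-trans (s≤s z≤n) C≥2)

    -- The smaller side limits alternation: paths from `T` to the clique have all sizes from 2 to
    -- |R| + μ.
    μ : ℕ
    μ = # T ⊓ # R

    μ≤T : μ ≤ # T
    μ≤T = m⊓n≤m (# T) (# R)

    μ≤R : μ ≤ # R
    μ≤R = m⊓n≤n (# T) (# R)

    R≥2 : 2 ≤ # R
    R≥2 = ≤-trans C≥2 (#-mono C⊑R)

    μ≥1 : 1 ≤ μ
    μ≥1 = ⊓-glb T≥1 (≤-trans (s≤s z≤n) R≥2)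

    nbT-P : ∀ {u} → u ∈ E → u ∈ nb T → u ∉ P
    nbT-P f m p = let (t , e , t∈) = nb∈ m in P-ind (T⊑E t∈) f (T⊑P t∈) p e

    dg-H : ∀ u → dg H u ≤ dg T u + dg R u
    dg-H u = dg-cover {H} {T} {R} λ _ → ∪⁻

    dg-T : ∀ {u} → u ∈ E → u ∉ H → dg T u ≤ μ
    dg-T {u} f h = ⊓-glb (dg≤# T u) (maximal f (h ∘ ∪ʳ {S = T}))

    dg-P : ∀ {u} → u ∈ E → u ≢ z → u ∉ T → u ∈ P → dg R u + 1 ≤ # R
    dg-P {u} f uz t∉ p with find (R ─ N u)
    ... | inj₂ (r , m) = ≤-trans (≤-reflexive (+-comm (dg R u) 1))
          (#-strict {S = N u ∩ R} (∩ʳ {S = N u}) (─ˡ m) (λ y → ─ʳ {S = R} m (∩ˡ y)))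
    ... | inj₁ g = ⊥-elim (t∉ (common f uz p λ {r} r∈ → near-r r∈ (r ∈? N u)))
      where
      near-r : ∀ {r} → r ∈ R → Dec (r ∈ N u) → u ~ r
      near-r _ (yes y) = y
      near-r r∈ (no y) = ⊥-elim (g _ (─⁺ r∈ y))

    dg-nbT : ∀ {u} → u ∈ E → u ∉ H → u ∈ nb T → dg R u + 1 ≤ # R
    dg-nbT {u} f h m = let (c , c∈ , g) = C-max f (h ∘ ∪ʳ {S = T} ∘ C⊑R) m in
      ≤-trans (≤-reflexive (+-comm (dg R u) 1)) (#-strict {S = N u ∩ R} (∩ʳ {S = N u}) (C⊑R c∈) (λ y → g (∩ˡ y)))

    dg-offC : ∀ {u} → u ∉ nb C → dg R u + 2 ≤ # R
    dg-offC {u} h = ≤-trans (+-monoʳ-≤ (dg R u) C≥2)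
      (#-disjoint {S = R} {N u ∩ R} {C} (∩ʳ {S = N u}) C⊑R (λ m c → h (∈nb (∩ˡ m) c)))

    -- For |R| + μ - 1 sizes, a vertex may have |R| + μ - 2 edges to `H` and `x`, and one more if it
    -- is next to `C`. At most μ of them go to `T`. In `R`, a neighbour of `T` misses a vertex of
    -- `C`, and a vertex not next to `C` misses at least two.
    limit-C : ∀ {u} → u ∈ E → u ≢ z → u ∉ H → dg H u + bit (P u) + 2 ≤ # R + μ + bit (nb C u)
    limit-C {u} f uz h with u ∈? nb C | u ∈? nb T | u ∈? P
    ... | yes c | yes t | _ = lin 7 (λ d x y p r m b → d ≼ x ⊕ y ⇛ x ≼ m ⇛ y ⊕ κ 1 ≼ r ⇛ p ≼ κ 0 ⇛ κ 1 ≼ b ⇛ ⊢ d ⊕ p ⊕ κ 2 ≼ r ⊕ m ⊕ b) refl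
          (dg H u) (dg T u) (dg R u) (bit (P u)) (# R) μ (bit (nb C u)) (dg-H u) (dg-T f h) (dg-nbT f h t)
          (≤-reflexive (bit-false (nbT-P f t))) (≤-reflexive (sym (bit-true c)))
    ... | yes c | no t | yes p = lin 7 (λ d x y p r m b → d ≼ x ⊕ y ⇛ x ≼ κ 0 ⇛ y ⊕ κ 1 ≼ r ⇛ p ≼ κ 1 ⇛ κ 1 ≼ b ⇛ κ 1 ≼ m ⇛ ⊢ d ⊕ p ⊕ κ 2 ≼ r ⊕ m ⊕ b) refl
          (dg H u) (dg T u) (dg R u) (bit (P u)) (# R) μ (bit (nb C u)) (dg-H u) (dg-nb t) (dg-P f uz (h ∘ ∪ˡ) p)
          (bit≤1 (P u)) (≤-reflexive (sym (bit-true c))) μ≥1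
    ... | yes c | no t | no p = lin 7 (λ d x y p r m b → d ≼ x ⊕ y ⇛ x ≼ κ 0 ⇛ y ≼ r ⇛ p ≼ κ 0 ⇛ κ 1 ≼ b ⇛ κ 1 ≼ m ⇛ ⊢ d ⊕ p ⊕ κ 2 ≼ r ⊕ m ⊕ b) refl
          (dg H u) (dg T u) (dg R u) (bit (P u)) (# R) μ (bit (nb C u)) (dg-H u) (dg-nb t) (dg≤# R u)
          (≤-reflexive (bit-false p)) (≤-reflexive (sym (bit-true c))) μ≥1
    ... | no c | yes t | _ = lin 7 (λ d x y p r m b → d ≼ x ⊕ y ⇛ x ≼ m ⇛ y ⊕ κ 2 ≼ r ⇛ p ≼ κ 0 ⇛ ⊢ d ⊕ p ⊕ κ 2 ≼ r ⊕ m ⊕ b) refl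
          (dg H u) (dg T u) (dg R u) (bit (P u)) (# R) μ (bit (nb C u)) (dg-H u) (dg-T f h) (dg-offC c)
          (≤-reflexive (bit-false (nbT-P f t)))
    ... | no c | no t | _ = lin 7 (λ d x y p r m b → d ≼ x ⊕ y ⇛ x ≼ κ 0 ⇛ y ⊕ κ 2 ≼ r ⇛ p ≼ κ 1 ⇛ κ 1 ≼ m ⇛ ⊢ d ⊕ p ⊕ κ 2 ≼ r ⊕ m ⊕ b) refl
          (dg H u) (dg T u) (dg R u) (bit (P u)) (# R) μ (bit (nb C u)) (dg-H u) (dg-nb t) (dg-offC c) (bit≤1 (P u)) μ≥1

    -- Paths ending in `T` are only used from size 3 on, one size fewer than for `C`; missing the
    -- whole clique makes up for this.
    limit-T : ∀ {u} → u ∈ E → u ∉ H → u ∉ nb C → 2 ≤ μ → dg H u + bit (P u) + 3 ≤ # R + μ + bit (nb T u)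
    limit-T {u} f h c μ≥2 with u ∈? nb T
    ... | yes t = lin 7 (λ d x y p r m b → d ≼ x ⊕ y ⇛ x ≼ m ⇛ y ⊕ κ 2 ≼ r ⇛ p ≼ κ 0 ⇛ κ 1 ≼ b ⇛ ⊢ d ⊕ p ⊕ κ 3 ≼ r ⊕ m ⊕ b) refl
          (dg H u) (dg T u) (dg R u) (bit (P u)) (# R) μ (bit (nb T u)) (dg-H u) (dg-T f h) (dg-offC c)
          (≤-reflexive (bit-false (nbT-P f t))) (≤-reflexive (sym (bit-true t)))
    ... | no t = lin 7 (λ d x y p r m b → d ≼ x ⊕ y ⇛ x ≼ κ 0 ⇛ y ⊕ κ 2 ≼ r ⇛ p ≼ κ 1 ⇛ κ 2 ≼ m ⇛ ⊢ d ⊕ p ⊕ κ 3 ≼ r ⊕ m ⊕ b) refl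
          (dg H u) (dg T u) (dg R u) (bit (P u)) (# R) μ (bit (nb T u)) (dg-H u) (dg-nb t) (dg-offC c) (bit≤1 (P u)) μ≥2

    limit-R : ∀ {u} → u ∉ nb C → u ∉ nb T → dg H u + bit (P u) + 1 ≤ # R
    limit-R {u} c t = lin 5 (λ d x y p r → d ≼ x ⊕ y ⇛ x ≼ κ 0 ⇛ y ⊕ κ 2 ≼ r ⇛ p ≼ κ 1 ⇛ ⊢ d ⊕ p ⊕ κ 1 ≼ r) refl
          (dg H u) (dg T u) (dg R u) (bit (P u)) (# R) (dg-H u) (dg-nb t) (dg-offC c) (bit≤1 (P u))

    walk-C : ∀ {s} → s ∈ C → ∀ c → 2 ≤ c → c ≤ # R + μ → ∃[ t ] t ∈ P × Walk H t s c
    walk-C s∈ c l h = let (t , t∈ , p) = reach-clique c complete C⊑R clique C≥2 small s∈ T≥1 l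
                            (≤-trans h (+-monoʳ-≤ (# R) μ≤T)) (≤-trans h (+-monoʳ-≤ (# R) μ≤R)) in t , T⊑P t∈ , p
      where
      small : R ⊑ C ⊎ c ≤ # T + # T + 1
      small = [ inj₁ , (λ r → inj₂ (≤-trans h (≤-trans (+-mono-≤ r μ≤T) (m≤m+n _ 1)))) ]′ shape

    -- Paths ending in T arrive from the clique, without using their last vertex before.
    walk-T : ∀ {t} → t ∈ T → 2 ≤ # T → ∀ c → 3 ≤ c → c ≤ # R + # T → c ≤ suc (# R + # R) → ∃[ s ] s ∈ P × Walk H s t c
    walk-T {t} t∈ T≥2 (suc c) (s≤s l) h₁ (s≤s h₂) with
      reach-clique {T ∖ t} c (λ a b → complete (∖ˡ a) b) C⊑R clique C≥2 small (proj₂ c₀) (remove T≥2) l room h₂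
      where
      room : c ≤ # R + # (T ∖ t)
      room = lin 4 (λ c r t t′ → κ 1 ⊕ c ≼ r ⊕ t ⇛ t ≼ t′ ⊕ κ 1 ⇛ ⊢ c ≼ r ⊕ t′) refl c (# R) (# T) (# (T ∖ t)) h₁ (#-∖ T t)
      small : R ⊑ C ⊎ c ≤ # (T ∖ t) + # (T ∖ t) + 1
      small = [ inj₁ , (λ r → inj₂ (lin 4 (λ c r t t′ → κ 1 ⊕ c ≼ r ⊕ t ⇛ r ≼ t ⇛ t ≼ t′ ⊕ κ 1 ⇛ t ≼ t′ ⊕ κ 1 ⇛ ⊢ c ≼ t′ ⊕ t′ ⊕ κ 1) refl
                                          c (# R) (# T) (# (T ∖ t)) h₁ r (#-∖ T t) (#-∖ T t))) ]′ shape
    ... | s , s∈ , p = s , T⊑P (∖ˡ s∈) , append p (λ m → [ ∪ˡ ∘ ∖ˡ , ∪ʳ {S = T} ]′ (∪⁻ m)) (∪ˡ t∈)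
                         (λ m → [ ∉∖ , (λ r → ~-irr (complete t∈ r)) ]′ (∪⁻ m)) (~-sym (complete t∈ (C⊑R (proj₂ c₀))))

    walk-R : ∀ {r} → r ∈ R → ∀ j → j < μ → ∃[ s ] s ∈ P × Walk H s r (2 + j * 2)
    walk-R r∈ j h = let (s , s∈ , p) = zigzag-R j complete r∈ (≤-trans h μ≤T) (≤-trans h μ≤R) in s , T⊑P s∈ , p

    reach-C : ∀ {u} → u ∈ nb C → ∀ c → 2 ≤ c → c ≤ # R + μ → Pre P H c u
    reach-C m c l h = let (s , e , s∈) = nb∈ m ; (t , t∈ , p) = walk-C s∈ c l h in inj₂ (t , s , t∈ , p , ~-sym e)

    reach-T : ∀ {u} → u ∈ nb T → 2 ≤ # T → ∀ c → 3 ≤ c → c ≤ # R + μ → Pre P H c u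
    reach-T m T≥2 c l h = let (t , e , t∈) = nb∈ m
                              (s , s∈ , p) = walk-T t∈ T≥2 c l (≤-trans h (+-monoʳ-≤ (# R) μ≤T))
                                               (≤-trans h (≤-trans (+-monoʳ-≤ (# R) μ≤R) (n≤1+n _)))
                          in inj₂ (s , t , s∈ , p , ~-sym e)

    reach-R : ∀ {u} → u ∈ nb R → ∀ j → j < μ → Pre P H (2 + j * 2) u
    reach-R m j h = let (r , e , r∈) = nb∈ m ; (s , s∈ , p) = walk-R r∈ j h in inj₂ (s , r , s∈ , p , ~-sym e)

    R≤T : ∀ {r} → r ∈ R → r ∉ C → # R ≤ # T
    R≤T r∈ r∉ = [ (λ i → ⊥-elim (r∉ (i r∈))) , id ]′ shape

    off-H : ∀ {K} → Misses K (nb T) → Misses K (nb R) → Misses K (nb H)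
    off-H g g′ x m with nb∈ m
    ... | w , e , w∈ with ∪⁻ {S = T} w∈
    ... | inj₁ t = g x (∈nb e t)
    ... | inj₂ r = g′ x (∈nb e r)

  module Sources₃ (I : Problem) {E : Sub n} (D : Core₃ E (Problem.P I) (Problem.z I)) (O : Sub n) (E⊑F : E ⊑ Problem.F I) where

    open Problem I
    open Core₃ D

    open Launch I H O E E⊑F

    H⊑F : H ⊑ F
    H⊑F m = E⊑F (H⊑E m)

    source-C : ∀ {K B} (p : Piece K B) → Meets K (nb C) → Source K (L p)
    source-C p m = layer p H⊑F m {2} {1} {ρ} (inj₁ refl) ρ≥1
      (λ a i l → reach-C a (2 + i * 1) (s≤s (s≤s z≤n))
        (subst (λ t → 2 + t ≤ # R + μ) (sym (*-identityʳ i)) (≤-trans (≤-reflexive (+-comm 1 (suc i))) (≤-trans (+-monoˡ-≤ 1 l) (≤-reflexive ρ+1)))))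
      (λ {u} x uz → lin 6 (λ d p s m b r → d ⊕ p ⊕ κ 2 ≼ s ⊕ m ⊕ b ⇛ s ⊕ m ≼ r ⊕ κ 1 ⇛ ⊢ d ⊕ p ⊕ κ 1 ≼ r ⊕ b) refl
        (dg H u) (bit (P u)) (# R) μ (bit (nb C u)) ρ (limit-C (inS p x) uz (offH p x)) (≤-reflexive (sym ρ+1)))
      where
      ρ = # R + μ ∸ 1
      ρ+1 : ρ + 1 ≡ # R + μ
      ρ+1 = m∸n+n≡m (≤-trans μ≥1 (m≤n+m μ (# R)))
      ρ≥1 : 1 ≤ ρ
      ρ≥1 = +-cancelʳ-≤ 1 1 ρ (≤-trans R≥2 (≤-trans (m≤m+n (# R) μ) (≤-reflexive (sym ρ+1))))

    source-T : ∀ {K B} (p : Piece K B) → Misses K (nb C) → Meets K (nb T) → 2 ≤ # T → Source K (L p)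
    source-T p g m T≥2 = layer p H⊑F m {3} {1} {ρ} (inj₁ refl) ρ≥1
      (λ a i l → reach-T a T≥2 (3 + i * 1) (s≤s (s≤s (s≤s z≤n)))
        (subst (λ t → 3 + t ≤ # R + μ) (sym (*-identityʳ i)) (≤-trans (≤-reflexive (+-comm 2 (suc i))) (≤-trans (+-monoˡ-≤ 2 l) (≤-reflexive ρ+2)))))
      (λ {u} x uz → lin 6 (λ d p s m b r → d ⊕ p ⊕ κ 3 ≼ s ⊕ m ⊕ b ⇛ s ⊕ m ≼ r ⊕ κ 2 ⇛ ⊢ d ⊕ p ⊕ κ 1 ≼ r ⊕ b) refl
        (dg H u) (bit (P u)) (# R) μ (bit (nb T u)) ρ (limit-T (inS p x) (offH p x) (g x) μ≥2) (≤-reflexive (sym ρ+2)))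
      where
      μ≥2 : 2 ≤ μ
      μ≥2 = ⊓-glb T≥2 R≥2
      ρ = # R + μ ∸ 2
      ρ+2 : ρ + 2 ≡ # R + μ
      ρ+2 = m∸n+n≡m (≤-trans μ≥2 (m≤n+m μ (# R)))
      ρ≥1 : 1 ≤ ρ
      ρ≥1 = +-cancelʳ-≤ 2 1 ρ (≤-trans (lin 2 (λ s m → κ 2 ≼ s ⇛ κ 1 ≼ m ⇛ ⊢ κ 3 ≼ s ⊕ m) refl (# R) μ R≥2 μ≥1) (≤-reflexive (sym ρ+2)))

    -- A vertex of `R` next to `K` is outside `C`, so `shape` gives |R| ≤ |T|, and plain alternation
    -- has |R| sizes of difference 2.
    source-R : ∀ {K B} (p : Piece K B) → Misses K (nb C) → Misses K (nb T) → Meets K (nb R) → Source K (L p)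
    source-R p g g′ m = layer p H⊑F m {2} {2} (inj₂ refl) (≤-trans (s≤s z≤n) R≥2)
      (λ a i l → reach-R a i (≤-trans l (⊓-glb small ≤-refl)))
      (λ {u} x _ → ≤-trans (limit-R (g x) (g′ x)) (m≤m+n (# R) (bit (nb R u))))
      where
      small : # R ≤ # T
      small = let (v , v∈ , a) = m ; (r , e , r∈) = nb∈ a in R≤T r∈ (λ c → g v∈ (∈nb e c))

  -- A core with `E = F`. The weaker `Core₂` is kept apart because it occurs again inside `F ∖ q`,
  -- where `common` is known only for vertices other than `z`.
  record Sparse (I : Problem) : Set where
    open Problem I
    field
      T R : Sub n
      T⊑F : T ⊑ F
      R⊑F : R ⊑ F
      T⊑P : T ⊑ P
      complete : Complete T R
      common : ∀ {u} → u ∈ F → u ∈ P → (∀ {r} → r ∈ R → u ~ r) → u ∈ T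
      P-ind : ∀ {u v} → u ∈ F → v ∈ F → u ∈ P → v ∈ P → u ∉ N v
      Q-ind : ∀ {u v} → u ∈ F → v ∈ F → u ∈ Q → v ∈ Q → u ∉ N v
      no-tri : ∀ {t u w} → t ∈ F → u ∈ F → w ∈ F → t ∈ P → t ~ u → t ~ w → u ∉ N w
      R<T : suc (# R) ≤ # T
      maximal : ∀ {u} → u ∈ F → u ∉ R → dg T u ≤ # R + 1

    nbT-R : ∀ {u r} → u ∈ F → u ∈ nb T → r ∈ R → u ∉ N r
    nbT-R f m r∈ = let (t , e , t∈) = nb∈ m in no-tri (T⊑F t∈) f (R⊑F r∈) (T⊑P t∈) (~-sym e) (complete t∈ r∈)

    core : Core₂ F P z
    core = record { T = T ; R = R ; T⊑E = T⊑F ; R⊑E = R⊑F ; T⊑P = T⊑P ; complete = complete ; common = λ f _ → common f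
                  ; P-ind = P-ind ; nbT-R = nbT-R ; R<T = R<T ; maximal = maximal }

  record Dense (I : Problem) : Set where
    open Problem I
    field
      T R C : Sub n
      T⊑F : T ⊑ F
      R⊑F : R ⊑ F
      T⊑P : T ⊑ P
      complete : Complete T R
      C⊑R : C ⊑ R
      clique : Clique C
      C≥2 : 2 ≤ # C
      T≥1 : 1 ≤ # T
      common : ∀ {u} → u ∈ F → u ∈ P → (∀ {r} → r ∈ R → u ~ r) → u ∈ T
      P-ind : ∀ {u v} → u ∈ F → v ∈ F → u ∈ P → v ∈ P → u ∉ N v
      Q-ind : ∀ {u v} → u ∈ F → v ∈ F → u ∈ Q → v ∈ Q → u ∉ N v
      shape : R ⊑ C ⊎ # R ≤ # T
      maximal : ∀ {u} → u ∈ F → u ∉ R → dg T u ≤ # R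
      C-max : ∀ {u} → u ∈ F → u ∉ C → u ∈ nb T → ∃[ c ] c ∈ C × c ∉ N u

    core : Core₃ F P z
    core = record { T = T ; R = R ; C = C ; T⊑E = T⊑F ; R⊑E = R⊑F ; T⊑P = T⊑P ; complete = complete ; C⊑R = C⊑R ; clique = clique
                  ; C≥2 = C≥2 ; T≥1 = T≥1 ; common = λ f _ → common f ; P-ind = P-ind ; shape = shape ; maximal = maximal ; C-max = C-max }

-- Independent neighbours of `x`, none of them in a triangle of `F`.

module SparseCase {n : ℕ} (G : Graph n) where

  open Walks G
  open Rooted G
  open Start G
  open Families G
  open Analysis G
  open Cores G

  module Around (I : Problem) (Δ : Sparse I) where

    open Problem I
    open Sparse Δ
    open Side I
    open Core₂ core hiding (T; R; T⊑E; R⊑E; T⊑P; complete; common; P-ind; nbT-R; R<T; maximal)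
    open With H H⊑E (proj₁ t₀ , ∪ˡ (proj₂ t₀))

    open Sources₂ I core O id

    -- When R = {h}, pieces without neighbours in T see only h.
    module Single (h : V) (h∈R : h ∈ R) (h! : ∀ {r} → r ∈ R → r ≡ h) where

      open Hub {h} (∪ʳ {S = T} h∈R)

      only-h : ∀ {K} → Misses K (nb T) → Only K
      only-h g x w e with ∪⁻ {S = T} w
      ... | inj₁ t = ⊥-elim (g x (∈nb e t))
      ... | inj₂ r = h! r

      nbR⇒N : ∀ {u} → u ∈ nb R → u ∈ N h
      nbR⇒N {u} m = let (r , e , r∈) = nb∈ m in ~-sym (subst (u ~_) (h! r∈) e)

      apart : ∀ {u} → u ∈ F → u ∉ H → u ∈ P → u ∉ N h
      apart {u} f g p m = g (∪ˡ (common f p λ {r} r∈ → ~-sym (subst (_~ u) (sym (h! r∈)) m)))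

    provider : Provider
    provider {K} p z∉ (v , m) rec with meets? K (nb T) | meets? K (nb R)
    ... | inj₁ g | _ = inj₁ (source-T p g)
    ... | inj₂ g | inj₂ g′ = inj₁ (x-source (L p) (attached p m (off-H g g′)) (off-H g g′))
    ... | inj₂ g | inj₁ g′ with 2 ≤? # R
    ... | yes R≥2 = inj₁ (source-R p g g′ R≥2)
    ... | no R<2 = hub-free p z∉ (v , m) (only-h g) (λ x → apart (inF p x) (offH p x))
          (t , T⊑F t∈ , (λ x → offH p x (∪ˡ t∈)) , λ eq → ~-irr (subst (_~ h) eq (complete t∈ h∈)))
          (2 , λ e → reach-R (∈nb (~-sym e) h∈) 0 (#-member h∈)) rec
      where
      hr = nb∈ (proj₂ (proj₂ g′))
      h = proj₁ hr
      h∈ : h ∈ R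
      h∈ = proj₂ (proj₂ hr)
      h! : ∀ {r} → r ∈ R → r ≡ h
      h! {r} r∈ with r Fin.≟ h
      ... | yes eq = eq
      ... | no ne  = ⊥-elim (R<2 (≤-trans (s≤s (#-member (∖⁺ r∈ ne))) (≤-trans (≤-reflexive (+-comm 1 _)) (#-∖< h∈))))
      open Single h h∈ h!
      open Hub {h} (∪ʳ {S = T} h∈)
      t = proj₁ t₀
      t∈ = proj₂ t₀

    solved : Solved
    solved = zfree provider

    odd-paths : ∀ {q} → q ∈ T → q ∈ Q → ∀ j → j ≤ # R → AB F P Q (1 + j * 2)
    odd-paths q∈ b j h = let (s , s∈ , p) = zigzag-T j complete q∈ (≤-trans (s≤s h) R<T) h in s , _ , T⊑P s∈ , b , walk-mono H⊑F p

    even-paths : ∀ {q} → q ∈ R → q ∈ Q → ∀ j → j < # R → AB F P Q (2 + j * 2)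
    even-paths q∈ b j h = let (s , s∈ , p) = zigzag-R j complete q∈ (≤-trans h (≤-trans (n≤1+n _) R<T)) h in
      s , _ , T⊑P s∈ , b , walk-mono H⊑F p

    step2 : ∀ {m} a → (∀ j → j < m → AB F P Q (a + j * 2)) → k ≤ m → Adm k F P Q
    step2 a f h = a , 2 , inj₂ refl , λ i l → f i (≤-trans l h)

    kinds : (∀ {q} → q ∈ F → q ∈ Q → q ≢ z → q ∈ H) → TKind T ⊎ RKind H T R
    kinds h with one-side T⊑F R⊑F complete Q-ind h
    ... | inj₁ t = inj₁ t
    ... | inj₂ toR = inj₂ record
      { e = z ; toR = toR ; small = ≤-trans (s≤s (#-mono λ m → toR (∩ˡ (∖ˡ m)) (∩ʳ {S = F} (∖ˡ m)) (∖ʳ m))) R<T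
      ; tiny = λ h → ⊥-elim (h refl) }

    module Conclude (R₀ : Region S Q ∅) (twoQ : ∀ e → ∃[ q ] q ∈ F × q ∈ Q × q ≢ z × q ≢ e) where

      open AtRegion R₀

      Result : Set
      Result = Adm k F P Q ⊎ TKind T ⊎ RKind H T R

      settle : (∀ {q} → q ∈ F → q ∈ Q → q ≢ z → q ∈ H) → Result
      settle h = inj₂ (kinds h)

      -- A second length from x to h comes from the part of F that z's component K leaves untouched.
      second-length : ∀ {h} (h∈ : h ∈ R) (h! : ∀ {r} → r ∈ R → r ≡ h) →
        (∀ {t} → t ∈ T → t ∈ N h → 3 + (dg K t + bit (Q t)) ≤ k + 1) → (∀ {q} → q ∈ F → q ∈ Q → q ∉ K → q ∈ H) →
        Adm 2 (F ─ K ─ ｛ h ｝) P (N h)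
      second-length {h} h∈ h! room exits =
        hub-adm (∪ʳ {S = T} h∈) whole-set touch onP deg3 (proj₁ t₀ , T⊑D (proj₂ t₀))
        where
        D = F ─ K ─ ｛ h ｝
        D∩H : ∀ {u} → u ∈ D → u ∈ H → u ∈ T
        D∩H m y with ∪⁻ {S = T} y
        ... | inj₁ t = t
        ... | inj₂ r = ⊥-elim (─ʳ {S = F ─ K} m (subst (_∈ ｛ h ｝) (sym (h! r)) ∈｛｝))
        T⊑D : T ⊑ D
        T⊑D t = ─⁺ (─⁺ (T⊑F t) (λ m → K-off m (∪ˡ t))) (λ s → ~-irr (complete t (subst (_∈ R) (sym (｛｝∈ s)) h∈)))
        N-h : ∀ {t} → t ∈ T → t ∈ N h
        N-h t = ~-sym (complete t h∈)
        touchT : ∀ {u} → u ∈ D → u ∈ Q ⊎ (∃[ w ] w ∈ K × u ~ w) → u ∈ T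
        touchT m (inj₁ q) = D∩H m (exits (─ˡ (─ˡ m)) q (─ʳ {S = F} (─ˡ m)))
        touchT {u} m (inj₂ (w , w∈ , e)) with u ∈? H
        ... | yes y = D∩H m y
        ... | no y  = ⊥-elim (─ʳ {S = F} (─ˡ m) (cl shut w∈ (∈S (─ˡ (─ˡ m)) y) (~-sym e)))
        touch : ∀ {u} → u ∈ D → u ∈ Q ⊎ (∃[ w ] w ∈ K × u ~ w) → u ∈ N h
        touch m x = N-h (touchT m x)
        onP : ∀ {C u} → Closed D C → u ∈ C → Meets C P
        onP {C} c m with meets? C P
        ... | inj₁ r = r
        ... | inj₂ g with rgX rg h (record { sub = λ x → ∖⁺ (─ˡ (─ˡ (sub c x))) (λ { refl → ─ʳ {S = F ─ K} (sub c x) ∈｛｝ }) ; cl = go }) m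
          where
          go : ∀ {u v} → u ∈ C → v ∈ F ∖ h → u ~ v → v ∈ C
          go {v = v} x f e with v ∈? K
          ... | yes v∈ = ⊥-elim (g x (T⊑P (touchT (sub c x) (inj₂ (v , v∈ , e)))))
          ... | no v∉  = cl c x (─⁺ (─⁺ (∖ˡ f) v∉) (λ s → ∖ʳ f (｛｝∈ s))) e
        ... | v , a , b = ⊥-elim ([ g a , (λ q → g a (T⊑P (touchT (sub c a) (inj₁ q)))) ]′ (∪⁻ {S = P} b))
        deg3 : ∀ {u} → u ∈ D → 3 ≤ dg D u + bit (P u) + bit (N h u)
        deg3 {u} m with u ∈? T
        ... | yes t = lin 9 (λ k f p q c s d i j → κ 3 ⊕ (c ⊕ q) ≼ k ⊕ κ 1 ⇛ k ⊕ κ 1 ≼ f ⊕ p ⊕ q ⇛ f ≼ d ⊕ s ⇛ s ≼ c ⊕ i ⇛ i ≼ j ⇛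
                               ⊢ κ 3 ≼ d ⊕ p ⊕ j) refl
              k (dg F u) (bit (P u)) (bit (Q u)) (dg K u) (dg (K ∪ ｛ h ｝) u) (dg D u) (dg ｛ h ｝ u) (bit (N h u))
              (room t (N-h t)) (degF (T⊑F t) (λ { refl → ─ʳ {S = F} (─ˡ m) z∈K }))
              (dg-cover {F} {D} {K ∪ ｛ h ｝} λ {w} _ f → side w f)
              (dg-cover {K ∪ ｛ h ｝} {K} {｛ h ｝} λ _ → ∪⁻) (dg-one {｛ h ｝} h λ _ → ｛｝∈)
          where
          side : ∀ w → w ∈ F → w ∈ D ⊎ w ∈ K ∪ ｛ h ｝
          side w f with w ∈? (K ∪ ｛ h ｝)
          ... | yes y = inj₂ y
          ... | no y  = inj₁ (─⁺ (─⁺ f (y ∘ ∪ˡ)) (y ∘ ∪ʳ {S = K}))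
        ... | no t∉ = lin 7 (λ k f p q d i j → κ 2 ≼ k ⇛ k ⊕ κ 1 ≼ f ⊕ p ⊕ q ⇛ q ≼ κ 0 ⇛ f ≼ d ⊕ i ⇛ i ≼ j ⇛ ⊢ κ 3 ≼ d ⊕ p ⊕ j) refl
              k (dg F u) (bit (P u)) (bit (Q u)) (dg D u) (dg ｛ h ｝ u) (bit (N h u)) k≥2
              (degF (─ˡ (─ˡ m)) (λ { refl → ─ʳ {S = F} (─ˡ m) z∈K })) (≤-reflexive (bit-false λ q → t∉ (touchT m (inj₁ q))))
              (dg-cover {F} {D} {｛ h ｝} λ {w} e f → side w e f) (dg-one {｛ h ｝} h λ _ → ｛｝∈)
          where
          side : ∀ w → u ~ w → w ∈ F → w ∈ D ⊎ w ∈ ｛ h ｝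
          side w e f with w ∈? ｛ h ｝ | w ∈? K
          ... | yes y | _     = inj₂ y
          ... | no _  | yes y = ⊥-elim (t∉ (touchT m (inj₂ (w , y , e))))
          ... | no a  | no b  = inj₁ (─⁺ (─⁺ f b) a)

      -- By `uses`, a piece stuck at one vertex has no other vertex next to `R`; what lies behind is
      -- then entered from `x` alone.
      record Next {K′ B} (p : Piece K′ B) : Set where
        field
          src  : Source K′ (L p)
          uses : ∀ {u} → u ∈ K′ → u ∉ Source.A src → u ∉ nb R

      next : ∀ {K′ B u} (p : Piece K′ B) → u ∈ K′ → K′ ⊑ K → L p ⊑ K → Misses K′ (nb T) →
             (∀ {t} → 1 ≤ # R → t ∈ T → 3 + (dg K t + bit (Q t)) ≤ k + 1) → Next p
      next {K′} p m i l g room with meets? K′ (nb R)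
      ... | inj₂ g′ = record { src = x-source (L p) (attached p m (off-H g g′)) (off-H g g′) ; uses = λ x _ → g′ x }
      ... | inj₁ g′ with 2 ≤? # R
      ... | yes R≥2 = record { src = source-R p g g′ R≥2 ; uses = λ _ h → h }
      ... | no R<2 = record
        { src = hub-source p (F ─ K ─ ｛ h ｝) (only-h g) (let (v , a , b) = g′ in v , a , nbR⇒N b) (─ˡ ∘ ─ˡ)
                  (λ d x → ─ʳ {S = F} (─ˡ d) (i x)) (λ d x → ─ʳ {S = F} (─ˡ d) (l x)) (λ d → ─ʳ {S = F ─ K} d ∈｛｝)
                  (second-length h∈ h! (λ t _ → room (#-member h∈) t) exits)
        ; uses = λ _ n b → n (nbR⇒N b) }
        where
        hr = nb∈ (proj₂ (proj₂ g′))
        h = proj₁ hr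
        h∈ : h ∈ R
        h∈ = proj₂ (proj₂ hr)
        h! : ∀ {r} → r ∈ R → r ≡ h
        h! {r} r∈ with r Fin.≟ h
        ... | yes eq = eq
        ... | no ne  = ⊥-elim (R<2 (≤-trans (s≤s (#-member (∖⁺ r∈ ne))) (≤-trans (≤-reflexive (+-comm 1 _)) (#-∖< h∈))))
        open Single h h∈ h!
        open Hub {h} (∪ʳ {S = T} h∈)

      module _ {A} (t : Stuck K A Q) where

        ε : V
        ε = e t

        through-T : ε ∈ nb T → ∀ j → j ≤ # R → AB F P Q (2 + j * 2)
        through-T m j h = AB-via (reach-T m j h) (K⊑F (e∈K t)) (K-off (e∈K t)) (e∈B t)

        through-R : ε ∈ nb R → ∀ j → j < # R → AB F P Q (3 + j * 2)
        through-R m j h = AB-via (reach-R m j h) (K⊑F (e∈K t)) (K-off (e∈K t)) (e∈B t)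

      alternate : ∀ a m → (∀ j → j < m → AB F P Q (a + j * 2)) → (∀ j → j < m → AB F P Q (suc a + j * 2)) → k ≤ m + m → Adm k F P Q
      alternate a m f g h = a , 1 , inj₁ refl , λ i l → pick i l (half i)
        where
        pick : ∀ i → i < k → ∃[ j ] (i ≡ j * 2 ⊎ i ≡ suc (j * 2)) → AB F P Q (a + i * 1)
        pick i l (j , inj₁ eq) = subst (AB F P Q) (cong (a +_) (trans (sym eq) (sym (*-identityʳ i)))) (f j (below-m (≤-trans (≤-trans (s≤s (≤-trans (≤-reflexive (sym (double j))) (≤-reflexive (sym eq)))) l) h)))
          where
          below-m : suc (j + j) ≤ m + m → j < m
          below-m x = halve (≤-trans (≤-reflexive (+-suc (suc j) j)) (≤-trans (s≤s x) (≤-reflexive (+-comm 1 (m + m)))))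
        pick i l (j , inj₂ eq) = subst (AB F P Q) (trans (sym (+-suc a (j * 2))) (cong (a +_) (trans (sym eq) (sym (*-identityʳ i))))) (g j (halve (≤-trans x (m≤m+n _ 1))))
          where
          x : suc j + suc j ≤ m + m
          x = ≤-trans (≤-reflexive (trans (+-suc (suc j) j) (cong (2 +_) (sym (double j))))) (≤-trans (≤-trans (≤-reflexive (cong suc (sym eq))) l) h)

      -- The paths through `T` and a stuck vertex `e ≠ z` have |R| + 1 sizes of difference 2. For
      -- larger `k` the piece behind `e` is tried, and it can only be stuck at `z`: a third failure
      -- would bound `k` by |R| + 1.
      at-T : Meets K (nb T) → Result
      at-T m with peel solved piece (source-T piece m) z∈K
      ... | inj₁ r = inj₁ r
      ... | inj₂ t with e t Fin.≟ z
      ... | yes eq = settle (stuck-plain t eq)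
      ... | no ne with k ≤? suc (# R)
      ... | yes k≤ = inj₁ (step2 2 (λ j h → through-T t (e∈A t) j (≤-pred h)) k≤)
      ... | no k≰ = after (follow solved piece t z∈K ne (Next.src nx))
        where
        rest : Piece (K ∖ e t) (N (e t))
        rest = tail piece t z∈K ne
        missT : Misses (K ∖ e t) (nb T)
        missT x a = ∖ʳ x (only-A t (∖ˡ x) a)
        -- A vertex of T sees at most one of y and e, which are adjacent.
        at-most : ∀ {t′} → t′ ∈ T → dg K t′ + bit (Q t′) ≤ 1
        at-most {t′} t′∈ with t′ ∈? N (e t) | t′ ∈? Q
        ... | yes y | yes q = ⊥-elim (Q-ind (T⊑F t′∈) (K⊑F (e∈K t)) q (e∈B t) y)
        ... | no y | _ = lin 3 (λ d q z → d ≼ κ 0 ⇛ q ≼ κ 1 ⇛ ⊢ d ⊕ q ≼ κ 1) refl (dg K t′) (bit (Q t′)) 0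
              (dg-zero λ {w} a w∈ → y (~-sym (subst (t′ ~_) (only-A t w∈ (∈nb (~-sym a) t′∈)) a))) (bit≤1 (Q t′))
        ... | yes y | no q = lin 3 (λ d q z → d ≼ κ 1 ⇛ q ≼ κ 0 ⇛ ⊢ d ⊕ q ≼ κ 1) refl (dg K t′) (bit (Q t′)) 0
              (#-single {S = N t′ ∩ K} (e t) λ x → only-A t (∩ʳ {S = N t′} x) (∈nb (~-sym (∩ˡ x)) t′∈)) (≤-reflexive (bit-false q))
        nx : Next rest
        nx = next rest (∖⁺ z∈K (ne ∘ sym)) ∖ˡ (tail-off t ne) missT λ {t′} r≥1 t′∈ →
          lin 4 (λ k r d q → κ 2 ⊕ r ≼ k ⇛ d ⊕ q ≼ κ 1 ⇛ κ 1 ≼ r ⇛ ⊢ κ 3 ⊕ (d ⊕ q) ≼ k ⊕ κ 1) refl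
            k (# R) (dg K t′) (bit (Q t′)) (≰⇒> k≰) (at-most t′∈) r≥1
        after : Adm k F P Q ⊎ (Stuck (K ∖ e t) (Source.A (Next.src nx)) (N (e t)) × k ≤ dg H (e t) + bit (P (e t)) + 1) → Result
        after (inj₁ r) = inj₁ r
        after (inj₂ (t′ , kb)) with e t′ Fin.≟ z
        ... | no ne′ = [ inj₁ , (λ (_ , kb′) → ⊥-elim (k≰ (≤-trans kb′ (≤-trans (+-monoˡ-≤ 1 (limit-R (K⊑F (∖ˡ (e∈K t′))) ne′ (K-off (∖ˡ (e∈K t′))) (missT (e∈K t′)))) (≤-reflexive (+-comm (# R) 1)))))) ]′
              (follow solved rest t′ z∈J ne′ (x-source (L last) (attached last (∖⁺ z∈J (ne′ ∘ sym)) missH) missH))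
          where
          z∈J = ∖⁺ {S = K} z∈K (ne ∘ sym)
          last : Piece (K ∖ e t ∖ e t′) (N (e t′))
          last = tail rest t′ z∈J ne′
          missH : Misses (K ∖ e t ∖ e t′) (nb H)
          missH = off-H (missT ∘ ∖ˡ) λ x → Next.uses nx (∖ˡ x) (λ a → ∖ʳ x (only-A t′ (∖ˡ x) a))
        ... | yes eq with find (F ∩ Q ∩ T)
        -- Odd sizes end in `q`, even ones in `e`: 2|R| + 2 consecutive sizes, while `limit-T`
        -- bounds `k` by |R| + 2.
        ... | inj₂ (q , q∈) = inj₁ (alternate 1 (suc (# R)) (λ j h → odd-paths (∩ʳ {S = F ∩ Q} q∈) (∩ʳ {S = F} (∩ˡ q∈)) j (≤-pred h))
              (λ j h → through-T t (e∈A t) j (≤-pred h))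
              (lin 5 (λ k d p s b → k ≼ d ⊕ p ⊕ κ 1 ⇛ d ⊕ p ⊕ κ 1 ≼ κ 1 ⊕ s ⊕ b ⇛ b ≼ κ 1 ⇛ ⊢ k ≼ κ 1 ⊕ s ⊕ (κ 1 ⊕ s)) refl
                 k (dg H (e t)) (bit (P (e t))) (# R) (bit (nb T (e t))) kb (limit-T (K⊑F (e∈K t)) ne (K-off (e∈K t))) (bit≤1 (nb T (e t)))))
        -- The origin of the second form of `RKind`: `z` hangs on `e`, outside the core and not next
        -- to `T`.
        ... | inj₁ none = inj₂ (inj₂ record
              { e = e t ; toR = toR ; small = ≤-trans (s≤s (#-mono λ m → toR (∩ˡ (∖ˡ m)) (∩ʳ {S = F} (∖ˡ m)) (∖ʳ m))) R<T
              ; tiny = λ _ → subst (e t ~_) eq (e∈B t′) , K-off z∈K , λ a → ne (sym (only-A t z∈K a)) })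
          where
          toR : ∀ {q} → q ∈ F → q ∈ Q → q ≢ e t → q ∈ R
          toR {q} f b n = [ (λ q∈ → ⊥-elim (none q (∩⁺ (∩⁺ f b) q∈))) , id ]′ (∪⁻ (in-core t f b n))

      at-R : Misses K (nb T) → Meets K (nb R) → Result
      at-R g m = cases (k ≤? suc (# R)) (find (F ∩ Q ∩ T))
        where
        R≥1 : 1 ≤ # R
        R≥1 = let (v , _ , a) = m ; (r , _ , r∈) = nb∈ a in #-member r∈
        -- A neighbour of `y` in `T` yields |R| + 1 odd sizes at once, so larger `k` may be assumed
        -- if there is one. This pays for the degree which its edge to `y` costs in `second-length`.
        large : (∀ {q} → q ∈ F → q ∈ Q → q ∈ T → suc (# R) < k) → Result
        large guard = go (peel solved piece (Next.src nx) z∈K)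
          where
          room : ∀ {t′} → 1 ≤ # R → t′ ∈ T → 3 + (dg K t′ + bit (Q t′)) ≤ k + 1
          room {t′} _ t′∈ with t′ ∈? Q
          ... | no q = lin 3 (λ k d q → κ 2 ≼ k ⇛ d ≼ κ 0 ⇛ q ≼ κ 0 ⇛ ⊢ κ 3 ⊕ (d ⊕ q) ≼ k ⊕ κ 1) refl
                k (dg K t′) (bit (Q t′)) k≥2 (dg-zero λ a w∈ → g w∈ (∈nb (~-sym a) t′∈)) (≤-reflexive (bit-false q))
          ... | yes q = lin 4 (λ k d q r → κ 2 ⊕ r ≼ k ⇛ κ 1 ≼ r ⇛ d ≼ κ 0 ⇛ q ≼ κ 1 ⇛ ⊢ κ 3 ⊕ (d ⊕ q) ≼ k ⊕ κ 1) refl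
                k (dg K t′) (bit (Q t′)) (# R) (guard (T⊑F t′∈) q t′∈) R≥1 (dg-zero λ a w∈ → g w∈ (∈nb (~-sym a) t′∈)) (bit≤1 (Q t′))
          nx : Next piece
          nx = next piece base∈ id (⊥-elim ∘ L-∅) g room
          go : Adm k F P Q ⊎ Stuck K (Source.A (Next.src nx)) Q → Result
          go (inj₁ r) = inj₁ r
          go (inj₂ t) with e t Fin.≟ z
          ... | yes eq = settle (stuck-plain t eq)
          ... | no ne = after (follow solved piece t z∈K ne (x-source (L rest) (attached rest (∖⁺ z∈K (ne ∘ sym)) missH) missH))
            where
            rest : Piece (K ∖ e t) (N (e t))
            rest = tail piece t z∈K ne
            missH : Misses (K ∖ e t) (nb H)
            missH = off-H (g ∘ ∖ˡ) λ x → Next.uses nx (∖ˡ x) (λ a → ∖ʳ x (only-A t (∖ˡ x) a))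
            e∈nbR : e t ∈ nb R
            e∈nbR with proj₁ m ∈? Source.A (Next.src nx)
            ... | yes y = subst (_∈ nb R) (only-A t (proj₁ (proj₂ m)) y) (proj₂ (proj₂ m))
            ... | no y  = ⊥-elim (Next.uses nx (proj₁ (proj₂ m)) y (proj₂ (proj₂ m)))
            after : _ → Result
            after (inj₁ r) = inj₁ r
            after (inj₂ (_ , kb)) with twoQ (e t)
            ... | q , f , b , _ , ne′ with ∪⁻ {S = T} (in-core t f b ne′)
            ... | inj₁ q∈ = ⊥-elim (<⇒≱ (guard f b q∈) k≤)
              where
              k≤ : k ≤ suc (# R)
              k≤ = ≤-trans kb (≤-trans (+-monoˡ-≤ 1 (limit-R (K⊑F (e∈K t)) ne (K-off (e∈K t)) (g (e∈K t)))) (≤-reflexive (+-comm (# R) 1)))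
            -- Even sizes end in `q`, odd ones pass from `R` to `e`; `limit-R` gives k ≤ |R| + 1 ≤
            -- 2|R|.
            ... | inj₂ q∈ = inj₁ (alternate 2 (# R) (λ j h → even-paths q∈ b j h) (λ j h → through-R t e∈nbR j h)
              (lin 4 (λ k d p s → k ≼ d ⊕ p ⊕ κ 1 ⇛ d ⊕ p ≼ s ⇛ κ 1 ≼ s ⇛ ⊢ k ≼ s ⊕ s) refl
                 k (dg H (e t)) (bit (P (e t))) (# R) kb (limit-R (K⊑F (e∈K t)) ne (K-off (e∈K t)) (g (e∈K t))) R≥1))
        cases : Dec (k ≤ suc (# R)) → (∀ u → u ∉ F ∩ Q ∩ T) ⊎ (∃[ u ] u ∈ F ∩ Q ∩ T) → Result
        cases (yes k≤) (inj₂ (q , q∈)) = inj₁ (step2 1 (λ j h → odd-paths (∩ʳ {S = F ∩ Q} q∈) (∩ʳ {S = F} (∩ˡ q∈)) j (≤-pred h)) k≤)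
        cases (yes k≤) (inj₁ none) = large λ f b t → ⊥-elim (none _ (∩⁺ (∩⁺ f b) t))
        cases (no k≰) _ = large λ _ _ _ → ≰⇒> k≰

      -- Behind a stuck vertex `e ≠ z` there would have to be another neighbour of `x`, although `e`
      -- is the only one in `K`.
      at-x : Misses K (nb T) → Misses K (nb R) → Result
      at-x g g′ with peel solved piece (x-source (L piece) (attached piece base∈ (off-H g g′)) (off-H g g′)) z∈K
      ... | inj₁ r = inj₁ r
      ... | inj₂ t with e t Fin.≟ z
      ... | yes eq = settle (stuck-plain t eq)
      ... | no ne = let (v , v∈ , a) = attached (tail piece t z∈K ne) (∖⁺ z∈K (ne ∘ sym)) (off-H g g′ ∘ ∖ˡ) in
                    ⊥-elim (∖ʳ v∈ (only-A t (∖ˡ v∈) a))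

      result : Result
      result with meets? K (nb T) | meets? K (nb R)
      ... | inj₁ m | _       = at-T m
      ... | inj₂ g | inj₁ m  = at-R g m
      ... | inj₂ g | inj₂ g′ = at-x g g′

    opaque
      conclude : (∀ e → ∃[ q ] q ∈ F × q ∈ Q × q ≢ z × q ≢ e) → Adm k F P Q ⊎ TKind T ⊎ RKind H T R
      conclude twoQ with region solved
      ... | inj₁ r = inj₁ r
      ... | inj₂ (inj₁ h) = inj₂ (kinds λ f b _ → plain (λ m → h m) f b)
      ... | inj₂ (inj₂ R₀) = Conclude.result R₀ twoQ

-- Independent neighbours of `x`, one of them in a triangle.

module DenseCase {n : ℕ} (G : Graph n) where

  open Walks G
  open Rooted G
  open Start G
  open Families G
  open Analysis G
  open Cores G

  module Around (I : Problem) (Δ : Dense I) where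

    open Problem I
    open Dense Δ
    open Side I
    open Core₃ core hiding (T; R; C; T⊑E; R⊑E; T⊑P; complete; C⊑R; clique; C≥2; T≥1; common; P-ind; shape; maximal; C-max)
    open With H H⊑E (proj₁ t₀ , ∪ˡ (proj₂ t₀))

    open Sources₃ I core O id

    -- If T = {h}, then R is the clique, and pieces without neighbours there see only h.
    module Single (h : V) (h∈T : h ∈ T) (T<2 : ¬ (2 ≤ # T)) where

      open Hub {h} (∪ˡ h∈T) public

      h! : ∀ {t} → t ∈ T → t ≡ h
      h! {t} t∈ with t Fin.≟ h
      ... | yes eq = eq
      ... | no ne  = ⊥-elim (T<2 (≤-trans (s≤s (#-member (∖⁺ t∈ ne))) (≤-trans (≤-reflexive (+-comm 1 _)) (#-∖< h∈T))))

      R⊑C : R ⊑ C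
      R⊑C = [ id , (λ r → ⊥-elim (T<2 (≤-trans R≥2 r))) ]′ shape

      only-h : ∀ {K} → Misses K (nb C) → Only K
      only-h g x w e with ∪⁻ {S = T} w
      ... | inj₁ t = h! t
      ... | inj₂ r = ⊥-elim (g x (∈nb e (R⊑C r)))

      nbT⇒N : ∀ {u} → u ∈ nb T → u ∈ N h
      nbT⇒N {u} m = let (t , e , t∈) = nb∈ m in ~-sym (subst (u ~_) (h! t∈) e)

      apart : ∀ {u} → u ∈ F → u ∈ P → u ∉ N h
      apart f p m = P-ind f (T⊑F h∈T) p (T⊑P h∈T) m

      at-h : ∀ {u} → u ∈ N h → Pre P H 1 u
      at-h e = inj₂ (h , h , T⊑P h∈T , one (∪ˡ h∈T) , e)

    provider : Provider
    provider {K} p z∉ (v , m) rec with meets? K (nb C)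
    ... | inj₁ g = inj₁ (source-C p g)
    ... | inj₂ gC with meets? K (nb T) | meets? K (nb R)
    ... | inj₂ gT | inj₁ g  = inj₁ (source-R p gC gT g)
    ... | inj₂ gT | inj₂ gR = inj₁ (x-source (L p) (attached p m (off-H gT gR)) (off-H gT gR))
    ... | inj₁ g  | _ with 2 ≤? # T
    ... | yes T≥2 = inj₁ (source-T p gC g T≥2)
    ... | no T<2 = hub-free p z∉ (v , m) (only-h gC) (λ x → apart (inF p x))
          (proj₁ c₀ , R⊑F (C⊑R (proj₂ c₀)) , (λ x → offH p x (∪ʳ {S = T} (C⊑R (proj₂ c₀)))) , (λ eq → ~-irr (subst (proj₁ t₀ ~_) eq (complete (proj₂ t₀) (C⊑R (proj₂ c₀))))))
          (1 , at-h) rec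
      where open Single (proj₁ t₀) (proj₂ t₀) T<2

    solved : Solved
    solved = zfree provider

    walk⇒AB : ∀ {q c} → q ∈ Q → (∃[ s ] s ∈ P × Walk H s q c) → AB F P Q c
    walk⇒AB b (s , p , w) = s , _ , p , b , walk-mono H⊑F w

    -- Two neighbours of y are not adjacent, so the clique has a vertex that is not one.
    off-Q : ∃[ c ] c ∈ C × c ∉ Q
    off-Q with #-pick≢ (proj₁ c₀) C≥2
    ... | c , c∈ , ne with c ∈? Q | proj₁ c₀ ∈? Q
    ... | no g  | _     = c , c∈ , g
    ... | yes _ | no g  = proj₁ c₀ , proj₂ c₀ , g
    ... | yes a | yes b = ⊥-elim (Q-ind (R⊑F (C⊑R c∈)) (R⊑F (C⊑R (proj₂ c₀))) a b (clique (proj₂ c₀) c∈ (ne ∘ sym)))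

    -- The clique inside `R` has a vertex not adjacent to `y`, so the inclusion in `R` is proper.
    count-R : ∀ {x} → # R ≤ # T → (∀ {q} → q ∈ F → q ∈ Q → q ≢ x → q ∈ R) → # ((F ∩ Q) ∖ x) < # T
    count-R {x} le toR = let (c , c∈ , g) = off-Q in
      ≤-trans (#-strict {S = (F ∩ Q) ∖ x} {R} (λ m → toR (∩ˡ (∖ˡ m)) (∩ʳ {S = F} (∖ˡ m)) (∖ʳ m)) (C⊑R c∈)
                        (λ m → g (∩ʳ {S = F} (∖ˡ m)))) le

    TwoQ : Set
    TwoQ = ∀ e → ∃[ q ] q ∈ F × q ∈ Q × q ≢ z × q ≢ e

    kinds : TwoQ → (∀ {q} → q ∈ F → q ∈ Q → q ≢ z → q ∈ H) → TKind T ⊎ RKind H T R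
    kinds twoQ h with one-side T⊑F R⊑F complete Q-ind h
    ... | inj₁ t = inj₁ t
    ... | inj₂ toR = inj₂ record { e = z ; toR = toR ; small = count-R le toR ; tiny = λ h → ⊥-elim (h refl) }
      where
      -- If `R` were the clique, two neighbours of `y` in it would be adjacent.
      le : # R ≤ # T
      le = [ (λ i → let (q , f , b , nz , _) = twoQ z ; (q′ , f′ , b′ , nz′ , ne) = twoQ q in
                    ⊥-elim (Q-ind f f′ b b′ (clique (i (toR f′ b′ nz′)) (i (toR f b nz)) ne))) , id ]′ shape

    module Conclude (R₀ : Region S Q ∅) (twoQ : TwoQ) where

      open AtRegion R₀

      Result : Set
      Result = Adm k F P Q ⊎ TKind T ⊎ RKind H T R

      settle : (∀ {q} → q ∈ F → q ∈ Q → q ≢ z → q ∈ H) → Result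
      settle h = inj₂ (kinds twoQ h)

      -- The case T = {h}: D is the component of the clique when h and z's component K are removed.
      module Lone (h : V) (h∈T : h ∈ T) (T<2 : ¬ (2 ≤ # T)) where

        open Single h h∈T T<2 public

        rest : Sub n
        rest = F ─ K ─ ｛ h ｝

        C⊑rest : C ⊑ rest
        C⊑rest c = ─⁺ (─⁺ (R⊑F (C⊑R c)) (λ m → K-off m (∪ʳ {S = T} (C⊑R c)))) (λ s → ~-irr (complete h∈T (subst (_∈ R) (｛｝∈ s) (C⊑R c))))

        comp-C : Comp rest (proj₁ c₀)
        comp-C = comp rest (proj₁ c₀) (C⊑rest (proj₂ c₀))

        D : Sub n
        D = Comp.D comp-C

        cD : Closed rest D
        cD = Comp.closed comp-C

        D⊑F : D ⊑ F
        D⊑F = ─ˡ ∘ ─ˡ ∘ sub cD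

        D-off : ∀ {u} → u ∈ D → u ∉ K
        D-off m = ─ʳ {S = F} (─ˡ (sub cD m))

        h∉D : h ∉ D
        h∉D m = ─ʳ {S = F ─ K} (sub cD m) ∈｛｝

        N-h : ∀ {c} → c ∈ C → c ∈ N h
        N-h c = complete h∈T (C⊑R c)

        -- Every non-empty closed part of the component `D` contains its base, which is adjacent to
        -- the rest of the clique.
        full : ∀ {E u} → Closed D E → u ∈ E → C ⊑ E
        full {E} cE m {c} c∈ with c Fin.≟ proj₁ c₀
        ... | yes refl = comp-minimal comp-C cE m
        ... | no ne    = cl cE base′ (cl cD (Comp.base comp-C) (C⊑rest c∈) edge) edge
          where
          base′ = comp-minimal comp-C cE m
          edge : proj₁ c₀ ~ c
          edge = clique (proj₂ c₀) c∈ (ne ∘ sym)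

        touchC : ∀ {u} → u ∈ D → u ∈ Q ⊎ (∃[ w ] w ∈ K × u ~ w) → u ∈ C
        touchC {u} m x with u ∈? H
        ... | yes y = [ (λ t → ⊥-elim (h∉D (subst (_∈ D) (h! t) m))) , R⊑C ]′ (∪⁻ {S = T} y)
        touchC m (inj₁ q) | no y = ⊥-elim (y (exits (D⊑F m) q (D-off m)))
        touchC m (inj₂ (w , w∈ , e)) | no y = ⊥-elim (D-off m (cl shut w∈ (∈S (D⊑F m) y) (~-sym e)))

        dg-D : ∀ {u} → u ∈ D → dg F u ≤ dg D u + (dg K u + dg ｛ h ｝ u)
        dg-D {u} m = ≤-trans (dg-cover {F} {D} {K ∪ ｛ h ｝} λ {w} e f → part w e f)
                             (+-monoʳ-≤ (dg D u) (dg-cover {K ∪ ｛ h ｝} {K} {｛ h ｝} λ _ → ∪⁻))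
          where
          part : ∀ w → u ~ w → w ∈ F → w ∈ D ⊎ w ∈ K ∪ ｛ h ｝
          part w e f with w ∈? (K ∪ ｛ h ｝)
          ... | yes y = inj₂ y
          ... | no y  = inj₁ (cl cD m (─⁺ (─⁺ f (y ∘ ∪ˡ)) (y ∘ ∪ʳ {S = K})) e)

        noK : ∀ {u} → u ∈ D → u ∉ C → dg K u + bit (Q u) ≤ 0
        noK m c = +-mono-≤ (dg-zero λ e w → c (touchC m (inj₂ (_ , w , e)))) (≤-reflexive (bit-false λ q → c (touchC m (inj₁ q))))

        lengths : (∀ {c} → c ∈ C → 3 + (dg K c + bit (Q c)) ≤ k + 1) → Meets D P → Adm 2 D P (N h)
        lengths room (v , v∈ , p) = hub-adm (∪ˡ h∈T) cD (λ m x → N-h (touchC m x)) onP deg3 (proj₁ c₀ , Comp.base comp-C)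
          where
          onP : ∀ {E u} → Closed D E → u ∈ E → Meets E P
          onP cE m = v , walk-closed cE (proj₂ (Comp.reach comp-C v∈)) (comp-minimal comp-C cE m) , p
          deg3 : ∀ {u} → u ∈ D → 3 ≤ dg D u + bit (P u) + bit (N h u)
          deg3 {u} m = lin 9 (λ k f p q c d i j x → κ 3 ⊕ (c ⊕ q) ≼ k ⊕ κ 1 ⇛ k ⊕ κ 1 ≼ f ⊕ p ⊕ q ⇛ f ≼ d ⊕ (c ⊕ i) ⇛ i ≼ j ⇛
                               ⊢ κ 3 ≼ d ⊕ p ⊕ j) refl
              k (dg F u) (bit (P u)) (bit (Q u)) (dg K u) (dg D u) (dg ｛ h ｝ u) (bit (N h u)) 0
              (room′ (u ∈? C)) (degF (D⊑F m) (λ { refl → D-off m z∈K })) (dg-D m) (dg-one {｛ h ｝} h λ _ → ｛｝∈)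
            where
            room′ : Dec (u ∈ C) → 3 + (dg K u + bit (Q u)) ≤ k + 1
            room′ (yes c) = room c
            room′ (no c)  = lin 2 (λ a k → a ≼ κ 0 ⇛ κ 2 ≼ k ⇛ ⊢ κ 3 ⊕ a ≼ k ⊕ κ 1) refl (dg K u + bit (Q u)) k (noK m c) k≥2

        -- Without a neighbour of x, D is entered through h only.
        blocked : ∀ B w → Misses D P → (∀ {E u} → Closed D E → u ∈ E → Meets E B) →
                  (∀ {u} → u ∈ D → u ≢ w → dg K u + bit (Q u) ≤ bit (B u)) → (∃[ u ] u ∈ D × u ≢ w) → Adm k D (N h) B
        blocked B w noP onB lost wit =
          below D (N h) B w k (#-strict D⊑F (T⊑F h∈T) h∉D) k≥1
            record { rgP = onN ; rgQ = onB ; rgX = onX } wit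
            λ {u} m ne → lin 9 (λ k f p q c d i j b → k ⊕ κ 1 ≼ f ⊕ p ⊕ q ⇛ p ≼ κ 0 ⇛ f ≼ d ⊕ (c ⊕ i) ⇛ i ≼ j ⇛ c ⊕ q ≼ b ⇛ ⊢ k ⊕ κ 1 ≼ d ⊕ j ⊕ b) refl
              k (dg F u) (bit (P u)) (bit (Q u)) (dg K u) (dg D u) (dg ｛ h ｝ u) (bit (N h u)) (bit (B u))
              (degF (D⊑F m) (λ { refl → D-off m z∈K })) (≤-reflexive (bit-false (noP m))) (dg-D m) (dg-one {｛ h ｝} h λ _ → ｛｝∈) (lost m ne)
          where
          reopen : ∀ {E u v} → E ⊑ D → Misses E (N h) → u ∈ E → v ∈ F → u ~ v → v ∈ D
          reopen {v = v} i g m f a with v ∈? K | v Fin.≟ h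
          ... | yes v∈ | _        = ⊥-elim (g m (N-h (touchC (i m) (inj₂ (v , v∈ , a)))))
          ... | no _   | yes refl = ⊥-elim (g m (~-sym a))
          ... | no v∉  | no ne    = cl cD (i m) (─⁺ (─⁺ f v∉) (λ s → ne (｛｝∈ s))) a
          onN : ∀ {E u} → Closed D E → u ∈ E → Meets E (N h)
          onN {E} c m with meets? E (N h)
          ... | inj₁ r = r
          ... | inj₂ g with rgP rg (record { sub = D⊑F ∘ sub c ; cl = λ x f a → cl c x (reopen (sub c) g x f a) a }) m
          ... | v , a , b = ⊥-elim (noP (sub c a) b)
          onX : ∀ x {E u} → Closed (D ∖ x) E → u ∈ E → Meets E (N h ∪ B)
          onX x {E} c m with meets? E (N h)
          ... | inj₁ (v , a , b) = v , a , ∪ˡ b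
          ... | inj₂ g with rgX rg x (record { sub = λ y → ∖⁺ (D⊑F (∖ˡ (sub c y))) (∖ʳ (sub c y))
                                              ; cl = λ y f a → cl c y (∖⁺ (reopen (∖ˡ ∘ sub c) g y (∖ˡ f) a) (∖ʳ f)) a }) m
          ... | v , a , b = ⊥-elim ([ noP (∖ˡ (sub c a)) , (λ q → g a (N-h (touchC (∖ˡ (sub c a)) (inj₁ q)))) ]′ (∪⁻ {S = P} b))

        from-h : ∀ {B L′ ℓ} → L′ ⊑ F → h ∉ L′ → Disjoint D L′ → (∀ {u} → u ∈ D → u ∈ B → Pre Q L′ ℓ u) → Adm k D (N h) B → Adm k F P Q
        from-h {ℓ = ℓ} l hl dl out = combine {X = ｛ h ｝} {a = 1} {1} {ℓ} 1 k k (inj₁ refl) ≤-refl k≥1 ≤-refl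
          (λ m → subst (_∈ F) (sym (｛｝∈ m)) (T⊑F h∈T)) D⊑F l (λ m d → h∉D (subst (_∈ D) (｛｝∈ m) d)) (λ m x → hl (subst (_∈ _) (｛｝∈ m) x)) dl
          (λ { _ e zero _ → Pre-single (T⊑P h∈T) e ; _ _ (suc _) (s≤s ()) }) out

        hub : ∀ {K′ B u} (p : Piece K′ B) → u ∈ K′ → K′ ⊑ K → L p ⊑ K → Misses K′ (nb C) → Meets K′ (nb T) →
              (∀ {c} → c ∈ C → 3 + (dg K c + bit (Q c)) ≤ k + 1) → (Misses D P → Adm k F P Q) → Source K′ (L p) ⊎ Adm k F P Q
        hub p m i l g g′ room other with meets? D P
        ... | inj₂ x = inj₂ (other x)
        ... | inj₁ x = inj₁ (hub-source p D (only-h g) (let (v , a , b) = g′ in v , a , nbT⇒N b) D⊑F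
                (λ d y → D-off d (i y)) (λ d y → D-off d (l y)) h∉D (lengths room x))

      next : ∀ {K′ B u} (p : Piece K′ B) → u ∈ K′ → K′ ⊑ K → L p ⊑ K → Misses K′ (nb C) →
             (∀ {c} → c ∈ C → 3 + (dg K c + bit (Q c)) ≤ k + 1) →
             (∀ h (h∈T : h ∈ T) (T<2 : ¬ (2 ≤ # T)) → Misses (Lone.D h h∈T T<2) P → Adm k F P Q) → Source K′ (L p) ⊎ Adm k F P Q
      next {K′} p m i l gC room other with meets? K′ (nb T) | meets? K′ (nb R)
      ... | inj₂ gT | inj₁ g  = inj₁ (source-R p gC gT g)
      ... | inj₂ gT | inj₂ gR = inj₁ (x-source (L p) (attached p m (off-H gT gR)) (off-H gT gR))
      ... | inj₁ g  | _ with 2 ≤? # T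
      ... | yes T≥2 = inj₁ (source-T p gC g T≥2)
      ... | no T<2  = Lone.hub (proj₁ t₀) (proj₂ t₀) T<2 p m i l gC g room (other (proj₁ t₀) (proj₂ t₀) T<2)

      at-most : ∀ {A} (t : Stuck K A Q) → A ≡ nb C → ∀ {c} → c ∈ C → dg K c + bit (Q c) ≤ 1
      at-most t refl {c} c∈ with c ∈? N (e t) | c ∈? Q
      ... | yes y | yes q = ⊥-elim (Q-ind (R⊑F (C⊑R c∈)) (K⊑F (e∈K t)) q (e∈B t) y)
      ... | no y | _ = lin 2 (λ d q → d ≼ κ 0 ⇛ q ≼ κ 1 ⇛ ⊢ d ⊕ q ≼ κ 1) refl (dg K c) (bit (Q c))
            (dg-zero λ {w} a w∈ → y (~-sym (subst (c ~_) (only-A t w∈ (∈nb (~-sym a) c∈)) a))) (bit≤1 (Q c))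
      ... | yes y | no q = lin 2 (λ d q → d ≼ κ 1 ⇛ q ≼ κ 0 ⇛ ⊢ d ⊕ q ≼ κ 1) refl (dg K c) (bit (Q c))
            (#-single {S = N c ∩ K} (e t) λ x → only-A t (∩ʳ {S = N c} x) (∈nb (~-sym (∩ˡ x)) c∈)) (≤-reflexive (bit-false q))

      -- Here K = {e, z} and y sees only e and the single vertex h of T; K is deleted and h excepted.
      module Pair (t : Stuck K (nb C) Q) (two : ∀ {u} → u ∈ K → u ≡ e t ⊎ u ≡ z) (h : V) (h∈T : h ∈ T) (T<2 : ¬ (2 ≤ # T))
                  (z∉P : z ∉ P) (z∉C : z ∉ nb C) (noR : ∀ {q} → q ∈ F → q ∈ Q → q ∉ R) where

        open Single h h∈T T<2

        E : Sub n
        E = F ─ K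

        Q⇒h : ∀ {u} → u ∈ E → u ∈ Q → u ≡ h
        Q⇒h m b with ∪⁻ {S = T} (exits (─ˡ m) b (─ʳ {S = F} m))
        ... | inj₁ y = h! y
        ... | inj₂ y = ⊥-elim (noR (─ˡ m) b y)

        z⇒h : ∀ {u} → u ∈ E → u ~ z → u ≡ h
        z⇒h {u} m a with u ∈? H
        ... | no y = ⊥-elim (─ʳ {S = F} m (cl shut z∈K (∈S (─ˡ m) y) (~-sym a)))
        ... | yes y with ∪⁻ {S = T} y
        ... | inj₁ x = h! x
        ... | inj₂ x = ⊥-elim (z∉C (∈nb (~-sym a) (R⊑C x)))

        nbr : ∀ {u v} → u ∈ E → u ≢ h → v ∈ F → u ~ v → v ∈ E ⊎ v ≡ e t
        nbr {v = v} m ne f a with v ∈? K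
        ... | no y = inj₁ (─⁺ f y)
        ... | yes y with two y
        ... | inj₁ eq = inj₂ eq
        ... | inj₂ refl = ⊥-elim (ne (z⇒h m a))

        C⊑E : C ⊑ E
        C⊑E c = ─⁺ (R⊑F (C⊑R c)) λ m → K-off m (∪ʳ {S = T} (C⊑R c))

        rooted : RG E P (N (e t))
        rooted = record { rgP = onP ; rgQ = onN ; rgX = onX }
          where
          onP : ∀ {C′ u} → Closed E C′ → u ∈ C′ → Meets C′ P
          onP {C′} c m with h ∈? C′
          ... | yes y = h , y , T⊑P h∈T
          ... | no y with rgX rg (e t) (record { sub = λ x → ∖⁺ (─ˡ (sub c x)) (λ { refl → ─ʳ {S = F} (sub c x) (e∈K t) }) ; cl = go }) m
            where
            go : ∀ {u v} → u ∈ C′ → v ∈ F ∖ e t → u ~ v → v ∈ C′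
            go x f a = [ (λ v∈ → cl c x v∈ a) , (λ eq → ⊥-elim (∖ʳ f eq)) ]′ (nbr (sub c x) (λ { refl → y x }) (∖ˡ f) a)
          ... | v , v∈ , b = v , v∈ , [ id , (λ q → ⊥-elim (y (subst (_∈ C′) (Q⇒h (sub c v∈) q) v∈))) ]′ (∪⁻ {S = P} b)
          onN : ∀ {C′ u} → Closed E C′ → u ∈ C′ → Meets C′ (N (e t))
          onN {C′} c m with meets? C′ (N (e t)) | h ∈? C′
          ... | inj₁ r | _ = r
          ... | inj₂ g | yes y = let (c′ , a , c∈) = nb∈ (e∈A t) in ⊥-elim (g (cl c y (C⊑E c∈) (complete h∈T (C⊑R c∈))) a)
          ... | inj₂ g | no y with rgQ rg (record { sub = ─ˡ ∘ sub c ; cl = go }) m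
            where
            go : ∀ {u v} → u ∈ C′ → v ∈ F → u ~ v → v ∈ C′
            go x f a = [ (λ v∈ → cl c x v∈ a) , (λ { refl → ⊥-elim (g x (~-sym a)) }) ]′ (nbr (sub c x) (λ { refl → y x }) f a)
          ... | v , v∈ , q = ⊥-elim (y (subst (_∈ C′) (Q⇒h (sub c v∈) q) v∈))
          onX : ∀ w {C′ u} → Closed (E ∖ w) C′ → u ∈ C′ → Meets C′ (P ∪ N (e t))
          onX w {C′} c m with meets? C′ (P ∪ N (e t))
          ... | inj₁ r = r
          ... | inj₂ g with rgX rg w (record { sub = λ x → ∖⁺ (─ˡ (∖ˡ (sub c x))) (∖ʳ (sub c x)) ; cl = go }) m
            where
            go : ∀ {u v} → u ∈ C′ → v ∈ F ∖ w → u ~ v → v ∈ C′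
            go x f a = [ (λ v∈ → cl c x (∖⁺ v∈ (∖ʳ f)) a) , (λ { refl → ⊥-elim (g x (∪ʳ {S = P} (~-sym a))) }) ]′
                         (nbr (∖ˡ (sub c x)) (λ { refl → g x (∪ˡ (T⊑P h∈T)) }) (∖ˡ f) a)
          ... | v , v∈ , b = ⊥-elim ([ (λ p → g v∈ (∪ˡ p)) ,
                (λ q → g v∈ (∪ˡ (subst (_∈ P) (sym (Q⇒h (∖ˡ (sub c v∈)) q)) (T⊑P h∈T)))) ]′ (∪⁻ {S = P} b))

        adm : Adm k F P Q
        adm = combine {X = ∅} {E} {｛ e t ｝} {a = 0} {1} {1} 1 k k (inj₁ refl) ≤-refl k≥1 ≤-refl (⊥-elim ∘ ∉∅) ─ˡ
          (λ m → subst (_∈ F) (sym (｛｝∈ m)) (K⊑F (e∈K t))) (⊥-elim ∘ ∉∅) (⊥-elim ∘ ∉∅)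
          (λ m s → ─ʳ {S = F} m (subst (_∈ K) (sym (｛｝∈ s)) (e∈K t)))
          (λ { _ a zero _ → inj₁ (refl , a) ; _ _ (suc _) (s≤s ()) }) (λ _ a → Pre-single (e∈B t) a)
          (below E P (N (e t)) h k (#-strict ─ˡ (K⊑F z∈K) (λ m → ─ʳ {S = F} m z∈K)) k≥1 rooted
            (proj₁ c₀ , C⊑E (proj₂ c₀) , λ eq → ~-irr (subst (h ~_) eq (complete h∈T (C⊑R (proj₂ c₀)))))
            λ {u} m ne → lin 7 (λ k f p q d i j → k ⊕ κ 1 ≼ f ⊕ p ⊕ q ⇛ q ≼ κ 0 ⇛ f ≼ d ⊕ i ⇛ i ≼ j ⇛ ⊢ k ⊕ κ 1 ≼ d ⊕ p ⊕ j) refl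
              k (dg F u) (bit (P u)) (bit (Q u)) (dg E u) (dg ｛ e t ｝ u) (bit (N (e t) u))
              (degF (─ˡ m) (λ { refl → ─ʳ {S = F} m z∈K })) (≤-reflexive (bit-false λ q → ne (Q⇒h m q)))
              (dg-cover {F} {E} {｛ e t ｝} λ a f → [ inj₁ , (λ { refl → inj₂ ∈｛｝ }) ]′ (nbr m ne f a)) (dg-one {｛ e t ｝} (e t) λ _ → ｛｝∈))

      -- The paths through `C` and a stuck vertex `e ≠ z` have the sizes 3 to |R| + μ + 1, enough
      -- for k < |R| + μ. Otherwise the piece behind `e`, which is not next to `C`, is tried. It can
      -- only be stuck at `z`, since a third stuck vertex would force k < |R| + μ.
      at-C : Meets K (nb C) → Result
      at-C m with peel solved piece (source-C piece m) z∈K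
      ... | inj₁ r = inj₁ r
      ... | inj₂ t with e t Fin.≟ z
      ... | yes eq = settle (stuck-plain t eq)
      ... | no ne with k + 1 ≤? # R + μ
      ... | yes k≤ = inj₁ (adm-run k 3 (suc (# R + μ)) (≤-trans (≤-reflexive (sym (+-assoc k 1 2))) (≤-trans (+-monoˡ-≤ 2 k≤) (≤-reflexive (+-comm (# R + μ) 2))))
              λ { (suc c) (s≤s l) (s≤s h) → AB-via (reach-C (e∈A t) c l h) (K⊑F (e∈K t)) (K-off (e∈K t)) (e∈B t) })
      ... | no k≰ = start (next J z∈J ∖ˡ (tail-off t ne) missC room blocked-J)
        where
        ε = e t
        J : Piece (K ∖ ε) (N ε)
        J = tail piece t z∈K ne
        z∈J : z ∈ K ∖ ε
        z∈J = ∖⁺ z∈K (ne ∘ sym)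
        missC : Misses (K ∖ ε) (nb C)
        missC x a = ∖ʳ x (only-A t (∖ˡ x) a)
        σ≤k : # R + μ ≤ k
        σ≤k = ≤-pred (≤-trans (≰⇒> k≰) (≤-reflexive (+-comm k 1)))
        room : ∀ {c} → c ∈ C → 3 + (dg K c + bit (Q c)) ≤ k + 1
        room {c} c∈ = lin 4 (λ k r m x → r ⊕ m ≼ k ⇛ κ 2 ≼ r ⇛ κ 1 ≼ m ⇛ x ≼ κ 1 ⇛ ⊢ κ 3 ⊕ x ≼ k ⊕ κ 1) refl
          k (# R) μ (dg K c + bit (Q c)) σ≤k R≥2 μ≥1 (at-most t refl c∈)
        blocked-J : ∀ h (h∈T : h ∈ T) (T<2 : ¬ (2 ≤ # T)) → Misses (Lone.D h h∈T T<2) P → Adm k F P Q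
        blocked-J h h∈T T<2 noP = from-h (λ m → subst (_∈ F) (sym (｛｝∈ m)) (K⊑F (e∈K t)))
            (λ m → K-off (subst (_∈ K) (sym (｛｝∈ m)) (e∈K t)) (∪ˡ h∈T)) (λ d m → D-off d (subst (_∈ K) (sym (｛｝∈ m)) (e∈K t)))
            (λ _ a → Pre-single (e∈B t) a) (by-Q (find (C ∩ Q)))
          where
          open Lone h h∈T T<2
          onB : ∀ {E u} → Closed D E → u ∈ E → Meets E (N ε)
          onB cE x = let (c , a , c∈) = nb∈ (e∈A t) in c , full cE x c∈ , a
          seen : ∀ {u} → u ∈ D → dg K u ≤ bit (N ε u)
          seen {u} d = dg-one {K} ε λ a w∈ → only-A t w∈ (∈nb (~-sym a) (touchC d (inj₂ (_ , w∈ , a))))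
          -- At most one vertex `q` of the clique is adjacent to `y`. Its edge to `y` is lost
          -- without credit, so it becomes the exception; `z`, lying in `K`, does not compete for
          -- this.
          by-Q : (∀ u → u ∉ C ∩ Q) ⊎ (∃[ u ] u ∈ C ∩ Q) → Adm k D (N h) (N ε)
          by-Q (inj₁ none) = blocked (N ε) z noP onB (λ {u} d _ → ≤-trans (+-mono-≤ (seen d) (≤-reflexive (bit-false λ q → none u (∩⁺ (touchC d (inj₁ q)) q)))) (≤-reflexive (+-identityʳ _)))
            (proj₁ c₀ , full whole-set (Comp.base comp-C) (proj₂ c₀) , λ { eq → D-off (full whole-set (Comp.base comp-C) (proj₂ c₀)) (subst (_∈ K) (sym eq) z∈K) })
          by-Q (inj₂ (q , q∈)) = blocked (N ε) q noP onB (λ {u} d nq → ≤-trans (+-mono-≤ (seen d) (≤-reflexive (bit-false λ q′ →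
              Q-ind (D⊑F d) (R⊑F (C⊑R (∩ˡ q∈))) q′ (∩ʳ {S = C} q∈) (clique (∩ˡ q∈) (touchC d (inj₁ q′)) (nq ∘ sym))))) (≤-reflexive (+-identityʳ _)))
            (let (c , c∈ , nc) = #-pick≢ q C≥2 in c , full whole-set (Comp.base comp-C) c∈ , nc)
        via-e : ∀ c → 3 ≤ c → c ≤ suc (# R + μ) → AB F P Q c
        via-e (suc c) (s≤s l) (s≤s h) = AB-via (reach-C (e∈A t) c l h) (K⊑F (e∈K t)) (K-off (e∈K t)) (e∈B t)
        from2 : AB F P Q 2 → k ≤ # R + μ → Adm k F P Q
        from2 a le = adm-run k 2 (suc (# R + μ)) (≤-trans (+-monoˡ-≤ 2 le) (≤-reflexive (+-comm (# R + μ) 2))) go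
          where
          go : ∀ c → 2 ≤ c → c ≤ suc (# R + μ) → AB F P Q c
          go (suc (suc zero)) _ _ = a
          go (suc (suc (suc c))) _ h = via-e (suc (suc (suc c))) (s≤s (s≤s (s≤s z≤n))) h
          go (suc zero) (s≤s ()) _
        top : AB F P Q (2 + (# R + μ)) → k ≤ # R + μ → Adm k F P Q
        top a le = adm-run k 3 (2 + (# R + μ)) (≤-trans (+-monoˡ-≤ 3 le) (≤-reflexive (+-comm (# R + μ) 3))) go
          where
          go : ∀ c → 3 ≤ c → c ≤ 2 + (# R + μ) → AB F P Q c
          go c l h with c ≤? suc (# R + μ)
          ... | yes x = via-e c l x
          ... | no x  = subst (AB F P Q) (≤-antisym (≰⇒> x) h) a
        -- Now k = |R| + μ, so one size is lacking. It is 2 if `y` has a neighbour in `R` or `z` is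
        -- adjacent to `x`, and otherwise |R| + μ + 2, from a longest path of the core followed by
        -- `z` and `e`. `Pair` treats the case where neither is available.
        pair : ∀ {A} (t′ : Stuck (K ∖ ε) A (N ε)) → e t′ ≡ z → k ≤ # R + μ → Adm k F P Q
        pair t′ eq le = cases (find (F ∩ Q ∩ R))
          where
          z~e : z ~ ε
          z~e = ~-sym (subst (ε ~_) eq (e∈B t′))
          two : ∀ {u} → u ∈ K → u ≡ ε ⊎ u ≡ z
          two {u} m with u Fin.≟ ε
          ... | yes x = inj₁ x
          ... | no x  = inj₂ (alone t′ eq (∖⁺ m x))
          z-off : z ∉ nb C
          z-off = missC z∈J
          via-z : ∀ c → Pre P H c z → AB F P Q (2 + c)
          via-z c pre = AB-via2 pre (K⊑F z∈K) (K-off z∈K) (K⊑F (e∈K t)) (K-off (e∈K t)) z~e (e∈B t)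
          cases : (∀ u → u ∉ F ∩ Q ∩ R) ⊎ (∃[ u ] u ∈ F ∩ Q ∩ R) → Adm k F P Q
          cases (inj₂ (q , q∈)) = from2 (walk⇒AB (∩ʳ {S = F} (∩ˡ q∈)) (walk-R (∩ʳ {S = F ∩ Q} q∈) 0 μ≥1)) le
          cases (inj₁ none) with z ∈? P | z ∈? nb T | z ∈? nb R
          ... | yes p | _ | _ = from2 (via-z 0 (inj₁ (refl , p))) le
          ... | no _ | no _ | yes r = top (subst (AB F P Q) (cong (2 +_) count) (via-z _ (reach-R r (pred μ) (≤-reflexive (suc-pred μ {{>-nonZero μ≥1}}))))) le
            where
            μR : μ ≡ # R
            μR = let (v , a , v∈) = nb∈ r in m≥n⇒m⊓n≡n (R≤T v∈ (λ c → z-off (∈nb a c)))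
            count : 2 + pred μ * 2 ≡ # R + μ
            count = trans (cong (_* 2) (suc-pred μ {{>-nonZero μ≥1}})) (trans (double μ) (cong (_+ μ) μR))
          ... | no p | no x | no y = ⊥-elim (lonely (toO J whole-set z∈J))
            where
            lonely : Meets (K ∖ ε) O → ⊥
            lonely (v , v∈ , o) with alone t′ eq v∈ | ∪⁻ {S = P} o
            ... | refl | inj₁ q = p q
            ... | refl | inj₂ q = off-H {｛ z ｝} (λ s → subst (_∉ nb T) (sym (｛｝∈ s)) x) (λ s → subst (_∉ nb R) (sym (｛｝∈ s)) y) ∈｛｝ q
          ... | no p | yes x | _ with 2 ≤? # T
          ... | yes T≥2 = top (via-z _ (reach-T x T≥2 (# R + μ) (lin 2 (λ r m → κ 2 ≼ r ⇛ κ 1 ≼ m ⇛ ⊢ κ 3 ≼ r ⊕ m) refl (# R) μ R≥2 μ≥1) ≤-refl)) le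
          ... | no T<2  = Pair.adm t two (proj₁ t₀) (proj₂ t₀) T<2 p z-off λ f b r → none _ (∩⁺ (∩⁺ f b) r)
        after : ∀ {A} → Adm k F P Q ⊎ (Stuck (K ∖ ε) A (N ε) × k ≤ dg H ε + bit (P ε) + 1) → Result
        after (inj₁ r) = inj₁ r
        after (inj₂ (t′ , kb)) with e t′ Fin.≟ z
        ... | yes eq = inj₁ (pair t′ eq (lin 6 (λ k d p r m b → k ≼ d ⊕ p ⊕ κ 1 ⇛ d ⊕ p ⊕ κ 2 ≼ r ⊕ m ⊕ b ⇛ b ≼ κ 1 ⇛ ⊢ k ≼ r ⊕ m) refl
                k (dg H ε) (bit (P ε)) (# R) μ (bit (nb C ε)) kb (limit-C (K⊑F (e∈K t)) ne (K-off (e∈K t))) (bit≤1 (nb C ε))))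
        ... | no ne′ = inj₁ ([ third , id ]′ (next last (∖⁺ z∈J (ne′ ∘ sym)) (∖ˡ ∘ ∖ˡ) last-L (missC ∘ ∖ˡ) room blocked-J))
          where
          last : Piece (K ∖ ε ∖ e t′) (N (e t′))
          last = tail J t′ z∈J ne′
          last-L : L last ⊑ K
          last-L x = [ tail-off t ne , ∖ˡ ]′ (∪⁻ {S = L J} (tail-L J t′ z∈J ne′ x))
          third : Source (K ∖ ε ∖ e t′) (L last) → Adm k F P Q
          third s with follow solved J t′ z∈J ne′ s
          ... | inj₁ r = r
          ... | inj₂ (_ , kb′) = ⊥-elim (k≰ (lin 6 (λ k d p r m b → k ≼ d ⊕ p ⊕ κ 1 ⇛ d ⊕ p ⊕ κ 2 ≼ r ⊕ m ⊕ b ⇛ b ≼ κ 0 ⇛ ⊢ k ⊕ κ 1 ≼ r ⊕ m) refl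
                k (dg H (e t′)) (bit (P (e t′))) (# R) μ (bit (nb C (e t′))) kb′
                (limit-C (K⊑F (∖ˡ (e∈K t′))) ne′ (K-off (∖ˡ (e∈K t′)))) (≤-reflexive (bit-false (missC (e∈K t′))))))
        start : Source (K ∖ ε) (L J) ⊎ Adm k F P Q → Result
        start (inj₂ r) = inj₁ r
        start (inj₁ s) = after (follow solved piece t z∈K ne s)

      source-RX : ∀ {K′ B u} (p : Piece K′ B) → u ∈ K′ → Misses K′ (nb C) → Misses K′ (nb T) → Source K′ (L p)
      source-RX {K′} p m gC gT with meets? K′ (nb R)
      ... | inj₁ g  = source-R p gC gT g
      ... | inj₂ gR = x-source (L p) (attached p m (off-H gT gR)) (off-H gT gR)

      small-deg : ∀ {u} → u ∈ K → u ≢ z → u ∉ nb C → k ≤ dg H u + bit (P u) + 1 → k + 1 ≤ # R + μ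
      small-deg {u} m uz g kb = lin 6 (λ k d p r m b → k ≼ d ⊕ p ⊕ κ 1 ⇛ d ⊕ p ⊕ κ 2 ≼ r ⊕ m ⊕ b ⇛ b ≼ κ 0 ⇛ ⊢ k ⊕ κ 1 ≼ r ⊕ m) refl
        k (dg H u) (bit (P u)) (# R) μ (bit (nb C u)) kb (limit-C (K⊑F m) uz (K-off m)) (≤-reflexive (bit-false g))

      in-C : ∀ {q} → q ∈ C → q ∈ Q → k + 1 ≤ # R + μ → Adm k F P Q
      in-C q∈ b le = adm-run k 2 (# R + μ) (≤-trans (≤-reflexive (sym (+-assoc k 1 1))) (≤-trans (+-monoˡ-≤ 1 le) (≤-reflexive (+-comm (# R + μ) 1))))
        λ c l h → walk⇒AB b (walk-C q∈ c l h)

      -- The paths through `T` and `e` have the sizes 4 to |R| + μ + 1, and k < |R| + μ because `e`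
      -- is not next to `C`; so at most one size is lacking. A neighbour of `y` in `T` supplies size
      -- 3, one in `C` all sizes from 2 to |R| + μ. With neither, `RKind` holds or a third stuck
      -- vertex bounds `k` by |R|.
      at-T : Misses K (nb C) → Meets K (nb T) → 2 ≤ # T → Result
      at-T gC m T≥2 with peel solved piece (source-T piece gC m T≥2) z∈K
      ... | inj₁ r = inj₁ r
      ... | inj₂ t with e t Fin.≟ z
      ... | yes eq = settle (stuck-plain t eq)
      ... | no ne = after (follow solved piece t z∈K ne (source-RX J z∈J (gC ∘ ∖ˡ) missT))
        where
        ε = e t
        J : Piece (K ∖ ε) (N ε)
        J = tail piece t z∈K ne
        z∈J : z ∈ K ∖ ε
        z∈J = ∖⁺ z∈K (ne ∘ sym)
        missT : Misses (K ∖ ε) (nb T)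
        missT x a = ∖ʳ x (only-A t (∖ˡ x) a)
        μ≥2 : 2 ≤ μ
        μ≥2 = ⊓-glb T≥2 R≥2
        via-e : ∀ c → 4 ≤ c → c ≤ suc (# R + μ) → AB F P Q c
        via-e (suc c) (s≤s l) (s≤s h) = AB-via (reach-T (e∈A t) T≥2 c l h) (K⊑F (e∈K t)) (K-off (e∈K t)) (e∈B t)
        after : ∀ {A} → Adm k F P Q ⊎ (Stuck (K ∖ ε) A (N ε) × k ≤ dg H ε + bit (P ε) + 1) → Result
        after (inj₁ r) = inj₁ r
        after (inj₂ (t′ , kb)) with find (F ∩ Q ∩ T) | find (F ∩ Q ∩ C)
        ... | _ | inj₂ (q , q∈) = inj₁ (in-C (∩ʳ {S = F ∩ Q} q∈) (∩ʳ {S = F} (∩ˡ q∈)) (small-deg (e∈K t) ne (gC (e∈K t)) kb))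
        ... | inj₂ (q , q∈) | _ = inj₁ (adm-run k 3 (suc (# R + μ)) (≤-trans (≤-reflexive (sym (+-assoc k 1 2)))
                (≤-trans (+-monoˡ-≤ 2 (small-deg (e∈K t) ne (gC (e∈K t)) kb)) (≤-reflexive (+-comm (# R + μ) 2)))) go)
          where
          go : ∀ c → 3 ≤ c → c ≤ suc (# R + μ) → AB F P Q c
          go c l h with c ≤? # R + μ
          ... | yes x = walk⇒AB (∩ʳ {S = F} (∩ˡ q∈)) (walk-T (∩ʳ {S = F ∩ Q} q∈) T≥2 c l (≤-trans x (+-monoʳ-≤ (# R) μ≤T))
                          (≤-trans x (≤-trans (+-monoʳ-≤ (# R) μ≤R) (n≤1+n _))))
          ... | no x = via-e c (≤-trans (s≤s (lin 2 (λ r m → κ 2 ≼ r ⇛ κ 2 ≼ m ⇛ ⊢ κ 3 ≼ r ⊕ m) refl (# R) μ R≥2 μ≥2)) (≰⇒> x)) h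
        ... | inj₁ noT | inj₁ noC with e t′ Fin.≟ z
        ... | yes eq = inj₂ (inj₂ record { e = ε ; toR = toR ; small = count-R le toR
                                         ; tiny = λ _ → subst (ε ~_) eq (e∈B t′) , K-off z∈K , missT z∈J })
          where
          toR : ∀ {q} → q ∈ F → q ∈ Q → q ≢ ε → q ∈ R
          toR f b n = [ (λ x → ⊥-elim (noT _ (∩⁺ (∩⁺ f b) x))) , id ]′ (∪⁻ (in-core t f b n))
          le : # R ≤ # T
          le = let (q , f , b , _ , n) = twoQ ε in R≤T (toR f b n) λ c → noC q (∩⁺ (∩⁺ f b) c)
        ... | no ne′ with follow solved J t′ z∈J ne′ (source-RX (tail J t′ z∈J ne′) (∖⁺ z∈J (ne′ ∘ sym)) (gC ∘ ∖ˡ ∘ ∖ˡ) (missT ∘ ∖ˡ))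
        ... | inj₁ r = inj₁ r
        ... | inj₂ (_ , kb′) = inj₁ (adm-run k 4 (suc (# R + μ)) (lin 5 (λ k d p r m → k ≼ d ⊕ p ⊕ κ 1 ⇛ d ⊕ p ⊕ κ 1 ≼ r ⇛ κ 2 ≼ m ⇛ ⊢ k ⊕ κ 4 ≼ κ 2 ⊕ (r ⊕ m)) refl
                k (dg H (e t′)) (bit (P (e t′))) (# R) μ kb′ (limit-R (gC (∖ˡ (e∈K t′))) (missT (e∈K t′))) μ≥2) via-e)

      -- `K` sees only the single vertex `h` of `T`. Two lengths from `x` to `h` through the
      -- component `D` of the clique make `h` a source; if `x` has no neighbour in `D`, then `D` is
      -- entered from `h` instead.
      at-h : Misses K (nb C) → Meets K (nb T) → ¬ (2 ≤ # T) → Result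
      at-h gC m T<2 = cases (k ≤? 2) (find (F ∩ Q ∩ C))
        where
        open Lone (proj₁ t₀) (proj₂ t₀) T<2
        h : V
        h = proj₁ t₀
        h∈T : h ∈ T
        h∈T = proj₂ t₀
        noK′ : ∀ {c} → c ∈ C → dg K c ≤ 0
        noK′ c∈ = dg-zero λ a w∈ → gC w∈ (∈nb (~-sym a) c∈)
        enough : k ≤ 2 → k + 1 ≤ # R + μ
        enough k≤ = lin 3 (λ k r m → k ≼ κ 2 ⇛ κ 2 ≼ r ⇛ κ 1 ≼ m ⇛ ⊢ k ⊕ κ 1 ≼ r ⊕ m) refl k (# R) μ k≤ R≥2 μ≥1
        c₀∈D : proj₁ c₀ ∈ D
        c₀∈D = Comp.base comp-C
        -- An edge from the clique to `y` costs a degree in `D`, affordable for k ≥ 3 only; for k =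
        -- 2 such an edge gives the paths directly.
        large : (∀ {c} → c ∈ C → c ∈ Q → 3 ≤ k) → Result
        large guard = go (meets? D P)
          where
          room : ∀ {c} → c ∈ C → 3 + (dg K c + bit (Q c)) ≤ k + 1
          room {c} c∈ with c ∈? Q
          ... | no q = lin 3 (λ k d q → κ 2 ≼ k ⇛ d ≼ κ 0 ⇛ q ≼ κ 0 ⇛ ⊢ κ 3 ⊕ (d ⊕ q) ≼ k ⊕ κ 1) refl
                k (dg K c) (bit (Q c)) k≥2 (noK′ c∈) (≤-reflexive (bit-false q))
          ... | yes q = lin 3 (λ k d q → κ 3 ≼ k ⇛ d ≼ κ 0 ⇛ q ≼ κ 1 ⇛ ⊢ κ 3 ⊕ (d ⊕ q) ≼ k ⊕ κ 1) refl
                k (dg K c) (bit (Q c)) (guard c∈ q) (noK′ c∈) (bit≤1 (Q c))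
          onB : Misses D P → ∀ {E u} → Closed D E → u ∈ E → Meets E Q
          onB noP {E} c x with rgX rg h (record { sub = λ y → ∖⁺ (D⊑F (sub c y)) (λ { refl → h∉D (sub c y) }) ; cl = reopen }) x
            where
            reopen : ∀ {u v} → u ∈ E → v ∈ F ∖ h → u ~ v → v ∈ E
            reopen {v = v} y f a with v ∈? K
            ... | yes v∈ = ⊥-elim (gC v∈ (∈nb (~-sym a) (touchC (sub c y) (inj₂ (v , v∈ , a)))))
            ... | no v∉  = cl c y (cl cD (sub c y) (─⁺ (─⁺ (∖ˡ f) v∉) (λ s → ∖ʳ f (｛｝∈ s))) a) a
          ... | v , a , b with ∪⁻ {S = P} b
          ... | inj₂ q = v , a , q
          ... | inj₁ p = ⊥-elim (noP (sub c a) p)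
          go : Meets D P ⊎ Misses D P → Result
          go (inj₂ noP) = inj₁ (from-h {L′ = ∅} {0} (⊥-elim ∘ ∉∅) ∉∅ (λ _ → ∉∅) (λ _ q → inj₁ (refl , q))
            (blocked Q z noP (onB noP) (λ {u} d _ → lin 2 (λ x y → x ≼ κ 0 ⇛ ⊢ x ⊕ y ≼ y) refl (dg K u) (bit (Q u))
                 (dg-zero λ a w∈ → gC w∈ (∈nb (~-sym a) (touchC d (inj₂ (_ , w∈ , a))))))
              (proj₁ c₀ , c₀∈D , λ eq → D-off c₀∈D (subst (_∈ K) (sym eq) z∈K))))
          go (inj₁ mP) = stuck (peel solved piece (hub-source piece D (only-h gC) (let (v , a , b) = m in v , a , nbT⇒N b)
                                  D⊑F D-off (λ _ → L-∅) h∉D (lengths room mP)) z∈K)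
            where
            after : (t : Stuck K (N h) Q) → k ≤ dg H (e t) + bit (P (e t)) + 1 → Adm k F P Q
            after t kb = let (q , f , b , _ , n) = twoQ (e t) in
              [ (λ y → two-short k≤2 (AB₁ f (T⊑P y) b) (AB₂ f (K⊑F (e∈K t)) (subst (_~ e t) (sym (h! y)) (e∈A t)) (T⊑P y) (e∈B t)))
              , (λ y → in-C (R⊑C y) b (enough k≤2)) ]′ (∪⁻ {S = T} (in-core t f b n))
              where
              k≤2 : k ≤ 2
              k≤2 = lin 4 (λ k d p i → k ≼ d ⊕ p ⊕ κ 1 ⇛ d ≼ i ⇛ i ≼ κ 1 ⇛ p ≼ κ 0 ⇛ ⊢ k ≼ κ 2) refl k (dg H (e t)) (bit (P (e t))) (bit (N h (e t))) kb
                (dg-hub (only-h gC) (e∈K t)) (bit≤1 (N h (e t))) (≤-reflexive (bit-false λ p → apart (K⊑F (e∈K t)) p (e∈A t)))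
            stuck : Adm k F P Q ⊎ Stuck K (N h) Q → Result
            stuck (inj₁ r) = inj₁ r
            stuck (inj₂ t) with e t Fin.≟ z
            ... | yes eq = settle (stuck-plain t eq)
            ... | no ne = inj₁ ([ id , (λ (_ , kb) → after t kb) ]′ (follow solved piece t z∈K ne
                    (source-RX (tail piece t z∈K ne) (∖⁺ z∈K (ne ∘ sym)) (gC ∘ ∖ˡ) λ x a → ∖ʳ x (only-A t (∖ˡ x) (nbT⇒N a)))))
        cases : Dec (k ≤ 2) → (∀ u → u ∉ F ∩ Q ∩ C) ⊎ (∃[ u ] u ∈ F ∩ Q ∩ C) → Result
        cases (yes k≤) (inj₂ (q , q∈)) = inj₁ (in-C (∩ʳ {S = F ∩ Q} q∈) (∩ʳ {S = F} (∩ˡ q∈)) (enough k≤))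
        cases (yes _) (inj₁ none) = large λ c q → ⊥-elim (none _ (∩⁺ (∩⁺ (R⊑F (C⊑R c)) q) c))
        cases (no k≰) _ = large λ _ _ → ≰⇒> k≰

      at-R : Misses K (nb C) → Misses K (nb T) → Meets K (nb R) → Result
      at-R gC gT m with peel solved piece (source-R piece gC gT m) z∈K
      ... | inj₁ r = inj₁ r
      ... | inj₂ t with e t Fin.≟ z
      ... | yes eq = settle (stuck-plain t eq)
      ... | no ne with follow solved piece t z∈K ne (source-RX (tail piece t z∈K ne) (∖⁺ z∈K (ne ∘ sym)) (gC ∘ ∖ˡ) (gT ∘ ∖ˡ))
      ... | inj₁ r = inj₁ r
      ... | inj₂ (_ , kb) = inj₁ (3 , 2 , inj₂ refl , λ i l →
              AB-via (reach-R (e∈A t) i (≤-trans l (≤-trans k≤ (⊓-glb R≤ ≤-refl)))) (K⊑F (e∈K t)) (K-off (e∈K t)) (e∈B t))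
        where
        k≤ : k ≤ # R
        k≤ = ≤-trans kb (limit-R (gC (e∈K t)) (gT (e∈K t)))
        R≤ : # R ≤ # T
        R≤ = let (r , a , r∈) = nb∈ (e∈A t) in R≤T r∈ (λ c → gC (e∈K t) (∈nb a c))

      at-x : Misses K (nb T) → Misses K (nb R) → Result
      at-x g g′ with peel solved piece (x-source (L piece) (attached piece base∈ (off-H g g′)) (off-H g g′)) z∈K
      ... | inj₁ r = inj₁ r
      ... | inj₂ t with e t Fin.≟ z
      ... | yes eq = settle (stuck-plain t eq)
      ... | no ne = let (v , v∈ , a) = attached (tail piece t z∈K ne) (∖⁺ z∈K (ne ∘ sym)) (off-H g g′ ∘ ∖ˡ) in
                    ⊥-elim (∖ʳ v∈ (only-A t (∖ˡ v∈) a))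

      result : Result
      result with meets? K (nb C) | meets? K (nb T) | meets? K (nb R) | 2 ≤? # T
      ... | inj₁ m | _      | _      | _      = at-C m
      ... | inj₂ g | inj₁ m | _      | yes T≥2 = at-T g m T≥2
      ... | inj₂ g | inj₁ m | _      | no T<2 = at-h g m T<2
      ... | inj₂ g | inj₂ h | inj₁ m | _      = at-R g h m
      ... | inj₂ _ | inj₂ h | inj₂ g | _      = at-x h g

    opaque
      conclude : TwoQ → Adm k F P Q ⊎ TKind T ⊎ RKind H T R
      conclude twoQ with region solved
      ... | inj₁ r = inj₁ r
      ... | inj₂ (inj₁ h) = inj₂ (kinds twoQ λ f b _ → plain (λ m → h m) f b)
      ... | inj₂ (inj₂ R₀) = Conclude.result R₀ twoQ

-- Choice of the cores.

module Growth {n : ℕ} (G : Graph n) where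

  open Walks G
  open Rooted G
  open Start G
  open Families G

  opaque
    saturate : ∀ {X Done : Sub n → Set} (F : Sub n) → (∀ {S} → X S → S ⊑ F) →
               (∀ S → X S → Done S ⊎ (∃[ u ] u ∈ F × u ∉ S × X (S ∪ ｛ u ｝))) → ∀ S → X S → ∃[ S′ ] (X S′ × Done S′)
    saturate {X} {Done} F inF step S x = go (# F) S x (m≤n+m (# F) (# S))
      where
      go : ∀ m S → X S → # F ≤ # S + m → ∃[ S′ ] (X S′ × Done S′)
      go m S x h with step S x
      ... | inj₁ d = S , x , d
      go zero S x h | inj₂ (u , f , g , y) = ⊥-elim (<⇒≱ (#-strict (inF x) f g) (≤-trans h (≤-reflexive (+-identityʳ (# S)))))
      go (suc m) S x h | inj₂ (u , f , g , y) = go m (S ∪ ｛ u ｝) y (≤-trans h (≤-trans (≤-reflexive (+-suc (# S) m))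
                                                 (+-monoˡ-≤ m (#-strict ∪ˡ (∪ʳ {S = S} ∈｛｝) g))))

  insert : ∀ {S R : Sub n} {u} → S ⊑ R → u ∈ R → S ∪ ｛ u ｝ ⊑ R
  insert {S} {R} i m y = [ i , (λ s → subst (_∈ R) (sym (｛｝∈ s)) m) ]′ (∪⁻ {S = S} y)

  all-of : (S : Sub n) (u : V) → (∀ {r} → r ∈ S → u ~ r) ⊎ (∃[ r ] r ∈ S × r ∉ N u)
  all-of S u with find (S ─ N u)
  ... | inj₂ (r , m) = inj₂ (r , ─ˡ m , ─ʳ {S = S} m)
  ... | inj₁ h = inj₁ λ {r} r∈ → near-r r∈ (r ∈? N u)
    where
    near-r : ∀ {r} → r ∈ S → Dec (r ∈ N u) → u ~ r
    near-r _ (yes y) = y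
    near-r r∈ (no y) = ⊥-elim (h _ (─⁺ r∈ y))

  clique-add : ∀ {S u} → Clique S → (∀ {r} → r ∈ S → u ~ r) → Clique (S ∪ ｛ u ｝)
  clique-add {S} c h {a} {b} x y ne with ∪⁻ {S = S} x | ∪⁻ {S = S} y
  ... | inj₁ x′ | inj₁ y′ = c x′ y′ ne
  ... | inj₁ x′ | inj₂ y′ = ~-sym (subst (_~ a) (sym (｛｝∈ y′)) (h x′))
  ... | inj₂ x′ | inj₁ y′ = subst (_~ b) (sym (｛｝∈ x′)) (h y′)
  ... | inj₂ x′ | inj₂ y′ = ⊥-elim (ne (trans (｛｝∈ x′) (sym (｛｝∈ y′))))

  pair-clique : ∀ {u v} → u ~ v → Clique (｛ u ｝ ∪ ｛ v ｝)
  pair-clique {u} {v} e = clique-add {｛ u ｝} (λ x y ne → ⊥-elim (ne (trans (｛｝∈ x) (sym (｛｝∈ y))))) λ r → ~-sym (subst (_~ v) (sym (｛｝∈ r)) e)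

  pair-size : ∀ {u v} → u ~ v → 2 ≤ # (｛ u ｝ ∪ ｛ v ｝)
  pair-size {u} {v} e = ≤-trans (≤-reflexive (sym (cong₂ _+_ (#｛｝ u) (#｛｝ v))))
    (#-disjoint {R = ｛ u ｝} {｛ v ｝} ∪ˡ (∪ʳ {S = ｛ u ｝}) λ x y → ~⇒≢ e (trans (sym (｛｝∈ x)) (｛｝∈ y)))

  adjacent? : ∀ S → (∃[ u ] ∃[ v ] u ∈ S × v ∈ S × u ~ v) ⊎ (∀ {u v} → u ∈ S → v ∈ S → u ∉ N v)
  adjacent? S with search each
    where
    each : ∀ u → (u ∈ S → ∀ {v} → v ∈ S → u ∉ N v) ⊎ (∃[ v ] u ∈ S × v ∈ S × u ~ v)
    each u with u ∈? S | meets? S (N u)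
    ... | no h  | _ = inj₁ λ s → ⊥-elim (h s)
    ... | yes s | inj₁ (v , v∈ , e) = inj₂ (v , s , v∈ , e)
    ... | yes s | inj₂ h = inj₁ λ _ v∈ e → h v∈ (~-sym e)
  ... | inj₁ f = inj₂ λ {u} s → f u s
  ... | inj₂ w = inj₁ w

  module Cliques (F P : Sub n) where

    IsClique Maximal : Sub n → Set
    IsClique T = (T ⊑ F) × (T ⊑ P) × Clique T × 2 ≤ # T
    Maximal T = ∀ {u} → u ∈ F → u ∈ P → u ∉ T → ∃[ t ] t ∈ T × t ∉ N u

    opaque
      max-clique : ∀ {u v} → u ∈ F ∩ P → v ∈ F ∩ P → u ~ v → ∃[ T ] (IsClique T × Maximal T)
      max-clique {u} {v} u∈ v∈ e = saturate {IsClique} {Maximal} F proj₁ step (｛ u ｝ ∪ ｛ v ｝)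
        (insert (λ s → subst (_∈ F) (sym (｛｝∈ s)) (∩ˡ u∈)) (∩ˡ v∈) , insert (λ s → subst (_∈ P) (sym (｛｝∈ s)) (∩ʳ {S = F} u∈)) (∩ʳ {S = F} v∈)
        , pair-clique e , pair-size e)
        where
        step : ∀ S → IsClique S → Maximal S ⊎ (∃[ u ] u ∈ F × u ∉ S × IsClique (S ∪ ｛ u ｝))
        step S (i , j , c , s) with search each
          where
          each : ∀ u → (u ∈ F → u ∈ P → u ∉ S → ∃[ t ] t ∈ S × t ∉ N u) ⊎ (u ∈ F × u ∈ P × u ∉ S × (∀ {r} → r ∈ S → u ~ r))
          each u with u ∈? F | u ∈? P | u ∈? S | all-of S u
          ... | no h | _ | _ | _ = inj₁ λ f → ⊥-elim (h f)
          ... | _ | no h | _ | _ = inj₁ λ _ p → ⊥-elim (h p)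
          ... | _ | _ | yes m | _ = inj₁ λ _ _ h → ⊥-elim (h m)
          ... | yes f | yes p | no h | inj₁ a = inj₂ (f , p , h , a)
          ... | _ | _ | _ | inj₂ w = inj₁ λ _ _ _ → w
        ... | inj₁ f = inj₁ λ {u} → f u
        ... | inj₂ (u , f , p , h , a) = inj₂ (u , f , h , insert i f , insert j p , clique-add c a , ≤-trans s (#-mono {S = S} {S ∪ ｛ u ｝} ∪ˡ))

    -- The side `T` is not chosen but determined by `R`, so that `common` holds by construction.
    com : Sub n → Sub n
    com R = (F ∩ P) ∩ set complete?
      where
      complete? : ∀ t → Dec (∀ {r} → r ∈ R → t ~ r)
      complete? t with all-of R t
      ... | inj₁ h = yes h
      ... | inj₂ (r , r∈ , g) = no λ h → g (h r∈)

    com-F : ∀ {R} → com R ⊑ F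
    com-F m = ∩ˡ (∩ˡ m)

    com-P : ∀ {R} → com R ⊑ P
    com-P m = ∩ʳ {S = F} (∩ˡ m)

    com-~ : ∀ {R} → Complete (com R) R
    com-~ {R} m = set∈ _ (∩ʳ {S = F ∩ P} m)

    ∈com : ∀ {R t} → t ∈ F → t ∈ P → (∀ {r} → r ∈ R → t ~ r) → t ∈ com R
    ∈com f p h = ∩⁺ (∩⁺ f p) (∈set _ h)

    com-anti : ∀ {R R′} → R ⊑ R′ → com R′ ⊑ com R
    com-anti i m = ∈com (com-F m) (com-P m) (com-~ m ∘ i)

    Grown Full : ℕ → Sub n → Sub n → Set
    Grown c R₀ R = R ⊑ F × (R₀ ⊑ R) × (R ⊑ R₀ ⊎ # R + c ≤ # (com R)) × 1 ≤ # (com R)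
    Full c _ R = ∀ {u} → u ∈ F → u ∉ R → dg (com R) u ≤ # R + c

    opaque
      -- A vertex with more than |R| + c neighbours in `com R` can be added: these stay common
      -- neighbours, and there are at least |R| + c + 1 of them. With `c = 1` this makes `T` larger
      -- than `R`; with a clique in the core `c = 0` is enough.
      grow : ∀ c R₀ → R₀ ⊑ F → 1 ≤ # (com R₀) → ∃[ R ] (Grown c R₀ R × Full c R₀ R)
      grow c R₀ i h = saturate {Grown c R₀} {Full c R₀} F proj₁ step R₀ (i , id , inj₁ id , h)
        where
        step : ∀ R → Grown c R₀ R → Full c R₀ R ⊎ (∃[ u ] u ∈ F × u ∉ R × Grown c R₀ (R ∪ ｛ u ｝))
        step R (i , j , s , h) with search each
          where
          each : ∀ u → (u ∈ F → u ∉ R → dg (com R) u ≤ # R + c) ⊎ (u ∈ F × u ∉ R × suc (# R + c) ≤ dg (com R) u)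
          each u with u ∈? F | u ∈? R | dg (com R) u ≤? # R + c
          ... | no g | _ | _ = inj₁ λ f → ⊥-elim (g f)
          ... | _ | yes m | _ = inj₁ λ _ g → ⊥-elim (g m)
          ... | _ | _ | yes l = inj₁ λ _ _ → l
          ... | yes f | no g | no l = inj₂ (f , g , ≰⇒> l)
        ... | inj₁ f = inj₁ λ {u} → f u
        ... | inj₂ (u , f , g , l) = inj₂ (u , f , g , insert i f , ∪ˡ ∘ j , inj₂ (≤-trans size more) , ≤-trans (s≤s z≤n) (≤-trans l more′))
          where
          more′ : dg (com R) u ≤ # (com (R ∪ ｛ u ｝))
          more′ = #-mono {S = N u ∩ com R} λ m → ∈com (com-F (∩ʳ {S = N u} m)) (com-P (∩ʳ {S = N u} m))
            λ {r} r∈ → [ com-~ (∩ʳ {S = N u} m) , (λ s → subst (_ ~_) (sym (｛｝∈ s)) (~-sym (∩ˡ m))) ]′ (∪⁻ {S = R} r∈)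
          more : suc (# R + c) ≤ # (com (R ∪ ｛ u ｝))
          more = ≤-trans l more′
          size : # (R ∪ ｛ u ｝) + c ≤ suc (# R + c)
          size = +-monoˡ-≤ c (≤-trans (#-cover {R = R} {｛ u ｝} (∪⁻ {S = R})) (≤-reflexive (trans (cong (# R +_) (#｛｝ u)) (+-comm (# R) 1))))

    Seed Locked : Sub n → Set
    Seed C = (C ⊑ F) × Clique C × 2 ≤ # C × 1 ≤ # (com C)
    Locked C = ∀ {u} → u ∈ F → u ∉ C → u ∈ nb (com C) → ∃[ c ] c ∈ C × c ∉ N u

    opaque
      -- A clique maximal among those with a common neighbour next to `x`. `Locked` speaks of all
      -- such common neighbours, so it persists for the fewer that are left when `R` grows from `C`.
      seed : ∀ {t u v} → t ∈ F ∩ P → u ∈ F → v ∈ F → t ~ u → t ~ v → u ~ v → ∃[ C ] (Seed C × Locked C)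
      seed {t} {u} {v} t∈ u∈ v∈ tu tv uv = saturate {Seed} {Locked} F proj₁ step (｛ u ｝ ∪ ｛ v ｝)
        (insert (λ s → subst (_∈ F) (sym (｛｝∈ s)) u∈) v∈ , pair-clique uv , pair-size uv
        , #-member (∈com (∩ˡ t∈) (∩ʳ {S = F} t∈) (insert (λ s → subst (t ~_) (sym (｛｝∈ s)) tu) tv)))
        where
        step : ∀ S → Seed S → Locked S ⊎ (∃[ u ] u ∈ F × u ∉ S × Seed (S ∪ ｛ u ｝))
        step S (i , c , s , h) with search each
          where
          each : ∀ u → (u ∈ F → u ∉ S → u ∈ nb (com S) → ∃[ c ] c ∈ S × c ∉ N u) ⊎
                       (u ∈ F × u ∉ S × u ∈ nb (com S) × (∀ {r} → r ∈ S → u ~ r))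
          each u with u ∈? F | u ∈? S | u ∈? nb (com S) | all-of S u
          ... | no g | _ | _ | _ = inj₁ λ f → ⊥-elim (g f)
          ... | _ | yes m | _ | _ = inj₁ λ _ g → ⊥-elim (g m)
          ... | _ | _ | no g | _ = inj₁ λ _ _ m → ⊥-elim (g m)
          ... | _ | _ | _ | inj₂ w = inj₁ λ _ _ _ → w
          ... | yes f | no g | yes m | inj₁ a = inj₂ (f , g , m , a)
        ... | inj₁ f = inj₁ λ {u} → f u
        ... | inj₂ (u , f , g , m , a) = let (w , e , w∈) = nb∈ m in
          inj₂ (u , f , g , insert i f , clique-add c a , ≤-trans s (#-mono {S = S} {S ∪ ｛ u ｝} ∪ˡ)
               , #-member (∈com (com-F w∈) (com-P w∈) (insert (com-~ w∈) (~-sym e))))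

-- Paths whose last step is from a common neighbour `q` to `y`.

module Common {n : ℕ} (G : Graph n) where

  open Walks G
  open Rooted G
  open Start G
  open Families G
  open Cores G

  -- x and y have the same neighbours apart from z, and q is one of them.  All other
  -- ones are put in a core H, and paths from x to y are sought that end with q.
  module Shared (I : Problem) {q : V} (q∈F : q ∈ Problem.F I) (q∈P : q ∈ Problem.P I) (q∈Q : q ∈ Problem.Q I) (q≢z : q ≢ Problem.z I) where

    open Problem I

    open Whole I public

    E : Sub n
    E = F ∖ q

    module Core (H : Sub n) (H⊑E : H ⊑ E) (cover : ∀ {u} → u ∈ E → u ≢ z → u ∈ P ⊎ u ∈ Q → u ∈ H) where

      O : Sub n
      O = P ∪ nb H ∪ Q

      open Launch I H O E ∖ˡ public

      S : Sub n
      S = E ─ H ─ ｛ q ｝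

      S⊑E : S ⊑ E
      S⊑E = ─ˡ ∘ ─ˡ

      S-off : ∀ {u} → u ∈ S → u ∉ H
      S-off m = ─ʳ {S = E} (─ˡ m)

      ∈S : ∀ {u} → u ∈ E → u ∉ H → u ∈ S
      ∈S m h = ─⁺ (─⁺ m h) (λ s → ∖ʳ m (｛｝∈ s))

      plain : ∀ {u} → u ∈ E → u ∉ H → u ≢ z → u ∉ P × u ∉ Q
      plain m h ne = (λ p → h (cover m ne (inj₁ p))) , (λ p → h (cover m ne (inj₂ p)))

      to-O : ∀ {C : Sub n} → Meets C (P ∪ Q) → Meets C O
      to-O (v , a , b) = v , a , [ (λ p → ∪ˡ (∪ˡ p)) , ∪ʳ {S = P ∪ nb H} ]′ (∪⁻ {S = P} b)

      put-back : ∀ {C} → Closed S C → Misses C (nb H) → Closed E C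
      put-back {C} c g = record { sub = S⊑E ∘ sub c ; cl = go }
        where
        go : ∀ {u v} → u ∈ C → v ∈ E → u ~ v → v ∈ C
        go {v = v} m f e with v ∈? H
        ... | yes h = ⊥-elim (g m (∈nb e h))
        ... | no h  = cl c m (∈S f h) e

      meetsO : ∀ {C u} → Closed S C → u ∈ C → Meets C O
      meetsO {C} c m with meets? C (nb H)
      ... | inj₁ (v , a , b) = v , a , ∪ˡ (∪ʳ {S = P} b)
      ... | inj₂ g = to-O (rgX rg q (put-back c g) m)

      meetsBO : ∀ w {C u} → Closed (S ∖ w) C → u ∈ C → Meets C (N q ∪ O)
      meetsBO w {C} c m with meets? C (N q) | meets? C (nb H)
      ... | inj₁ (v , a , b) | _ = v , a , ∪ˡ b
      ... | inj₂ _ | inj₁ (v , a , b) = v , a , ∪ʳ {S = N q} (∪ˡ (∪ʳ {S = P} b))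
      ... | inj₂ g | inj₂ g′ with to-O (rgX rg w (record { sub = λ x → ∖⁺ (∖ˡ (S⊑E (∖ˡ (sub c x)))) (∖ʳ (sub c x)) ; cl = go }) m)
        where
        go : ∀ {u v} → u ∈ C → v ∈ F ∖ w → u ~ v → v ∈ C
        go {v = v} x f e with v Fin.≟ q | v ∈? H
        ... | yes refl | _ = ⊥-elim (g x (~-sym e))
        ... | no _  | yes h = ⊥-elim (g′ x (∈nb e h))
        ... | no ne | no h  = cl c x (∖⁺ (∈S (∖⁺ (∖ˡ f) ne) h) (∖ʳ f)) e
      ... | v , a , b = v , a , ∪ʳ {S = N q} b

      degs : ∀ {u} → u ∈ S → u ≢ z → k + 1 ≤ dg S u + dg H u + bit (P u) + bit (N q u)
      degs {u} m ne = lin 9 (λ k f p b s h hq i x → k ⊕ κ 1 ≼ f ⊕ p ⊕ b ⇛ b ≼ κ 0 ⇛ f ≼ s ⊕ hq ⇛ hq ≼ h ⊕ x ⇛ x ≼ i ⇛ ⊢ k ⊕ κ 1 ≼ s ⊕ h ⊕ p ⊕ i) refl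
        k (dg F u) (bit (P u)) (bit (Q u)) (dg S u) (dg H u) (dg (H ∪ ｛ q ｝) u) (bit (N q u)) (dg ｛ q ｝ u)
        (degF (∖ˡ (S⊑E m)) ne) (≤-reflexive (bit-false (proj₂ (plain (S⊑E m) (S-off m) ne))))
        (dg-cover {F} {S} {H ∪ ｛ q ｝} λ {w} _ f → part w f) (dg-cover {H ∪ ｛ q ｝} {H} {｛ q ｝} λ _ → ∪⁻) (dg-one {｛ q ｝} q λ _ → ｛｝∈)
        where
        part : ∀ w → w ∈ F → w ∈ S ⊎ w ∈ H ∪ ｛ q ｝
        part w f with w ∈? (H ∪ ｛ q ｝)
        ... | yes y = inj₂ y
        ... | no y  = inj₁ (─⁺ (─⁺ (∖⁺ f λ { refl → y (∪ʳ {S = H} ∈｛｝) }) (y ∘ ∪ˡ)) (y ∘ ∪ʳ {S = H}))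

      open Depart (N q) ｛ q ｝ 1 (λ m → subst (_∈ F) (sym (｛｝∈ m)) q∈F) (λ h s → ∖ʳ (H⊑E h) (｛｝∈ s)) (λ e → Pre-single q∈Q e)
                  (q , q∈F , λ m → ∖ʳ (S⊑E m) refl) meetsO meetsBO degs using (region)

      Sees : Sub n → Set
      Sees C = Meets C (nb H)

      -- With `A` inside `nb H`, a vertex where a piece gets stuck is next to the core, as `hung`
      -- records.
      Supply : Set
      Supply = ∀ {K B} (p : Piece K B) → Sees K → ∃[ s ] (Source.A {K} {L p} s ⊑ nb H)

      -- Outside the core `q` has no neighbour or just `e`. Either way its degree bounds `k` by the
      -- number of its neighbours in the core, plus 1 or 2.
      data Outcome : Set where
        done : Adm k F P Q → Outcome
        free : Misses S (N q) → Outcome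
        hung : ∀ e → e ∈ S → q ~ e → (∀ {u} → u ∈ S → q ~ u → u ≡ e) → e ∈ nb H ⊎ (e ≡ z × e ∈ P ∪ Q) → Outcome

      sees : ∀ {K B} (p : Piece K B) → z ∉ K → (∃[ v ] v ∈ K) → Sees K
      sees {K} p z∉ (v , m) with toO p whole-set m
      ... | w , w∈ , o with ∪⁻ {S = P ∪ nb H} o
      ... | inj₂ x = ⊥-elim (offH p w∈ (cover (inS p w∈) (λ { refl → z∉ w∈ }) (inj₂ x)))
      ... | inj₁ o′ with ∪⁻ {S = P} o′
      ... | inj₁ x = ⊥-elim (offH p w∈ (cover (inS p w∈) (λ { refl → z∉ w∈ }) (inj₁ x)))
      ... | inj₂ x = w , w∈ , x

      solves : Supply → Solved
      solves supply = zfree λ { p z∉ v _ → inj₁ (proj₁ (supply p (sees p z∉ v))) }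

      opaque
        outcome : Supply → Outcome
        outcome supply with region (solves supply)
        ... | inj₁ r = done r
        ... | inj₂ (inj₁ h) = free h
        ... | inj₂ (inj₂ R) = at (meets? K (nb H))
          where
          open Region R
          K⊑E : K ⊑ E
          K⊑E = S⊑E ∘ sub shut
          K-off : ∀ {u} → u ∈ K → u ∉ H
          K-off = S-off ∘ sub shut
          stuck : ∀ {A} → A ⊑ nb H → Adm k F P Q ⊎ Stuck K A (N q) → Outcome
          stuck i (inj₁ r) = done r
          stuck i (inj₂ t) = hung (e t) (sub shut (e∈K t)) (e∈B t) (λ m a → only-B t (all m a) a) (inj₁ (i (e∈A t)))
          z∈PQ : Misses K (nb H) → z ∈ P ∪ Q
          z∈PQ g with rgX rg q (put-back shut g) z∈K
          ... | v , v∈ , b with v Fin.≟ z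
          ... | yes refl = b
          ... | no ne = let (a , c) = plain (K⊑E v∈) (K-off v∈) ne in ⊥-elim ([ a , c ]′ (∪⁻ {S = P} b))
          at : Meets K (nb H) ⊎ Misses K (nb H) → Outcome
          at (inj₁ m) = let (s , i) = supply piece m in stuck i (peel (solves supply) piece s z∈K)
          at (inj₂ g) with find (K ∖ z)
          ... | inj₁ none = hung z (sub shut z∈K) q~z (λ m a → isz (all m a)) (inj₂ (refl , z∈PQ g))
            where
            isz : ∀ {u} → u ∈ K → u ≡ z
            isz {u} m with u Fin.≟ z
            ... | yes eq = eq
            ... | no ne  = ⊥-elim (none u (∖⁺ m ne))
            q~z : q ~ z
            q~z = let (w , w∈ , a) = toB piece whole-set base∈ in subst (q ~_) (isz w∈) a
          -- `K ∖ z` contains no neighbour of `H`, `x` or `y`. So it hangs on `z` and `q`, of which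
          -- `z` is adjacent to one root and `q` to both.
          ... | inj₂ (v , v∈) = done ([ (λ p → Adm-z p) , (λ b → z-Adm b) ]′ (∪⁻ {S = P} (z∈PQ g)))
            where
            q∉ : q ∉ K ∖ z
            q∉ m = ∖ʳ (K⊑E (∖ˡ m)) refl
            ways : ∀ {u w} → u ∈ K ∖ z → w ∈ F → u ~ w → w ∈ K ∖ z ⊎ w ≡ z ⊎ w ≡ q
            ways {w = w} m f a with w Fin.≟ z | w Fin.≟ q
            ... | yes eq | _ = inj₂ (inj₁ eq)
            ... | no _ | yes eq = inj₂ (inj₂ eq)
            ... | no a₁ | no a₂ = inj₁ (∖⁺ (cl (put-back shut g) (∖ˡ m) (∖⁺ f a₂) a) a₁)
            noPQ : Misses (K ∖ z) (P ∪ Q)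
            noPQ m b = let (a , c) = plain (K⊑E (∖ˡ m)) (K-off (∖ˡ m)) (∖ʳ m) in [ a , c ]′ (∪⁻ {S = P} b)
            z∈F : z ∈ F
            z∈F = ∖ˡ (K⊑E z∈K)
            inF′ : K ∖ z ⊑ F
            inF′ m = ∖ˡ (K⊑E (∖ˡ m))
            hubs : Adm k (K ∖ z) (N z) (N q)
            hubs = two-hubs z∈F ∉∖ q∉ inF′ ways noPQ v∈ ∉∖
            Adm-z : z ∈ P → Adm k F P Q
            Adm-z p = extend p q∈Q z∈F q∈F (q≢z ∘ sym) ∉∖ q∉ inF′ hubs
            z-Adm : z ∈ Q → Adm k F P Q
            z-Adm b = extend q∈P b q∈F z∈F q≢z q∉ ∉∖ inF′ (Adm-rev hubs)

      AB-hung : ∀ {c e} → Pre P H c e → e ∈ S → e ~ q → AB F P Q (2 + c)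
      AB-hung {c} {e} pre m a = subst (AB F P Q) (trans (+-identityʳ (c + 2)) (+-comm c 2))
        (glue {X = H} {｛ e ｝ ∪ ｛ q ｝} {∅} {e = 0} (∖ˡ ∘ H⊑E) (λ y → [ at (∖ˡ (S⊑E m)) , at q∈F ]′ (∪⁻ {S = ｛ e ｝} y)) (⊥-elim ∘ ∉∅)
          (λ x y → [ (λ s → S-off m (subst (_∈ H) (｛｝∈ s) x)) , (λ s → ∖ʳ (H⊑E x) (｛｝∈ s)) ]′ (∪⁻ {S = ｛ e ｝} y))
          (λ _ → ∉∅) (λ _ → ∉∅) pre
          (cons (∪ˡ ∈｛｝) a (one (∖⁺ (∪ʳ {S = ｛ e ｝} ∈｛｝) λ eq → ~⇒≢ a (sym eq)))) (inj₁ (refl , q∈Q)))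
        where
        at : ∀ {a u} → a ∈ F → u ∈ ｛ a ｝ → u ∈ F
        at f s = subst (_∈ F) (sym (｛｝∈ s)) f

      k≤dgF : k ≤ dg F q + 1
      k≤dgF = lin 4 (λ k f p b → k ⊕ κ 1 ≼ f ⊕ p ⊕ b ⇛ p ≼ κ 1 ⇛ b ≼ κ 1 ⇛ ⊢ k ≼ f ⊕ κ 1) refl
        k (dg F q) (bit (P q)) (bit (Q q)) (degF q∈F q≢z) (bit≤1 (P q)) (bit≤1 (Q q))

      dg-q : dg F q ≤ dg S q + dg H q
      dg-q = dg-cover {F} {S} {H} λ {w} a f → part w a f
        where
        part : ∀ w → q ~ w → w ∈ F → w ∈ S ⊎ w ∈ H
        part w a f with w ∈? H
        ... | yes h = inj₂ h
        ... | no h  = inj₁ (∈S (∖⁺ f λ eq → ~⇒≢ a (sym eq)) h)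

      k-free : Misses S (N q) → k ≤ dg H q + 1
      k-free h = ≤-trans k≤dgF (+-monoˡ-≤ 1 (≤-trans dg-q (+-monoˡ-≤ (dg H q) (dg-zero λ a s → h s a))))

      k-hung : ∀ {e} → (∀ {u} → u ∈ S → q ~ u → u ≡ e) → k ≤ dg H q + 2
      k-hung {e} h = lin 4 (λ k f s d → k ≼ f ⊕ κ 1 ⇛ f ≼ s ⊕ d ⇛ s ≼ κ 1 ⇛ ⊢ k ≼ d ⊕ κ 2) refl
        k (dg F q) (dg S q) (dg H q) k≤dgF dg-q (#-single {S = N q ∩ S} e λ m → h (∩ʳ {S = N q} m) (∩ˡ m))

-- Roots with the same neighbours; the clique core.

module Alike {n : ℕ} (G : Graph n) where

  open Walks G
  open Rooted G
  open Start G
  open Families G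
  open Cores G
  open Common G

  -- The inclusions close up cyclically: apart from `z`, the sets `T`, `P` and `Q` agree in `F`.
  record Twins (I : Problem) (T : Sub n) : Set where
    open Problem I
    field
      {q} : V
      q∈T : q ∈ T
      q≢z : q ≢ z
      T⊑F : T ⊑ F
      T⊑P : T ⊑ P
      T≥2 : 2 ≤ # T
      P⇒Q : ∀ {u} → u ∈ F → u ∈ P → u ≢ z → u ∈ Q
      Q⇒T : ∀ {u} → u ∈ F → u ∈ Q → u ≢ z → u ∈ T

  module Twin (I : Problem) {T : Sub n} (tw : Twins I T) where

    open Problem I
    open Twins tw

    q∈Q : q ∈ Q
    q∈Q = P⇒Q (T⊑F q∈T) (T⊑P q∈T) q≢z

    open Shared I (T⊑F q∈T) (T⊑P q∈T) q∈Q q≢z public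

    T⁻ : Sub n
    T⁻ = T ∖ q

    T⁻⊑E : T⁻ ⊑ E
    T⁻⊑E m = ∖⁺ (T⊑F (∖ˡ m)) (∖ʳ m)

    T⁻≤T : # T⁻ + 1 ≤ # T
    T⁻≤T = #-∖< q∈T

    T≤T⁻ : # T ≤ # T⁻ + 1
    T≤T⁻ = #-∖ T q

    T⁻≥1 : 1 ≤ # T⁻
    T⁻≥1 = remove T≥2

    ends : ∀ {u} → u ∈ E → u ≢ z → u ∈ P ⊎ u ∈ Q → u ∈ T⁻
    ends m ne (inj₁ p) = ∖⁺ (Q⇒T (∖ˡ m) (P⇒Q (∖ˡ m) p ne) ne) (∖ʳ m)
    ends m ne (inj₂ b) = ∖⁺ (Q⇒T (∖ˡ m) b ne) (∖ʳ m)

    module OfClique (clique : Clique T) where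

      open Core T⁻ T⁻⊑E ends

      supply : Supply
      supply {K} p m = layer p (λ h → T⊑F (∖ˡ h)) m {1} {1} {# T⁻} (inj₁ refl) T⁻≥1 enters bd , id
        where
        enters : ∀ {u} → u ∈ nb T⁻ → ∀ i → i < # T⁻ → Pre P T⁻ (1 + i * 1) u
        enters x i l = let (t , e , t∈) = nb∈ x ; (s , s∈ , w) = clique-walk i (clique-∖ clique) t∈ l in
          inj₂ (s , t , T⊑P (∖ˡ s∈) , subst (Walk T⁻ s t) (cong suc (sym (*-identityʳ i))) w , ~-sym e)
        bd : ∀ {u} → u ∈ K → u ≢ z → dg T⁻ u + bit (P u) + 1 ≤ # T⁻ + bit (nb T⁻ u)
        bd {u} x ne with u ∈? nb T⁻
        ... | yes g = lin 4 (λ d p t b → d ≼ t ⇛ p ≼ κ 0 ⇛ κ 1 ≼ b ⇛ ⊢ d ⊕ p ⊕ κ 1 ≼ t ⊕ b) refl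
              (dg T⁻ u) (bit (P u)) (# T⁻) (bit (nb T⁻ u)) (dg≤# T⁻ u)
              (≤-reflexive (bit-false (proj₁ (plain (inS p x) (offH p x) ne)))) (≤-reflexive (sym (bit-true g)))
        ... | no g = lin 4 (λ d p t b → d ≼ κ 0 ⇛ p ≼ κ 0 ⇛ κ 1 ≼ t ⇛ ⊢ d ⊕ p ⊕ κ 1 ≼ t ⊕ b) refl
              (dg T⁻ u) (bit (P u)) (# T⁻) (bit (nb T⁻ u)) (dg-nb g)
              (≤-reflexive (bit-false (proj₁ (plain (inS p x) (offH p x) ne)))) T⁻≥1

      to-q : ∀ c → c < # T → ∃[ s ] s ∈ T × Walk T s q (suc c)
      to-q c l = clique-walk c clique q∈T l

      short : ∀ c → 1 ≤ c → c ≤ # T → AB F P Q c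
      short (suc c) _ l = let (s , s∈ , w) = to-q c l in s , q , T⊑P s∈ , q∈Q , walk-mono T⊑F w

      result : Adm k F P Q
      result with outcome supply
      ... | done r = r
      ... | free h = adm-run k 1 (# T) (lin 4 (λ k d t s → k ≼ d ⊕ κ 1 ⇛ d ≼ s ⇛ s ⊕ κ 1 ≼ t ⇛ ⊢ k ⊕ κ 1 ≼ κ 1 ⊕ t) refl
              k (dg T⁻ q) (# T) (# T⁻) (k-free h) (dg≤# T⁻ q) T⁻≤T) short
      ... | hung e e∈S q~e uniq side =
        adm-run k 1 (1 + # T) (lin 4 (λ k d t s → k ≼ d ⊕ κ 2 ⇛ d ≼ s ⇛ s ⊕ κ 1 ≼ t ⇛ ⊢ k ⊕ κ 1 ≼ κ 2 ⊕ t) refl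
          k (dg T⁻ q) (# T) (# T⁻) (k-hung uniq) (dg≤# T⁻ q) T⁻≤T) all
        where
        size : # T ≡ suc (# T⁻)
        size = trans (≤-antisym T≤T⁻ T⁻≤T) (+-comm (# T⁻) 1)
        e∉T : e ∉ T
        e∉T m = S-off e∈S (∖⁺ m λ { refl → ~-irr q~e })
        e∈F : e ∈ F
        e∈F = ∖ˡ (S⊑E e∈S)
        onto-e : ∃[ s ] s ∈ T × Walk F s e (1 + # T)
        onto-e = let (s , s∈ , w) = to-q (# T⁻) (≤-reflexive (sym size)) in
          s , s∈ , append (subst (Walk T s q) (sym size) w) T⊑F e∈F e∉T q~e
        -- The one size beyond `short`: all of `T⁻`, then `e` and `q`; or, if `e` is `z` and
        -- adjacent to a root, all of `T` with `q` last, then `e`.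
        longest : e ∈ nb T⁻ ⊎ (e ≡ z × e ∈ P ∪ Q) → AB F P Q (1 + # T)
        longest (inj₁ m) = let (t , a , t∈) = nb∈ m ; (s , s∈ , w) = clique-walk (# T⁻ ∸ 1) (clique-∖ clique) t∈ (≤-reflexive (m+[n∸m]≡n T⁻≥1)) in
          subst (AB F P Q) (cong suc (trans (cong suc (m+[n∸m]≡n T⁻≥1)) (sym size)))
            (AB-hung (inj₂ (s , t , T⊑P (∖ˡ s∈) , w , ~-sym a)) e∈S (~-sym q~e))
        longest (inj₂ (refl , pq)) with ∪⁻ {S = P} pq | onto-e
        ... | inj₂ b | s , s∈ , w = s , e , T⊑P s∈ , b , w
        ... | inj₁ p | s , s∈ , w = e , s , p , P⇒Q (T⊑F s∈) (T⊑P s∈) (λ { refl → e∉T s∈ }) , walk-rev w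
        all : ∀ c → 1 ≤ c → c ≤ 1 + # T → AB F P Q c
        all c l h with m≤n⇒m<n∨m≡n h
        ... | inj₁ (s≤s h′) = short c l h′
        ... | inj₂ refl = longest side

    module OfIndependent (R : Sub n) (R⊑F : R ⊑ F) (complete : Complete T R)
                  (P-ind : ∀ {u v} → u ∈ F → v ∈ F → u ∈ P → v ∈ P → u ∉ N v)
                  (Q-ind : ∀ {u v} → u ∈ F → v ∈ F → u ∈ Q → v ∈ Q → u ∉ N v) where

      q∈F : q ∈ F
      q∈F = T⊑F q∈T

      q∈P : q ∈ P
      q∈P = T⊑P q∈T

      R⊑E : R ⊑ E
      R⊑E m = ∖⁺ (R⊑F m) λ { refl → ~-irr (complete q∈T m) }

      TR⊑F : T ∪ R ⊑ F
      TR⊑F m = [ T⊑F , R⊑F ]′ (∪⁻ m)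

      common⁻ : ∀ {u} → u ∈ E → u ≢ z → u ∈ P → u ∈ T⁻
      common⁻ m ne p = ends m ne (inj₁ p)

      P-ind⁻ : ∀ {u v} → u ∈ E → v ∈ E → u ∈ P → v ∈ P → u ∉ N v
      P-ind⁻ m m′ = P-ind (∖ˡ m) (∖ˡ m′)

      not-root : ∀ {e} → e ∈ F → q ~ e → e ∉ P ∪ Q
      not-root f a m = [ (λ p → P-ind f q∈F p q∈P a) , (λ b → Q-ind f q∈F b q∈Q a) ]′ (∪⁻ {S = P} m)

      dg-core : ∀ R′ → R′ ⊑ R → dg (T⁻ ∪ R′) q ≤ # R′
      dg-core R′ i = ≤-trans (dg-mono {T⁻ ∪ R′} {R′} λ a m → [ (λ t → ⊥-elim (P-ind (T⊑F (∖ˡ t)) q∈F (T⊑P (∖ˡ t)) q∈P a)) , id ]′ (∪⁻ m)) (dg≤# R′ q)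

      -- A vertex of R put outside the core is the only neighbour of q outside it.
      dg-removed : ∀ {r₀} (r₀∈ : r₀ ∈ R) → (∀ {u} → u ∈ E → u ∉ T⁻ ∪ R ∖ r₀ → q ~ u → u ≡ r₀) → dg F q ≤ # R
      dg-removed {r₀} r₀∈ h = ≤-trans (dg-mono {F} {R} λ {w} a f → at w a f) (dg≤# R q)
        where
        at : ∀ w → q ~ w → w ∈ F → w ∈ R
        at w a f with w ∈? (T⁻ ∪ R ∖ r₀)
        ... | no g = subst (_∈ R) (sym (h (∖⁺ f λ eq → ~⇒≢ a (sym eq)) g a)) r₀∈
        ... | yes m = [ (λ t → ⊥-elim (P-ind (T⊑F (∖ˡ t)) q∈F (T⊑P (∖ˡ t)) q∈P a)) , ∖ˡ ]′ (∪⁻ m)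

      core⊑E : ∀ {R′} → R′ ⊑ R → T⁻ ∪ R′ ⊑ E
      core⊑E i m = [ T⁻⊑E , R⊑E ∘ i ]′ (∪⁻ m)

      cover : ∀ {R′ u} → u ∈ E → u ≢ z → u ∈ P ⊎ u ∈ Q → u ∈ T⁻ ∪ R′
      cover m ne o = ∪ˡ (ends m ne o)

      odd : ∀ j → j < # T → j ≤ # R → AB F P Q (1 + j * 2)
      odd j l h = let (s , s∈ , w) = zigzag-T j complete q∈T l h in s , q , T⊑P s∈ , q∈Q , walk-mono TR⊑F w

-- Roots with the same neighbours; bipartite cores.

module TwinCases {n : ℕ} (G : Graph n) where

  open Walks G
  open Rooted G
  open Start G
  open Families G
  open Cores G
  open Alike G

  module SparseTwins (I : Problem) (D : Sparse I) (tw : Twins I (Sparse.T D)) where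

    open Problem I
    open Sparse D
    open Twins tw using (q; q∈T; q≢z; T≥2; P⇒Q; Q⇒T)
    open Twin I tw
    open OfIndependent R R⊑F complete P-ind Q-ind

    module At (R′ : Sub n) (R′⊑R : R′ ⊑ R) (R′<T⁻ : suc (# R′) ≤ # T⁻)
              (maximal′ : ∀ {u} → u ∈ E → u ∉ R′ → dg T⁻ u ≤ # R′ + 1) where

      open Core (T⁻ ∪ R′) (core⊑E R′⊑R) cover public

      private
        nbT⁻-R : ∀ {u r} → u ∈ E → u ∈ nb T⁻ → r ∈ R′ → u ∉ N r
        nbT⁻-R m a r = let (t , e , t∈) = nb∈ a in
          no-tri (T⊑F (∖ˡ t∈)) (∖ˡ m) (R⊑F (R′⊑R r)) (T⊑P (∖ˡ t∈)) (~-sym e) (complete (∖ˡ t∈) (R′⊑R r))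

        core⁻ : Core₂ E P z
        core⁻ = record
          { T = T⁻ ; R = R′ ; T⊑E = T⁻⊑E ; R⊑E = R⊑E ∘ R′⊑R ; T⊑P = T⊑P ∘ ∖ˡ ; complete = λ t r → complete (∖ˡ t) (R′⊑R r)
          ; common = λ m ne p _ → common⁻ m ne p ; P-ind = P-ind⁻ ; nbT-R = nbT⁻-R ; R<T = R′<T⁻ ; maximal = maximal′ }

        module K₂ = Core₂ core⁻

      open Sources₂ I core⁻ O ∖ˡ
      open K₂ public using (reach-T)

      supply : Supply
      supply {K} p m with meets? K (nb T⁻) | meets? K (nb R′)
      ... | inj₁ g | _ = source-T p g , λ a → let (t , e , t∈) = nb∈ a in ∈nb e (∪ˡ t∈)
      ... | inj₂ g | inj₂ g′ = let (v , v∈ , a) = m in ⊥-elim (K₂.off-H g g′ v∈ a)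
      ... | inj₂ g | inj₁ g′ = layer p H⊑F g′ {2} {2} (inj₂ refl) R≥1 K₂.reach-R bd , λ a → let (r , e , r∈) = nb∈ a in ∈nb e (∪ʳ {S = T⁻} r∈)
        where
        R≥1 : 1 ≤ # R′
        R≥1 = let (_ , _ , a) = g′ ; (r , _ , r∈) = nb∈ a in #-member r∈
        bd : ∀ {u} → u ∈ K → u ≢ z → dg (T⁻ ∪ R′) u + bit (P u) + 1 ≤ # R′ + bit (nb R′ u)
        bd {u} x ne with u ∈? nb R′
        ... | yes y = lin 4 (λ d p s b → d ⊕ p ≼ s ⇛ κ 1 ≼ b ⇛ ⊢ d ⊕ p ⊕ κ 1 ≼ s ⊕ b) refl
              (dg (T⁻ ∪ R′) u) (bit (P u)) (# R′) (bit (nb R′ u)) (K₂.limit-R (inS p x) ne (offH p x) (g x)) (≤-reflexive (sym (bit-true y)))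
        ... | no y = lin 6 (λ d t r p s b → d ≼ t ⊕ r ⇛ t ≼ κ 0 ⇛ r ≼ κ 0 ⇛ p ≼ κ 0 ⇛ κ 1 ≼ s ⇛ ⊢ d ⊕ p ⊕ κ 1 ≼ s ⊕ b) refl
              (dg (T⁻ ∪ R′) u) (dg T⁻ u) (dg R′ u) (bit (P u)) (# R′) (bit (nb R′ u)) (K₂.dg-H u) (dg-nb (g x)) (dg-nb y)
              (≤-reflexive (bit-false (proj₁ (plain (inS p x) (offH p x) ne)))) R≥1

    odds : k ≤ # R + 1 → Adm k F P Q
    odds h = 1 , 2 , inj₂ refl , λ i l → let i≤ = ≤-pred (≤-trans l (≤-trans h (≤-reflexive (+-comm (# R) 1)))) in odd i (≤-trans (s≤s i≤) R<T) i≤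

    -- Without `q` the side `T` is still larger than `R`, so `R` can stay.
    wide : 2 + # R ≤ # T → Adm k F P Q
    wide h = finish (outcome supply)
      where
      open At R id (remove h) (λ m r → ≤-trans (dg-mono {T⁻} {T} λ _ → ∖ˡ) (maximal (∖ˡ m) r))
      finish : Outcome → Adm k F P Q
      finish (done r) = r
      finish (free g) = odds (≤-trans (k-free g) (+-monoˡ-≤ 1 (dg-core R id)))
      finish (hung e e∈S q~e uniq (inj₂ (refl , m))) = ⊥-elim (not-root (∖ˡ (S⊑E e∈S)) q~e m)
      -- `e` adds the size 2|R| + 3: a longest alternating path ending in `T⁻`, then `e` and `q`.
      -- The neighbour of `e` in the core is in `T⁻`, as one in `R` would form a triangle with `q`
      -- and `e`.
      finish (hung e e∈S q~e uniq (inj₁ m)) = 1 , 2 , inj₂ refl , λ i l → at i (≤-trans l (≤-trans (k-hung uniq) (≤-trans (+-monoˡ-≤ 2 (dg-core R id)) (≤-reflexive (+-comm (# R) 2)))))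
        where
        next : e ∈ nb T⁻
        next with nb∈ m
        ... | w , a , w∈ with ∪⁻ {S = T⁻} w∈
        ... | inj₁ t = ∈nb a t
        ... | inj₂ r = ⊥-elim (no-tri q∈F (R⊑F r) (∖ˡ (S⊑E e∈S)) q∈P (complete q∈T r) q~e a)
        at : ∀ i → i < 2 + # R → AB F P Q (1 + i * 2)
        at i (s≤s l) with m≤n⇒m<n∨m≡n l
        ... | inj₁ (s≤s l′) = odd i (≤-trans (s≤s l′) R<T) l′
        ... | inj₂ refl = AB-hung (reach-T next (# R) ≤-refl) e∈S (~-sym q~e)

    -- As `T` loses `q`, a vertex `r₀` is taken from `R`. It is a neighbour of `q` outside the core,
    -- hence the only one; so `q` has at most |R| neighbours in `F`, and the odd sizes suffice.
    tight : # T ≤ 1 + # R → Adm k F P Q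
    tight h with #-pick {S = R} (≤-pred (≤-trans T≥2 h))
    ... | r₀ , r₀∈ = finish (outcome supply)
      where
      R⁻<T⁻ : suc (# (R ∖ r₀)) ≤ # T⁻
      R⁻<T⁻ = lin 4 (λ r s t t′ → s ⊕ κ 1 ≼ r ⇛ κ 1 ⊕ r ≼ t ⇛ t ≼ t′ ⊕ κ 1 ⇛ ⊢ κ 1 ⊕ s ≼ t′) refl
        (# R) (# (R ∖ r₀)) (# T) (# T⁻) (#-∖< r₀∈) R<T T≤T⁻
      open At (R ∖ r₀) ∖ˡ R⁻<T⁻ (λ {u} _ _ → lin 5 (λ d r s t t′ → d ≼ t′ ⇛ t′ ⊕ κ 1 ≼ t ⇛ t ≼ κ 1 ⊕ r ⇛ r ≼ s ⊕ κ 1 ⇛ ⊢ d ≼ s ⊕ κ 1) refl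
        (dg T⁻ u) (# R) (# (R ∖ r₀)) (# T) (# T⁻) (dg≤# T⁻ u) T⁻≤T h (#-∖ R r₀))
      r₀∈S : r₀ ∈ S
      r₀∈S = ∈S (R⊑E r₀∈) λ m → [ (λ t → ~-irr (complete (∖ˡ t) r₀∈)) , ∉∖ ]′ (∪⁻ m)
      finish : Outcome → Adm k F P Q
      finish (done r) = r
      finish (free g) = ⊥-elim (g r₀∈S (complete q∈T r₀∈))
      finish (hung e _ _ uniq _) = odds (≤-trans k≤dgF (+-monoˡ-≤ 1 (dg-removed r₀∈ λ m g a →
        trans (uniq (∈S m g) a) (sym (uniq r₀∈S (complete q∈T r₀∈))))))

    result : Adm k F P Q
    result with 2 + # R ≤? # T
    ... | yes h = wide h
    ... | no h  = tight (≤-pred (≰⇒> h))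

  module DenseTwins (I : Problem) (D : Dense I) (tw : Twins I (Dense.T D)) where

    open Problem I
    open Dense D
    open Twins tw using (q; q∈T; q≢z; T≥2; P⇒Q; Q⇒T)
    open Twin I tw
    open OfIndependent R R⊑F complete P-ind Q-ind

    -- With T = {q, t} the core is {t} alone, and q has two neighbours outside it.
    two : # T ≤ 2 → Adm k F P Q
    two h = finish (outcome supply)
      where
      open Core (T⁻ ∪ ∅) (core⊑E (⊥-elim ∘ ∉∅)) cover
      T⁻≤1 : # T⁻ ≤ 1
      T⁻≤1 = +-cancelʳ-≤ 1 (# T⁻) 1 (≤-trans T⁻≤T h)
      core⁻ : Core₂ E P z
      core⁻ = record
        { T = T⁻ ; R = ∅ ; T⊑E = T⁻⊑E ; R⊑E = ⊥-elim ∘ ∉∅ ; T⊑P = T⊑P ∘ ∖ˡ ; complete = λ _ r → ⊥-elim (∉∅ r)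
        ; common = λ m ne p _ → common⁻ m ne p ; P-ind = P-ind⁻ ; nbT-R = λ _ _ r → ⊥-elim (∉∅ r)
        ; R<T = ≤-trans (s≤s (≤-reflexive (#∅ {n}))) T⁻≥1 ; maximal = λ {u} _ _ → ≤-trans (dg≤# T⁻ u) (≤-trans T⁻≤1 (m≤n+m 1 (# {n} ∅))) }
      module K₂ = Core₂ core⁻
      open Sources₂ I core⁻ O ∖ˡ
      supply : Supply
      supply {K} p m with meets? K (nb T⁻)
      ... | inj₁ g = source-T p g , λ a → let (t , e , t∈) = nb∈ a in ∈nb e (∪ˡ t∈)
      ... | inj₂ g = let (v , v∈ , a) = m in ⊥-elim (K₂.off-H g (λ _ b → ∉∅ (proj₂ (proj₂ (nb∈ b)))) v∈ a)
      c₁ : ∃[ c ] c ∈ C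
      c₁ = #-pick (≤-trans (s≤s z≤n) C≥2)
      c₂ : ∃[ c ] c ∈ C × c ≢ proj₁ c₁
      c₂ = #-pick≢ (proj₁ c₁) C≥2
      inS′ : ∀ {c} → c ∈ C → c ∈ S
      inS′ c∈ = ∈S (R⊑E (C⊑R c∈)) λ m → [ (λ t → ~-irr (complete (∖ˡ t) (C⊑R c∈))) , ∉∅ ]′ (∪⁻ m)
      q~ : ∀ {c} → c ∈ C → q ~ c
      q~ c∈ = complete q∈T (C⊑R c∈)
      finish : Outcome → Adm k F P Q
      finish (done r) = r
      finish (free g) = ⊥-elim (g (inS′ (proj₂ c₁)) (q~ (proj₂ c₁)))
      finish (hung e _ _ uniq _) = let (c , c∈ , ne) = c₂ in
        ⊥-elim (ne (trans (uniq (inS′ c∈) (q~ c∈)) (sym (uniq (inS′ (proj₂ c₁)) (q~ (proj₂ c₁))))))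

    module At (R′ : Sub n) (R′⊑R : R′ ⊑ R) (C⊑R′ : C ⊑ R′) (T⁻≥2 : 2 ≤ # T⁻) (shape′ : R′ ⊑ C ⊎ # R′ ≤ # T⁻)
              (maximal′ : ∀ {u} → u ∈ E → u ∉ R′ → dg T⁻ u ≤ # R′) where

      open Core (T⁻ ∪ R′) (core⊑E R′⊑R) cover public

      nb-T : ∀ {u} → u ∈ nb T⁻ → u ∈ nb T
      nb-T a = let (t , e , t∈) = nb∈ a in ∈nb e (∖ˡ t∈)

      core⁻ : Core₃ E P z
      core⁻ = record
        { T = T⁻ ; R = R′ ; C = C ; T⊑E = T⁻⊑E ; R⊑E = R⊑E ∘ R′⊑R ; T⊑P = T⊑P ∘ ∖ˡ ; complete = λ t r → complete (∖ˡ t) (R′⊑R r)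
        ; C⊑R = C⊑R′ ; clique = clique ; C≥2 = C≥2 ; T≥1 = T⁻≥1 ; common = λ m ne p _ → common⁻ m ne p ; P-ind = P-ind⁻
        ; shape = shape′ ; maximal = maximal′ ; C-max = λ m c a → C-max (∖ˡ m) c (nb-T a) }

      module K₃ = Core₃ core⁻

      open Sources₃ I core⁻ O ∖ˡ

      supply : Supply
      supply {K} p m with meets? K (nb C) | meets? K (nb T⁻) | meets? K (nb R′)
      ... | inj₁ g | _ | _ = source-C p g , λ a → let (c , e , c∈) = nb∈ a in ∈nb e (∪ʳ {S = T⁻} (C⊑R′ c∈))
      ... | inj₂ g | inj₁ g′ | _ = source-T p g g′ T⁻≥2 , λ a → let (t , e , t∈) = nb∈ a in ∈nb e (∪ˡ t∈)
      ... | inj₂ g | inj₂ g′ | inj₁ g″ = source-R p g g′ g″ , λ a → let (r , e , r∈) = nb∈ a in ∈nb e (∪ʳ {S = T⁻} r∈)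
      ... | inj₂ _ | inj₂ g | inj₂ g′ = let (v , v∈ , a) = m in ⊥-elim (K₃.off-H g g′ v∈ a)

    module K = Core₃ core

    at-q : ∀ c → 3 ≤ c → c ≤ # R + # T → c ≤ suc (# R + # R) → AB F P Q c
    at-q c l h h′ = let (s , p , w) = K.walk-T q∈T T≥2 c l h h′ in s , q , p , q∈Q , walk-mono TR⊑F w

    module Larger (T≥3 : 3 ≤ # T) where

      T⁻≥2 : 2 ≤ # T⁻
      T⁻≥2 = remove T≥3

      -- Paths ending in `q` have the sizes 3 to |R| + μ + 1, where μ belongs to the core without
      -- `q`. If `q` has a neighbour `e` outside the core, `k` can be larger by one, and `e`
      -- supplies one more size.
      wide : R ⊑ C ⊎ # R ≤ # T⁻ → Adm k F P Q
      wide shape′ = finish (outcome supply)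
        where
        open At R id C⊑R T⁻≥2 shape′ (λ m r → ≤-trans (dg-mono {T⁻} {T} λ _ → ∖ˡ) (maximal (∖ˡ m) r))
        open K₃ using (μ; μ≤T; μ≤R)
        μ≥2 : 2 ≤ μ
        μ≥2 = ⊓-glb T⁻≥2 K₃.R≥2
        run : ∀ c → 3 ≤ c → c ≤ # R + μ + 1 → AB F P Q c
        run c l h = at-q c l
          (lin 5 (λ c r m t t′ → c ≼ r ⊕ m ⊕ κ 1 ⇛ m ≼ t′ ⇛ t′ ⊕ κ 1 ≼ t ⇛ ⊢ c ≼ r ⊕ t) refl c (# R) μ (# T) (# T⁻) h μ≤T T⁻≤T)
          (lin 3 (λ c r m → c ≼ r ⊕ m ⊕ κ 1 ⇛ m ≼ r ⇛ ⊢ c ≼ κ 1 ⊕ (r ⊕ r)) refl c (# R) μ h μ≤R)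
        finish : Outcome → Adm k F P Q
        finish (done r) = r
        finish (free g) = adm-run k 3 (# R + μ + 1) (lin 4 (λ k d r m → k ≼ d ⊕ κ 1 ⇛ d ≼ r ⇛ κ 2 ≼ m ⇛ ⊢ k ⊕ κ 3 ≼ κ 1 ⊕ (r ⊕ m ⊕ κ 1)) refl
          k (dg (T⁻ ∪ R) q) (# R) μ (k-free g) (dg-core R id) μ≥2) run
        finish (hung e e∈S q~e uniq (inj₂ (refl , m))) = ⊥-elim (not-root (∖ˡ (S⊑E e∈S)) q~e m)
        finish (hung e e∈S q~e uniq (inj₁ m)) =
          adm-run k 3 (2 + (# R + μ)) (lin 4 (λ k d r m → k ≼ d ⊕ κ 2 ⇛ d ≼ r ⇛ κ 2 ≼ m ⇛ ⊢ k ⊕ κ 3 ≼ κ 3 ⊕ (r ⊕ m)) refl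
            k (dg (T⁻ ∪ R) q) (# R) μ (k-hung uniq) (dg-core R id) μ≥2) all
          where
          large : 3 ≤ # R + μ
          large = lin 2 (λ r m → κ 2 ≼ r ⇛ κ 2 ≼ m ⇛ ⊢ κ 3 ≼ r ⊕ m) refl (# R) μ K₃.R≥2 μ≥2
          approach : e ∈ nb C ⊎ e ∉ nb C → e ∈ nb T⁻ ⊎ e ∉ nb T⁻ → Pre P (T⁻ ∪ R) (# R + μ) e
          approach (inj₁ c) _ = K₃.reach-C c (# R + μ) (≤-trans (n≤1+n 2) large) ≤-refl
          approach (inj₂ _) (inj₁ t) = K₃.reach-T t T⁻≥2 (# R + μ) large ≤-refl
          approach (inj₂ c) (inj₂ t) with nb∈ m
          ... | w , a , w∈ with ∪⁻ {S = T⁻} w∈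
          ... | inj₁ w∈T = ⊥-elim (t (∈nb a w∈T))
          ... | inj₂ w∈R = subst (λ j → Pre P (T⁻ ∪ R) j e) count (K₃.reach-R (∈nb a w∈R) (μ ∸ 1) (≤-reflexive μ⁻))
            where
            μ⁻ : suc (μ ∸ 1) ≡ μ
            μ⁻ = m+[n∸m]≡n K₃.μ≥1
            count : 2 + (μ ∸ 1) * 2 ≡ # R + μ
            count = trans (cong (_* 2) μ⁻) (trans (double μ) (cong (_+ μ) (m≥n⇒m⊓n≡n (K₃.R≤T w∈R λ w∈C → c (∈nb a w∈C)))))
          split : ∀ A → e ∈ A ⊎ e ∉ A
          split A with e ∈? A
          ... | yes y = inj₁ y
          ... | no y  = inj₂ y
          all : ∀ c → 3 ≤ c → c ≤ 2 + (# R + μ) → AB F P Q c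
          all c l h with m≤n⇒m<n∨m≡n h
          ... | inj₁ (s≤s h′) = run c l (≤-trans h′ (≤-reflexive (+-comm 1 (# R + μ))))
          ... | inj₂ refl = AB-hung (approach (split (nb C)) (split (nb T⁻))) e∈S (~-sym q~e)

      -- As in the sparse case, but `r₀` is taken outside the clique. Then k ≤ |R| + 1, and the
      -- sizes 3 to |R| + |T| are enough because |T| ≥ 3.
      tight : ∀ {r₀} → r₀ ∈ R → r₀ ∉ C → # R ≤ # T → # T ≤ # R → Adm k F P Q
      tight {r₀} r₀∈ r₀∉ R≤T T≤R = finish (outcome supply)
        where
        R⁻≤T⁻ : # (R ∖ r₀) ≤ # T⁻
        R⁻≤T⁻ = lin 4 (λ r s t t′ → s ⊕ κ 1 ≼ r ⇛ r ≼ t ⇛ t ≼ t′ ⊕ κ 1 ⇛ ⊢ s ≼ t′) refl (# R) (# (R ∖ r₀)) (# T) (# T⁻) (#-∖< r₀∈) R≤T T≤T⁻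
        C⊑R⁻ : C ⊑ R ∖ r₀
        C⊑R⁻ c = ∖⁺ (C⊑R c) λ { refl → r₀∉ c }
        open At (R ∖ r₀) ∖ˡ C⊑R⁻ T⁻≥2 (inj₂ R⁻≤T⁻)
          (λ {u} _ _ → lin 5 (λ d r s t t′ → d ≼ t′ ⇛ t′ ⊕ κ 1 ≼ t ⇛ t ≼ r ⇛ r ≼ s ⊕ κ 1 ⇛ ⊢ d ≼ s) refl
            (dg T⁻ u) (# R) (# (R ∖ r₀)) (# T) (# T⁻) (dg≤# T⁻ u) T⁻≤T T≤R (#-∖ R r₀))
        r₀∈S : r₀ ∈ S
        r₀∈S = ∈S (R⊑E r₀∈) λ m → [ (λ t → ~-irr (complete (∖ˡ t) r₀∈)) , ∉∖ ]′ (∪⁻ m)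
        finish : Outcome → Adm k F P Q
        finish (done r) = r
        finish (free g) = ⊥-elim (g r₀∈S (complete q∈T r₀∈))
        finish (hung e _ _ uniq _) = adm-run k 3 (# R + # T)
          (lin 4 (λ k d r t → k ≼ d ⊕ κ 1 ⇛ d ≼ r ⇛ κ 3 ≼ t ⇛ ⊢ k ⊕ κ 3 ≼ κ 1 ⊕ (r ⊕ t)) refl k (dg F q) (# R) (# T) k≤dgF
            (dg-removed r₀∈ λ m g a → trans (uniq (∈S m g) a) (sym (uniq r₀∈S (complete q∈T r₀∈)))) T≥3)
          λ c l h → at-q c l h (≤-trans h (≤-trans (+-monoʳ-≤ (# R) T≤R) (n≤1+n _)))

      result : Adm k F P Q
      result with find (R ─ C)
      ... | inj₁ g = wide (inj₁ λ {r} r∈ → within r∈ (r ∈? C))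
        where
        within : ∀ {r} → r ∈ R → Dec (r ∈ C) → r ∈ C
        within _ (yes c) = c
        within r∈ (no h) = ⊥-elim (g _ (─⁺ r∈ h))
      ... | inj₂ (r₀ , m) with suc (# R) ≤? # T
      ... | yes h = wide (inj₂ (remove h))
      ... | no h  = tight (─ˡ m) (─ʳ {S = R} m) (K.R≤T (─ˡ m) (─ʳ {S = R} m)) (≤-pred (≰⇒> h))

    result : Adm k F P Q
    result with 3 ≤? # T
    ... | yes h = Larger.result h
    ... | no h  = two (≤-pred (≰⇒> h))

-- Comparison of the two sides, and the induction.

module Conclusion {n : ℕ} (G : Graph n) where

  open Walks G
  open Rooted G
  open Start G
  open Families G
  open Analysis G
  open Growth G
  open Cores G
  open Alike G

  Independent : Sub n → Sub n → Set
  Independent F P = ∀ {u v} → u ∈ F → v ∈ F → u ∈ P → v ∈ P → u ∉ N v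

  -- Two neighbours of a root other than `z`, in the form in which they are used: one of them avoids
  -- any given `e`.
  Several : Sub n → Sub n → V → Set
  Several F Q z = ∀ e → ∃[ q ] q ∈ F × q ∈ Q × q ≢ z × q ≢ e

  edge? : ∀ F P → (∃[ u ] ∃[ v ] u ∈ F ∩ P × v ∈ F ∩ P × u ~ v) ⊎ Independent F P
  edge? F P = map₂ (λ h {_} {_} f g p q → h (∩⁺ f p) (∩⁺ g q)) (adjacent? (F ∩ P))

  record Triangle (F P : Sub n) : Set where
    field
      {t u v} : V
      t∈ : t ∈ F ∩ P
      u∈ : u ∈ F
      v∈ : v ∈ F
      t~u : t ~ u
      t~v : t ~ v
      u~v : u ~ v

  triangle? : ∀ F P → Triangle F P ⊎ (∀ {t u w} → t ∈ F → u ∈ F → w ∈ F → t ∈ P → t ~ u → t ~ w → u ∉ N w)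
  triangle? F P with search each
    where
    each : ∀ t → (t ∈ F ∩ P → ∀ {u w} → u ∈ F ∩ N t → w ∈ F ∩ N t → u ∉ N w) ⊎ (t ∈ F ∩ P × ∃[ u ] ∃[ v ] u ∈ F ∩ N t × v ∈ F ∩ N t × u ~ v)
    each t with t ∈? (F ∩ P) | adjacent? (F ∩ N t)
    ... | no h  | _ = inj₁ λ m → ⊥-elim (h m)
    ... | yes m | inj₁ w = inj₂ (m , w)
    ... | yes _ | inj₂ h = inj₁ λ _ a b → h a b
  ... | inj₁ f = inj₂ λ a b c p tu tw → f _ (∩⁺ a p) (∩⁺ b tu) (∩⁺ c tw)
  ... | inj₂ (t , m , u , v , a , b , e) = inj₁ record
    { t∈ = m ; u∈ = ∩ˡ a ; v∈ = ∩ˡ b ; t~u = ∩ʳ {S = F} a ; t~v = ∩ʳ {S = F} b ; u~v = e }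

  module Rootside (I : Problem) (w₀ : ∃[ u ] u ∈ Problem.F I × u ≢ Problem.z I) where

    open Problem I

    TKind : Sub n → Set
    TKind = Side.TKind I

    RKind : Sub n → Sub n → Sub n → Set
    RKind = Side.RKind I

    open Cliques F P

    several : Adm k F P Q ⊎ Several F Q z
    several with find ((F ∩ Q) ∖ z)
    ... | inj₁ none = let (v , f , b) = rgQ rg whole-set (proj₁ (proj₂ w₀)) in
        inj₁ (Whole.OneExit.result I f b (λ f′ b′ → inj₁ (trans (isz f′ b′) (sym (isz f b)))) w₀)
      where
      isz : ∀ {u} → u ∈ F → u ∈ Q → u ≡ z
      isz {u} f b with u Fin.≟ z
      ... | yes eq = eq
      ... | no ne  = ⊥-elim (none u (∖⁺ (∩⁺ f b) ne))
    ... | inj₂ (q , m) with find ((F ∩ Q) ∖ z ∖ q)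
    ... | inj₁ none = inj₁ (Whole.OneExit.result I (∩ˡ (∖ˡ m)) (∩ʳ {S = F} (∖ˡ m)) only w₀)
      where
      only : ∀ {u} → u ∈ F → u ∈ Q → u ≡ q ⊎ u ≡ z
      only {u} f b with u Fin.≟ q | u Fin.≟ z
      ... | yes eq | _ = inj₁ eq
      ... | no _ | yes eq = inj₂ eq
      ... | no a | no c = ⊥-elim (none u (∖⁺ (∖⁺ (∩⁺ f b) c) a))
    ... | inj₂ (q′ , m′) = inj₂ pick
      where
      pick : Several F Q z
      pick e with q Fin.≟ e
      ... | no ne = q , ∩ˡ (∖ˡ m) , ∩ʳ {S = F} (∖ˡ m) , ∖ʳ m , ne
      ... | yes refl = q′ , ∩ˡ (∖ˡ (∖ˡ m′)) , ∩ʳ {S = F} (∖ˡ (∖ˡ m′)) , ∖ʳ (∖ˡ m′) , ∖ʳ m′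

    with-edge : Several F Q z → ∃[ u ] ∃[ v ] u ∈ F ∩ P × v ∈ F ∩ P × u ~ v → Adm k F P Q ⊎ (∃[ T ] IsClique T × TKind T)
    with-edge twoQ (u , v , u∈ , v∈ , e) with max-clique u∈ v∈ e
    ... | T , ic@(T⊑F , T⊑P , cl , T≥2) , max = map₂ {B = TKind T} (λ t → T , ic , t) (CliqueCase.Around.conclude G I
      (record { T = T ; T⊑F = T⊑F ; T⊑P = T⊑P ; clique = cl ; T≥2 = T≥2 ; maximal = max }) twoQ)

    Alike : Sub n → Set
    Alike T = 2 ≤ # T → (∀ {u} → u ∈ F → u ∈ P → u ≢ z → u ∈ Q) → TKind T → Twins I T

    alike : ∀ {T} → T ⊑ F → T ⊑ P → Alike T
    alike T⊑F T⊑P T≥2 P⇒Q tk = let (q , q∈ , ne) = #-pick≢ z T≥2 in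
      record { q∈T = q∈ ; q≢z = ne ; T⊑F = T⊑F ; T⊑P = T⊑P ; T≥2 = T≥2 ; P⇒Q = P⇒Q ; Q⇒T = tk }

    record Bipartite : Set where
      field
        T R      : Sub n
        T⊑F      : T ⊑ F
        T⊑P      : T ⊑ P
        complete : Complete T R
        kind     : TKind T ⊎ RKind (T ∪ R) T R
        twins    : Twins I T → Adm k F P Q

    bipartite : Several F Q z → Independent F P → Independent F Q → Adm k F P Q ⊎ Bipartite
    bipartite twoQ P-ind Q-ind = [ dense , sparse ]′ (triangle? F P)
      where
      of-dense : Dense I → Adm k F P Q ⊎ Bipartite
      of-dense Δ = map₂ (λ kd → record
        { T = T ; R = R ; T⊑F = T⊑F ; T⊑P = T⊑P ; complete = complete ; kind = kd ; twins = TwinCases.DenseTwins.result G I Δ })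
        (DenseCase.Around.conclude G I Δ twoQ)
        where open Dense Δ
      of-sparse : Sparse I → Adm k F P Q ⊎ Bipartite
      of-sparse Δ = map₂ (λ kd → record
        { T = T ; R = R ; T⊑F = T⊑F ; T⊑P = T⊑P ; complete = complete ; kind = kd ; twins = TwinCases.SparseTwins.result G I Δ })
        (SparseCase.Around.conclude G I Δ twoQ)
        where open Sparse Δ
      dense : Triangle F P → Adm k F P Q ⊎ Bipartite
      dense tri = let (C , (C⊑F , clique , C≥2 , com≥1) , lock) = seed t∈ u∈ v∈ t~u t~v u~v ; (R , (R⊑F , C⊑R , s , T≥1) , full) = grow 0 C C⊑F com≥1 in
        of-dense record
          { T = com R ; R = R ; C = C ; T⊑F = com-F ; R⊑F = R⊑F ; T⊑P = com-P ; complete = com-~ ; C⊑R = C⊑R ; clique = clique ; C≥2 = C≥2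
          ; T≥1 = T≥1 ; common = ∈com ; P-ind = P-ind ; Q-ind = Q-ind ; shape = map₂ (≤-trans (≤-reflexive (sym (+-identityʳ (# R))))) s
          ; maximal = λ f g → ≤-trans (full f g) (≤-reflexive (+-identityʳ (# R)))
          ; C-max = λ f g a → lock f g (let (t , e , t∈) = nb∈ a in ∈nb e (com-anti C⊑R t∈)) }
        where open Triangle tri
      sparse : (∀ {t u w} → t ∈ F → u ∈ F → w ∈ F → t ∈ P → t ~ u → t ~ w → u ∉ N w) → Adm k F P Q ⊎ Bipartite
      sparse no-tri = let (R , (R⊑F , _ , s , T≥1) , full) = grow 1 ∅ (⊥-elim ∘ ∉∅) some in
        of-sparse record
          { T = com R ; R = R ; T⊑F = com-F ; R⊑F = R⊑F ; T⊑P = com-P ; complete = com-~ ; common = ∈com ; P-ind = P-ind ; Q-ind = Q-ind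
          ; no-tri = no-tri ; R<T = larger R s T≥1 ; maximal = full }
        where
        some : 1 ≤ # (com ∅)
        some = let (v , f , p) = rgP rg whole-set (proj₁ (proj₂ w₀)) in #-member (∈com f p (⊥-elim ∘ ∉∅))
        larger : ∀ R → R ⊑ ∅ ⊎ # R + 1 ≤ # (com R) → 1 ≤ # (com R) → suc (# R) ≤ # (com R)
        larger R (inj₁ i) h = ≤-trans (s≤s (#-empty {S = R} λ _ m → ∉∅ (i m))) h
        larger R (inj₂ l) _ = ≤-trans (≤-reflexive (+-comm 1 (# R))) l

    pair : ∀ {T} → Several F Q z → TKind T → ∃[ a ] ∃[ b ] a ∈ T × b ∈ T × a ≢ b × a ∈ F ∩ Q × b ∈ F ∩ Q
    pair twoQ tk = let (a , fa , qa , za , _) = twoQ z ; (b , fb , qb , zb , ne) = twoQ a in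
      a , b , tk fa qa za , tk fb qb zb , ne ∘ sym , ∩⁺ fa qa , ∩⁺ fb qb

    pair-large : ∀ {T} → Several F Q z → TKind T → 2 ≤ # T
    pair-large {T} twoQ tk = let (a , b , a∈ , b∈ , ne , _) = pair {T} twoQ tk in
      ≤-trans (s≤s (#-member {S = T ∖ b} (∖⁺ a∈ ne))) (≤-trans (≤-reflexive (+-comm 1 (# (T ∖ b)))) (#-∖< b∈))

  reverse : Problem → Problem
  reverse I = record
    { F = F ; P = Q ; Q = P ; z = z ; k = k ; k≥2 = k≥2 ; below = below ; rg = RG-rev rg
    ; degF = λ {u} f ne → lin 4 (λ k d p b → k ⊕ κ 1 ≼ d ⊕ p ⊕ b ⇛ ⊢ k ⊕ κ 1 ≼ d ⊕ b ⊕ p) refl k (dg F u) (bit (P u)) (bit (Q u)) (degF f ne) }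
    where open Problem I

  module Step (I : Problem) (w₀ : ∃[ u ] u ∈ Problem.F I × u ≢ Problem.z I) where

    open Problem I

    module X = Rootside I w₀
    module Y = Rootside (reverse I) w₀

    open Cliques

    both-cliques : Several F Q z → (∃[ T ] IsClique F P T × (∀ {q} → q ∈ F → q ∈ Q → q ≢ z → q ∈ T)) →
                   (∃[ T ] IsClique F Q T × (∀ {p} → p ∈ F → p ∈ P → p ≢ z → p ∈ T)) → Adm k F P Q
    both-cliques twoQ (T , (T⊑F , T⊑P , clique , T≥2) , tk) (T′ , (_ , T′⊑Q , _) , tk′) =
      Twin.OfClique.result I (X.alike T⊑F T⊑P T≥2 (λ f p ne → T′⊑Q (tk′ f p ne)) tk) clique

    module Opposite (twoP : Several F P z) (twoQ : Several F Q z) (P-ind : Independent F P) (Q-ind : Independent F Q)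
                    (x : X.Bipartite) (y : Y.Bipartite) where

      module Bx = X.Bipartite x
      module By = Y.Bipartite y

      -- A vertex of `A` other than `z` and `e` lies in `T′`, so in `B` and therefore in `R`. Then
      -- it is adjacent to `T`, which is part of the independent set `A`.
      mixed : ∀ {A B z} {T R T′ : Sub n} → Several F A z → Independent F A → T ⊑ F → T ⊑ A → T′ ⊑ B → Complete T R → 1 ≤ # T →
              (∀ {p} → p ∈ F → p ∈ A → p ≢ z → p ∈ T′) → ∀ e → (∀ {q} → q ∈ F → q ∈ B → q ≢ e → q ∈ R) → ⊥
      mixed two ind T⊑F T⊑A T′⊑B c T≥1 tk e toR = let (p , f , a , z≢ , e≢) = two e ; (t , t∈) = #-pick T≥1 in
        ind (T⊑F t∈) f (T⊑A t∈) a (~-sym (c t∈ (toR f (T′⊑B (tk f a z≢)) e≢)))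

      -- A vertex f missing from T would make T smaller than the other set, which is no larger.
      member : ∀ {A B} {T T′ : Sub n} e f → T ⊑ F → T ⊑ A → T′ ⊑ F → T′ ⊑ B → # ((F ∩ B) ∖ e) < # T → # ((F ∩ A) ∖ f) < # T′ → f ∈ T
      member {A} {B} {T} {T′} e f T⊑F T⊑A T′⊑F T′⊑B h h′ with f ∈? T
      ... | yes m = m
      ... | no g  = ⊥-elim (1+n≰n (lin 5 (λ t t′ a b b′ → κ 1 ⊕ b ≼ t ⇛ κ 1 ⊕ a ≼ t′ ⇛ t ≼ a ⇛ t′ ≼ b′ ⇛ b′ ≼ b ⊕ κ 1 ⇛ ⊢ κ 1 ⊕ t ≼ t) refl
            (# T) (# T′) (# ((F ∩ A) ∖ f)) (# ((F ∩ B) ∖ e)) (# (F ∩ B)) h h′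
            (#-mono {S = T} λ m → ∖⁺ (∩⁺ (T⊑F m) (T⊑A m)) λ { refl → g m }) (#-mono {S = T′} λ m → ∩⁺ (T′⊑F m) (T′⊑B m)) (#-∖ (F ∩ B) e)))

      open Side.RKind

      -- By `member`, each exception lies in the set `T` of the opposite side. If one of them is not
      -- `z`, its `tiny` forbids `z` to be in that core or next to its `T`, and the other exception
      -- violates this. If both are `z`, then `z` is adjacent to `y` and, through the core at `x`,
      -- to another neighbour of `y`.
      clash : X.RKind (Bx.T ∪ Bx.R) Bx.T Bx.R → Y.RKind (By.T ∪ By.R) By.T By.R → ⊥
      clash a b = at (e a Fin.≟ z) (e b Fin.≟ z)
        where
        f∈ : e b ∈ Bx.T
        f∈ = member (e a) (e b) Bx.T⊑F Bx.T⊑P By.T⊑F By.T⊑P (small a) (small b)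
        e∈ : e a ∈ By.T
        e∈ = member (e b) (e a) By.T⊑F By.T⊑P Bx.T⊑F Bx.T⊑P (small b) (small a)
        at : Dec (e a ≡ z) → Dec (e b ≡ z) → ⊥
        at (yes refl) (no ne) = proj₁ (proj₂ (tiny b ne)) (∪ˡ e∈)
        at (no ne) (yes refl) = proj₁ (proj₂ (tiny a ne)) (∪ˡ f∈)
        at (no ne) (no ne′)   = proj₂ (proj₂ (tiny a ne)) (∈nb (~-sym (proj₁ (tiny b ne′))) f∈)
        at (yes eq) (yes eq′) = let (q , f , b∈ , _ , ne) = twoQ (e a) in
          Q-ind f (By.T⊑F e∈) b∈ (By.T⊑P e∈) (subst (_~ q) (trans eq′ (sym eq)) (Bx.complete f∈ (toR a f b∈ ne)))

      result : Adm k F P Q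
      result with Bx.kind | By.kind
      ... | inj₁ tk | inj₁ tk′ = Bx.twins (X.alike Bx.T⊑F Bx.T⊑P (X.pair-large {Bx.T} twoQ tk) (λ f p ne → By.T⊑P (tk′ f p ne)) tk)
      ... | inj₂ a | inj₁ tk′ = ⊥-elim (mixed twoP P-ind Bx.T⊑F Bx.T⊑P By.T⊑P Bx.complete (≤-trans (s≤s z≤n) (small a)) tk′ (e a) (toR a))
      ... | inj₁ tk | inj₂ b = ⊥-elim (mixed twoQ Q-ind By.T⊑F By.T⊑P Bx.T⊑P By.complete (≤-trans (s≤s z≤n) (small b)) tk (e b) (toR b))
      ... | inj₂ a | inj₂ b = ⊥-elim (clash a b)

    result : Adm k F P Q
    result = [ id , (λ twoQ → [ Adm-rev , (λ twoP → cases twoQ twoP (edge? F P) (edge? F Q)) ]′ Y.several) ]′ X.several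
      where
      Edge : Sub n → Set
      Edge A = ∃[ u ] ∃[ v ] u ∈ F ∩ A × v ∈ F ∩ A × u ~ v
      not-both : ∀ {A T} → Independent F A → Clique T → ∃[ a ] ∃[ b ] a ∈ T × b ∈ T × a ≢ b × a ∈ F ∩ A × b ∈ F ∩ A → ⊥
      not-both ind clique (u , v , u∈ , v∈ , ne , a , b) = ind (∩ˡ b) (∩ˡ a) (∩ʳ {S = F} b) (∩ʳ {S = F} a) (clique u∈ v∈ ne)
      cases : Several F Q z → Several F P z → Edge P ⊎ Independent F P → Edge Q ⊎ Independent F Q → Adm k F P Q
      cases twoQ twoP (inj₁ a) (inj₁ b) =
        [ id , (λ s → [ Adm-rev , both-cliques twoQ s ]′ (Y.with-edge twoP b)) ]′ (X.with-edge twoQ a)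
      cases twoQ twoP (inj₁ a) (inj₂ Q-ind) =
        [ id , (λ { (T , (_ , _ , clique , _) , tk) → ⊥-elim (not-both Q-ind clique (X.pair {T} twoQ tk)) }) ]′ (X.with-edge twoQ a)
      cases twoQ twoP (inj₂ P-ind) (inj₁ b) =
        [ Adm-rev , (λ { (T , (_ , _ , clique , _) , tk) → ⊥-elim (not-both P-ind clique (Y.pair {T} twoP tk)) }) ]′ (Y.with-edge twoP b)
      cases twoQ twoP (inj₂ P-ind) (inj₂ Q-ind) =
        [ id , (λ x → [ Adm-rev , Opposite.result twoP twoQ P-ind Q-ind x ]′ (Y.bipartite twoP Q-ind P-ind)) ]′ (X.bipartite twoQ P-ind Q-ind)

  claim : ∀ F P Q z k → 1 ≤ k → Claim F P Q z k
  claim F P Q z k = go (suc (# F)) F P Q z k ≤-refl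
    where
    go : ∀ m F P Q z k → # F < m → 1 ≤ k → Claim F P Q z k
    go (suc m) F P Q z (suc zero) _ _ rg (u , f , _) _ = one-path rg f
    go (suc m) F P Q z k@(suc (suc _)) (s≤s h) _ rg w₀ degF =
      Step.result record { F = F ; P = P ; Q = Q ; z = z ; k = k ; k≥2 = s≤s (s≤s z≤n) ; rg = rg ; degF = degF
                         ; below = λ F′ P′ Q′ z′ k′ l → go m F′ P′ Q′ z′ k′ (≤-trans l h) } w₀

-- From blocks and end-blocks to rooted graphs, and from walks back to paths.

open import Data.Maybe using (Maybe; just; nothing)
open import Defs using (TwoConnectedRooted; NotRoot; δ≥; deg; AdmissiblePaths)

module Translation {n : ℕ} (G : Graph n) where

  open import Data.Fin using (toℕ; inject₁)
  open import Data.List using (map; tabulate)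
  open import Data.Nat.ListAction using (sum)
  open import Data.Unit using (tt)
  open import Defs using (Reach; here; step; ConnectedOn; CutVertexOn; CutVertex; All; Connected; IsBlockish; IsEndBlock; VSet;
                          TwoConnectedRooted; NotRoot; δ≥; deg; PathLen; AdmissiblePaths)

  open Walks G
  open Rooted G
  open Families G

  full : Sub n
  full = set (λ _ → yes tt)

  ∈full : ∀ {u} → u ∈ full
  ∈full = ∈set (λ _ → yes tt) tt

  reach-start : ∀ {S : VSet G} {a b} → Reach G S a b → S a
  reach-start (here s)     = s
  reach-start (step s _ _) = s

  reach-closed : ∀ {S : VSet G} {C : Sub n} {a b} → (∀ {u w} → u ∈ C → S w → u ~ w → w ∈ C) → Reach G S a b → a ∈ C → b ∈ C
  reach-closed h (here _)       m = m
  reach-closed h (step _ e r) m = reach-closed h r (h m (reach-start r) (mem e))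

  walk-reach : ∀ {S a b c} → Walk S a b c → Reach G (_∈ S) a b
  walk-reach = go id
    where
    go : ∀ {S R a b c} → R ⊑ S → Walk R a b c → Reach G (_∈ S) a b
    go i (one s)      = here (i s)
    go i (cons s e p) = step (i s) (holds e) (go (i ∘ ∖ˡ) p)

  reach-map : ∀ {S S′ : VSet G} {a b} → (∀ {u} → S u → S′ u) → Reach G S a b → Reach G S′ a b
  reach-map i (here s)     = here (i s)
  reach-map i (step s e r) = step (i s) e (reach-map i r)

  closed-complement : ∀ {S D} → Closed S D → Closed S (S ─ D)
  closed-complement {S} {D} c = record { sub = ─ˡ ; cl = λ m s e → ─⁺ s λ d → ─ʳ {S = S} m (cl c d (─ˡ m) (~-sym e)) }

  -- Both the component of `a` and its complement are closed, and one of them avoids `v`.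
  separate : ∀ {S a b} v → a ∈ S → b ∈ S → ¬ Reach G (_∈ S) a b →
             ∃[ D ] Closed S D × v ∉ D × (∃[ d ] d ∈ D) × (∃[ o ] o ∈ S × o ∉ D × (o ≡ a ⊎ o ≡ b))
  separate {S} {a} {b} v a∈ b∈ h with v ∈? Comp.D (comp S a a∈)
  ... | no g = Comp.D K , Comp.closed K , g , (a , Comp.base K) , b , b∈ , b∉ , inj₂ refl
    where
    K = comp S a a∈
    b∉ : b ∉ Comp.D K
    b∉ m = h (walk-reach (walk-mono (sub (Comp.closed K)) (proj₂ (Comp.reach K m))))
  ... | yes m = S ─ Comp.D K , closed-complement (Comp.closed K) , (λ m′ → ─ʳ {S = S} m′ m) , (b , ─⁺ b∈ b∉)
              , a , a∈ , (λ m′ → ─ʳ {S = S} m′ (Comp.base K)) , inj₁ refl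
    where
    K = comp S a a∈
    b∉ : b ∉ Comp.D K
    b∉ m = h (walk-reach (walk-mono (sub (Comp.closed K)) (proj₂ (Comp.reach K m))))

  module Escape (x y : V) (x≢y : x ≢ y) (connected : Connected G)
                (ends : ∀ B → IsEndBlock G B → (B x × ¬ CutVertex G x) ⊎ (B y × ¬ CutVertex G y)) where

    whole : ∀ {C u v} → Closed full C → u ∈ C → v ∈ C
    whole c m = reach-closed (λ m′ _ e → cl c m′ ∈full e) (proj₂ connected _ _ tt tt) m

    -- A smallest part C of G − v without roots would make C ∪ {v} an end-block whose
    -- only possible root v is a cut-vertex.
    escape : ∀ m {C v u} → # C < m → Closed (full ∖ v) C → u ∈ C → x ∉ C → y ∉ C → ⊥
    escape (suc m) {C} {v} {c} (s≤s small) closed c∈ x∉ y∉ = conclude (ends (_∈ B) end-block)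
      where
      B : Sub n
      B = C ∪ ｛ v ｝
      v∉C : v ∉ C
      v∉C s = ∖ʳ (sub closed s) refl
      c≢v : ∀ {u} → u ∈ C → u ≢ v
      c≢v s = ∖ʳ (sub closed s)
      v∈B : v ∈ B
      v∈B = ∪ʳ {S = C} ∈｛｝
      B⁻ : ∀ {u} → u ∈ B → u ≢ v → u ∈ C
      B⁻ s ne = [ id , (λ e → ⊥-elim (ne (｛｝∈ e))) ]′ (∪⁻ s)
      smaller : ∀ {D u d} → Closed (full ∖ u) D → d ∈ D → D ⊑ C → (∃[ o ] o ∈ C × o ∉ D) → ⊥
      smaller cD d∈ i (o , o∈ , o∉) = escape m (≤-trans (#-strict i o∈ o∉) small) cD d∈ (x∉ ∘ i) (y∉ ∘ i)

      stay : ∀ {u w} → u ∈ C → u ~ w → w ∈ B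
      stay {w = w} s e with w Fin.≟ v
      ... | yes refl = v∈B
      ... | no ne    = ∪ˡ (cl closed s (∖⁺ ∈full ne) e)

      -- Edges leave `C` only towards `v`, so a closed set avoiding `v` would be closed in all of
      -- the connected graph.
      through-v : ∀ {D d} → Closed B D → d ∈ D → v ∈ D
      through-v {D} cD d∈ with v ∈? D
      ... | yes s = s
      ... | no g  = whole {D} (record { sub = λ _ → ∈full ; cl = λ s _ e → cl cD s (stay (B⁻ (sub cD s) λ { refl → g s }) e) e }) d∈

      connectedB : ConnectedOn G (_∈ B)
      connectedB = (v , v∈B) , λ a b a∈ b∈ → walk-reach (walk-mono (sub (Comp.closed (comp B a a∈))) (proj₂ (Comp.reach (comp B a a∈) (reached a∈ b∈))))
        where
        reached : ∀ {a b} (a∈ : a ∈ B) → b ∈ B → b ∈ Comp.D (comp B a a∈)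
        reached {a} {b} a∈ b∈ with b ∈? Comp.D (comp B a a∈)
        ... | yes s = s
        ... | no g  = ⊥-elim (─ʳ {S = B} (through-v (closed-complement K) (─⁺ b∈ g)) (through-v K (Comp.base (comp B a a∈))))
          where K = Comp.closed (comp B a a∈)

      -- The side avoiding `v` lies in `C` and contradicts its minimality: it misses `u` or, for
      -- `u = v`, the vertices of the other side.
      no-cut : ∀ u → ¬ CutVertexOn G (_∈ B) u
      no-cut u (u∈ , a , b , a∈ , b∈ , a≢ , b≢ , h) with separate v (∖⁺ a∈ a≢) (∖⁺ b∈ b≢) (h ∘ reach-map λ s → ∖ˡ s , ∖ʳ s)
      ... | D , cD , v∉D , (d , d∈) , o , o∈ , o∉ , _ = smaller {D} {u} (record { sub = λ s → ∖⁺ ∈full (∖ʳ (sub cD s)) ; cl = λ s f e → cl cD s (∖⁺ (stay (i s) e) (∖ʳ f)) e }) d∈ i other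
        where
        i : D ⊑ C
        i s = B⁻ (∖ˡ (sub cD s)) λ { refl → v∉D s }
        other : ∃[ o ] o ∈ C × o ∉ D
        other with u Fin.≟ v
        ... | yes refl = o , B⁻ (∖ˡ o∈) (∖ʳ o∈) , o∉
        ... | no ne = u , B⁻ u∈ ne , λ s → ∖ʳ (sub cD s) refl

      maximal : ∀ T → (∀ u → u ∈ B → T u) → IsBlockish G T → ∀ u → T u → u ∈ B
      maximal T i (_ , nc) u t with u ∈? B
      ... | yes s = s
      ... | no g = ⊥-elim (nc v (i v v∈B , c , u , i c (∪ˡ c∈) , t , c≢v c∈ , (λ { refl → g v∈B }) ,
                     λ r → g (∪ˡ (reach-closed (λ s w e → cl closed s (∖⁺ ∈full (proj₂ w)) e) r c∈))))

      -- Otherwise the side of the graph without `u` that avoids `v` lies in `C`, since its part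
      -- outside `C` would be closed in the whole graph. It misses `u`, against minimality.
      cut-is-v : ∀ {u} → u ∈ B → CutVertex G u → u ≡ v
      cut-is-v {u} u∈ (_ , a , b , _ , _ , a≢ , b≢ , h) with u Fin.≟ v
      ... | yes eq = eq
      ... | no ne with separate v (∖⁺ ∈full a≢) (∖⁺ ∈full b≢) (h ∘ reach-map λ s → tt , ∖ʳ s)
      ... | D , cD , v∉D , (d , d∈) , _ = ⊥-elim (smaller cD d∈ (λ s → i s) (u , u∈C , λ s → ∖ʳ (sub cD s) refl))
        where
        u∈C : u ∈ C
        u∈C = B⁻ u∈ ne
        outside : Closed full (D ─ C)
        outside = record { sub = λ _ → ∈full ; cl = go }
          where
          go : ∀ {s w} → s ∈ D ─ C → w ∈ full → s ~ w → w ∈ D ─ C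
          go {s} {w} s∈ _ e with w ∈? C
          ... | yes w∈ = ⊥-elim (─ʳ {S = D} s∈ (cl closed w∈ (∖⁺ ∈full λ { refl → v∉D (─ˡ s∈) }) (~-sym e)))
          ... | no w∉  = ─⁺ (cl cD (─ˡ s∈) (∖⁺ ∈full λ { refl → w∉ u∈C }) e) w∉
        i : D ⊑ C
        i {s} s∈ with s ∈? C
        ... | yes y = y
        ... | no g  = ⊥-elim (v∉D (─ˡ (whole outside (─⁺ s∈ g))))

      end-block : IsEndBlock G (_∈ B)
      end-block = ((connectedB , no-cut) , maximal) , λ u w u∈ w∈ cu cw → trans (cut-is-v u∈ cu) (sym (cut-is-v w∈ cw))

      v-cuts : ∀ {o} → o ∉ C → o ≢ v → CutVertex G v
      v-cuts {o} o∉ ne = tt , c , o , tt , tt , c≢v c∈ , ne , λ r → o∉ (reach-closed (λ s w e → cl closed s (∖⁺ ∈full (proj₂ w)) e) r c∈)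

      conclude : (x ∈ B × ¬ CutVertex G x) ⊎ (y ∈ B × ¬ CutVertex G y) → ⊥
      conclude (inj₁ (x∈ , nc)) with x Fin.≟ v
      ... | no ne    = x∉ (B⁻ x∈ ne)
      ... | yes refl = nc (v-cuts y∉ (x≢y ∘ sym))
      conclude (inj₂ (y∈ , nc)) with y Fin.≟ v
      ... | no ne    = y∉ (B⁻ y∈ ne)
      ... | yes refl = nc (v-cuts x∉ x≢y)

    F : Sub n
    F = full ∖ x ∖ y

    ∈F : ∀ {u} → u ≢ x → u ≢ y → u ∈ F
    ∈F a b = ∖⁺ (∖⁺ ∈full a) b

    x∉F : x ∉ F
    x∉F m = ∖ʳ (∖ˡ m) refl

    -- Passes from sets closed in `F` to sets closed in the graph without `v`. Only roots other than
    -- `v` need to be non-adjacent to `C`, so taking the opposite root for `v` yields `rgP` and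
    -- `rgQ`.
    enclosed : ∀ v {C u} → u ∈ C → C ⊑ F → C ⊑ full ∖ v → (∀ {u w} → u ∈ C → w ∈ full ∖ v → u ~ w → w ∈ F → w ∈ C) →
               (∀ {u} → u ∈ C → x ≢ v → u ∉ N x) → (∀ {u} → u ∈ C → y ≢ v → u ∉ N y) → ⊥
    enclosed v {C} m i j h hx hy = escape _ ≤-refl (record { sub = j ; cl = go }) m (x∉F ∘ i) (λ s → ∉∖ (i s))
      where
      go : ∀ {u w} → u ∈ C → w ∈ full ∖ v → u ~ w → w ∈ C
      go {w = w} s f e with w Fin.≟ x | w Fin.≟ y
      ... | yes refl | _ = ⊥-elim (hx s (∖ʳ f) (~-sym e))
      ... | no _ | yes refl = ⊥-elim (hy s (∖ʳ f) (~-sym e))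
      ... | no a | no b = h s f e (∈F a b)

    rooted : RG F (N x) (N y)
    rooted = record
      { rgP = λ {C} c m → otherwise (meets? C (N x)) λ g →
          enclosed y m (sub c) (λ s → ∖⁺ ∈full (∖ʳ (sub c s))) (λ s _ e f → cl c s f e) (λ s _ → g s) (λ _ ne → ⊥-elim (ne refl))
      ; rgQ = λ {C} c m → otherwise (meets? C (N y)) λ g →
          enclosed x m (sub c) (λ s → ∖⁺ ∈full (∖ʳ (∖ˡ (sub c s)))) (λ s _ e f → cl c s f e) (λ _ ne → ⊥-elim (ne refl)) (λ s _ → g s)
      ; rgX = λ w {C} c m → otherwise (meets? C (N x ∪ N y)) λ g →
          enclosed w m (∖ˡ ∘ sub c) (λ s → ∖⁺ ∈full (∖ʳ (sub c s))) (λ s f e f′ → cl c s (∖⁺ f′ (∖ʳ f)) e)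
            (λ s _ a → g s (∪ˡ a)) (λ s _ a → g s (∪ʳ {S = N x} a)) }
      where
      otherwise : ∀ {C A} → Meets C A ⊎ Misses C A → (Misses C A → ⊥) → Meets C A
      otherwise (inj₁ r) _ = r
      otherwise (inj₂ g) h = ⊥-elim (h g)

    deg-total : ∀ u → deg G u ≡ # (N u)
    deg-total u = go id
      where
      go : ∀ {m} (g : Fin m → V) → sum (map (λ w → if adj G u w then 1 else 0) (tabulate g)) ≡ total (λ i → bit (N u (g i)))
      go {zero}  g = refl
      go {suc m} g = cong (bit (N u (g zero)) +_) (go (g ∘ suc))

    degree : ∀ u → deg G u ≤ dg F u + bit (N x u) + bit (N y u)
    degree u = lin 7 (λ d s f xy a b₁ b₂ → d ≼ s ⇛ s ≼ f ⊕ xy ⇛ xy ≼ b₁ ⊕ b₂ ⇛ ⊢ d ≼ f ⊕ b₁ ⊕ b₂) refl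
      (deg G u) (# (N u)) (dg F u) (dg (｛ x ｝ ∪ ｛ y ｝) u) 0 (bit (N x u)) (bit (N y u)) (≤-reflexive (deg-total u))
      (#-cover {S = N u} {N u ∩ F} {N u ∩ (｛ x ｝ ∪ ｛ y ｝)} λ {w} e → [ (λ f → inj₁ (∩⁺ e f)) , (λ r → inj₂ (∩⁺ e r)) ]′ (part w))
      (≤-trans (dg-cover {｛ x ｝ ∪ ｛ y ｝} {｛ x ｝} {｛ y ｝} λ _ → ∪⁻) (+-mono-≤ (dg-one {｛ x ｝} x λ _ → ｛｝∈) (dg-one {｛ y ｝} y λ _ → ｛｝∈)))
      where
      part : ∀ w → w ∈ F ⊎ w ∈ ｛ x ｝ ∪ ｛ y ｝
      part w with w Fin.≟ x | w Fin.≟ y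
      ... | yes refl | _ = inj₂ (∪ˡ ∈｛｝)
      ... | no _ | yes refl = inj₂ (∪ʳ {S = ｛ x ｝} ∈｛｝)
      ... | no a | no b = inj₁ (∈F a b)

  record Trail (S : Sub n) (u v : V) (ℓ : ℕ) : Set where
    field
      path   : PathLen G u v ℓ
      inside : ∀ i → PathLen.vs path i ∈ S

  walk-trail : ∀ {ℓ S u v} → Walk S u v (suc ℓ) → Trail S u v ℓ
  walk-trail {zero} {u = u} (one s) = record
    { path = record { vs = λ _ → u ; inj = λ { {zero} {zero} _ → refl } ; edges = λ () ; start = refl ; finish = refl }
    ; inside = λ _ → s }
  walk-trail {suc ℓ} {S} {u} (cons s e p) = record
    { path = record { vs = vs ; inj = λ {i} {j} → inj {i} {j} ; edges = edges ; start = refl ; finish = T.finish }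
    ; inside = λ { zero → s ; (suc i) → ∖ˡ (inside i) } }
    where
    open Trail (walk-trail p)
    module T = PathLen path
    vs : Fin (2 + ℓ) → V
    vs zero    = u
    vs (suc i) = T.vs i
    inj : ∀ {i j} → vs i ≡ vs j → i ≡ j
    inj {zero}  {zero}  _  = refl
    inj {zero}  {suc j} eq = ⊥-elim (∖ʳ (inside j) (sym eq))
    inj {suc i} {zero}  eq = ⊥-elim (∖ʳ (inside i) eq)
    inj {suc i} {suc j} eq = cong suc (T.inj eq)
    edges : ∀ i → adj G (vs (inject₁ i)) (vs (suc i)) ≡ true
    edges zero    = subst (λ w → adj G u w ≡ true) (sym T.start) (holds e)
    edges (suc i) = T.edges i

  walk-size : ∀ {S u v c} → Walk S u v c → 1 ≤ c
  walk-size (one _)      = s≤s z≤n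
  walk-size (cons _ _ _) = s≤s z≤n

  admissible : ∀ {k x y} → 1 ≤ k → x ≢ y → Adm k (full ∖ x ∖ y) (N x) (N y) → AdmissiblePaths G k x y
  -- `c` vertices between `x` and `y` make `c + 1` edges; walks are non-empty, so there are at least
  -- two.
  admissible {k} {x} {y} k≥1 x≢y (a , d , d≡ , f) = suc a , d , s≤s a≥1 , d≡ , λ i → extend (f (toℕ i) (Fin.toℕ<n i))
    where
    a≥1 : 1 ≤ a
    a≥1 = let (_ , _ , _ , _ , w) = f 0 k≥1 in subst (1 ≤_) (+-identityʳ a) (walk-size w)
    extend : ∀ {c} → AB (full ∖ x ∖ y) (N x) (N y) c → PathLen G x y (suc c)
    extend (s , t , p , b , w) = Trail.path (walk-trail (cons ∈full p (append w ∖ˡ (∖⁺ ∈full (x≢y ∘ sym)) ∉∖ (~-sym b))))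

theorem3 : (k : ℕ) → 1 ≤ k → (n : ℕ) → (G : Graph n) → (x y : Fin n) →
           (z : Maybe (Fin n)) → TwoConnectedRooted G x y →
           δ≥ G x y z (k + 1) → AdmissiblePaths G k x y
theorem3 k k≥1 n G x y z (x≢y , (connected , _) , ends) (v₀ , degs) = admissible k≥1 x≢y (paths z v₀ degs)
  where
  open Translation G
  open Escape x y x≢y connected ends
  open Walks G using (N; V; Adm)
  open Conclusion G using (claim)
  paths : ∀ z → ∃[ v ] NotRoot G x y z v → (∀ v → NotRoot G x y z v → k + 1 ≤ deg G v) → Adm k F (N x) (N y)
  paths (just z) (v , a , b , c) h = claim F (N x) (N y) z k k≥1 rooted (v , ∈F a b , c)
    λ {u} m ne → ≤-trans (h u (∖ʳ (∖ˡ m) , ∖ʳ m , ne)) (degree u)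
  -- `x` is not in `F`, so as an exception it excepts nothing.
  paths nothing (v , a , b) h = claim F (N x) (N y) x k k≥1 rooted (v , ∈F a b , a)
    λ {u} m _ → ≤-trans (h u (∖ʳ (∖ˡ m) , ∖ʳ m)) (degree u)
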